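{- Fix an integer $k\ge 1$. The family of graphs of catwidth at most $k$ has light spanners: for every $\epsilon>0$ there is a bound $f(\epsilon)$ (depending only on $\epsilon$ and $k$) such that every connected graph $G$ of catwidth at most $k$, with any nonnegative edge weights $w$, has a $(1+\epsilon)$-spanner $G'$ with $w(G')\le f(\epsilon)\cdot \mathrm{MST}(G)$. Moreover, such a spanner is computable by a greedy algorithm.
   Context: For a connected graph $G$ with edge weights $w(e)\ge 0$, $d_G(u,v)$ is the shortest-path distance. A spanning subgraph $G'$ of $G$ (with inherited weights) is a $(1+\epsilon)$-spanner if $d_{G'}(u,v)\le(1+\epsilon)d_G(u,v)$ for all vertices $u,v$. $w(G')$ is the total edge weight of $G'$ and $\mathrm{MST}(G)$ is the minimum weight of a spanning tree of $G$. A tree decomposition of $G=(V,E)$ is a tree $T$ with bags $B_i\subseteq V$ ($i\in V(T)$) such that the bags cover $V$, every edge lies in some bag, and for every vertex the bags containing it form a connected subtree; its width is the maximum bag size minus one. A caterpillar is a path with added pendant leaves; the catwidth of $G$ is the minimum width of a tree decomposition of $G$ whose underlying tree is a caterpillar. The greedy algorithm referred to is: start with $G'$ equal to a chosen spanning tree $T$ of $G$, then process the edges $e=\{u,v\}$ of $G-T$ in nondecreasing order of weight, adding $e$ to $G'$ whenever $(1+\epsilon)w(e)<d_{G'}(u,v)$.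
   Formalization: The edge weights w and the parameter ε are rational numbers rather than arbitrary nonnegative (respectively positive) real numbers; the bound f(ε) is accordingly given for rational ε. -}

module Defs where

open import Data.Nat using (ℕ; zero; suc; _≤_)
import Data.Nat as ℕ
open import Data.Fin using (Fin; toℕ; _≟_)
open import Data.Fin.Subset using (Subset; _∈_; ∣_∣)
open import Data.Bool using (Bool; true; false; _∨_; _∧_)
open import Data.List using (List; []; _∷_; _++_; [_]; length; map; allFin; foldr; filter)
open import Data.List.Relation.Unary.All using (All)
open import Data.List.Relation.Unary.Linked using (Linked)
open import Data.List.Relation.Unary.Unique.Propositional using (Unique)
import Data.List.Membership.Propositional as LMem
open import Data.Product using (Σ; ∃; ∃-syntax; _×_; _,_)
open import Data.Sum using (_⊎_)
open import Data.Rational using (ℚ; 0ℚ; 1ℚ; _+_; _*_) renaming (_≤_ to _≤ℚ_; _<_ to _<ℚ_)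
open import Relation.Binary.PropositionalEquality using (_≡_)
open import Relation.Nullary using (¬_)
open import Relation.Nullary.Decidable using (⌊_⌋)

Adj : ℕ → Set
Adj n = Fin n → Fin n → Bool

Edge : ∀ {n} → Adj n → Fin n → Fin n → Set
Edge A u v = A u v ≡ true

IsGraph : ∀ {n} → Adj n → Set
IsGraph {n} A = (∀ u v → A u v ≡ A v u) × (∀ u → A u u ≡ false)

_⊆ᴳ_ : ∀ {n} → Adj n → Adj n → Set
H ⊆ᴳ G = ∀ u v → Edge H u v → Edge G u v

data Walk {n} (A : Adj n) : Fin n → Fin n → Set where
  [] : ∀ {u} → Walk A u u
  _∷_ : ∀ {u v x} → Edge A u v → Walk A v x → Walk A u x

verts : ∀ {n} {A : Adj n} {u v} → Walk A u v → List (Fin n)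
verts {u = u} [] = u ∷ []
verts {u = u} (_ ∷ p) = u ∷ verts p

len : ∀ {n} {A : Adj n} → (Fin n → Fin n → ℚ) → ∀ {u v} → Walk A u v → ℚ
len w [] = 0ℚ
len w (_∷_ {u} {v} _ p) = w u v + len w p

Connected : ∀ {n} → Adj n → Set
Connected {n} A = ∀ (u v : Fin n) → Walk A u v

HasCycle : ∀ {n} → Adj n → Set
HasCycle {n} A = Σ (Fin n) λ x → Σ (List (Fin n)) λ ys →
  (2 ≤ length ys) × Unique (x ∷ ys) × Linked (Edge A) (x ∷ ys ++ [ x ])

Acyclic : ∀ {n} → Adj n → Set
Acyclic A = ¬ HasCycle A

IsTree : ∀ {n} → Adj n → Set
IsTree A = IsGraph A × Connected A × Acyclic A

SpanningTree : ∀ {n} → Adj n → Adj n → Set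
SpanningTree G T = T ⊆ᴳ G × IsTree T

sumℚ : List ℚ → ℚ
sumℚ = foldr _+_ 0ℚ

weight : ∀ {n} → (Fin n → Fin n → ℚ) → Adj n → ℚ
weight {n} w A = sumℚ (Data.List.concatMap (λ u → map (λ v →
  if' (A u v ∧ ⌊ toℕ u ℕ.<? toℕ v ⌋) (w u v)) (allFin n)) (allFin n))
  where
  if' : Bool → ℚ → ℚ
  if' true q = q
  if' false q = 0ℚ

IsSpanner : ∀ {n} → Adj n → (Fin n → Fin n → ℚ) → ℚ → Adj n → Set
IsSpanner {n} G w ε H = IsGraph H × H ⊆ᴳ G ×
  (∀ (u v : Fin n) (P : Walk G u v) →
     Σ (Walk H u v) λ Q → len w Q ≤ℚ ((1ℚ + ε) * len w P))

-- weight(H) ≤ c · MST(G), i.e. ≤ c · weight(T) for every spanning tree T of G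
Light : ∀ {n} → Adj n → (Fin n → Fin n → ℚ) → ℚ → Adj n → Set
Light G w c H = ∀ T → SpanningTree G T → weight w H ≤ℚ (c * weight w T)

MinSpanningTree : ∀ {n} → Adj n → (Fin n → Fin n → ℚ) → Adj n → Set
MinSpanningTree G w T = SpanningTree G T × (∀ T' → SpanningTree G T' → weight w T ≤ℚ weight w T')

IsCaterpillar : ∀ {m} → Adj m → Set
IsCaterpillar {m} T = IsTree T × Σ (List (Fin m)) λ spine →
  Linked (Edge T) spine × Unique spine ×
  (∀ i → LMem._∈_ i spine ⊎
     Σ (Fin m) λ j → LMem._∈_ j spine × Edge T i j × (∀ j' → Edge T i j' → j' ≡ j))

record CaterpillarDecomposition {n} (G : Adj n) (k : ℕ) : Set where
  field
    m : ℕ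
    tree : Adj m
    caterpillar : IsCaterpillar tree
    bag : Fin m → Subset n
    cover : ∀ (v : Fin n) → Σ (Fin m) λ i → v ∈ bag i
    edgeCover : ∀ u v → Edge G u v → Σ (Fin m) λ i → u ∈ bag i × v ∈ bag i
    coherent : ∀ (v : Fin n) (i j : Fin m) → v ∈ bag i → v ∈ bag j →
      Σ (Walk tree i j) λ p → All (λ x → v ∈ bag x) (verts p)
    width : ∀ i → ∣ bag i ∣ ≤ suc k

CatwidthAtMost : ∀ {n} → Adj n → ℕ → Set
CatwidthAtMost G k = CaterpillarDecomposition G k

addEdge : ∀ {n} → Adj n → Fin n → Fin n → Adj n
addEdge A u v x y = A x y ∨ ((⌊ x ≟ u ⌋ ∧ ⌊ y ≟ v ⌋) ∨ (⌊ x ≟ v ⌋ ∧ ⌊ y ≟ u ⌋))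

-- Greedy w ε H es H' : processing the edge list es in order starting from H
-- yields H'.  Edge {u,v} is added iff (1+ε) w(u,v) < d_H(u,v) (d = ∞ if no walk).
data Greedy {n} (w : Fin n → Fin n → ℚ) (ε : ℚ) : Adj n → List (Fin n × Fin n) → Adj n → Set where
  done : ∀ {H} → Greedy w ε H [] H
  add : ∀ {H u v es H'} →
    (∀ (P : Walk H u v) → ((1ℚ + ε) * w u v) <ℚ len w P) →
    Greedy w ε (addEdge H u v) es H' → Greedy w ε H ((u , v) ∷ es) H'
  skip : ∀ {H u v es H'} →
    (Σ (Walk H u v) λ P → len w P ≤ℚ ((1ℚ + ε) * w u v)) →
    Greedy w ε H es H' → Greedy w ε H ((u , v) ∷ es) H'

ValidOrder : ∀ {n} → Adj n → (Fin n → Fin n → ℚ) → Adj n → List (Fin n × Fin n) → Set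
ValidOrder {n} G w T es =
  Unique es ×
  (∀ u v → LMem._∈_ (u , v) es ⇔' (Edge G u v × ¬ Edge T u v × toℕ u ℕ.< toℕ v)) ×
  Linked (λ e f → w (Data.Product.proj₁ e) (Data.Product.proj₂ e) ≤ℚ w (Data.Product.proj₁ f) (Data.Product.proj₂ f)) es
  where
  _⇔'_ : Set → Set → Set
  P ⇔' Q = (P → Q) × (Q → P)

{-# OPTIONS --safe #-}

-- A greedy spanner H satisfies a gap condition: every detour around a non-tree edge e = {x,y} is longer
-- than (1 + ε) w(e).  We bound the weight of its non-tree edges by a sweep.
--
-- A caterpillar decomposition of width k yields a linear order of the vertices in which every prefix has
-- a boundary of at most q = 2(k + 1) vertices.  Sweep along this order, inserting the non-tree edges
-- into the tree when their later endpoint is reached, and let D be the current shortest-path metric.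
-- The potential is the maximum of Σ min(D(x,y), r(x), r(y)) over pairs x, y of the boundary and over
-- radii r with min(r(x), r(y)) ≤ K · dT(x,y) for x ≠ y.  By this constraint clusters of nearby boundary
-- vertices count only once, so that
--   * inserting an edge e lowers the potential by at least κ w(e), where κ = ε / 5: after raising the
--     radii of a vertex near x and of a vertex near y, this pair feels the drop of D(x,y);
--   * a new vertex at tree distance a from the boundary raises the potential by O(q² K a);
--   * forgetting a vertex does not raise it.
-- The distances a sum up to at most (q + 1) w(T): contract the tree edges already swept and consider
-- the sum J over all swept vertices of the contracted distance to the earlier ones.  Only the oldest
-- vertex of each swept component contributes, there are at most q of these, and so sweeping tree edges
-- of weight g lowers J by at most q g, whereas a new vertex adds its distance a to J.
--
-- For the existence statement run the greedy algorithm on the empty graph.  The tree T to compare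
-- with need not lie in the resulting spanner, but the detours of its edges form a connected subgraph of
-- weight at most (1 + ε) w(T), and the sweep only uses that the subgraph is connected.

module Submission where

open import Defs
open import Data.Nat using (ℕ; zero; suc; _≤_; z≤n; s≤s)
import Data.Nat as ℕ
import Data.Nat.Properties as ℕₚ
import Data.Integer as ℤ
open import Data.Bool using (true; false; not; _∨_; _∧_; T)
import Data.Bool.Properties as Boolₚ
open import Data.Fin using (Fin; toℕ; _≟_)
import Data.Fin.Properties as Finₚ
open import Data.Fin.Subset using (Subset; ∣_∣) renaming (_∈_ to _∈ˢ_)
open import Data.Fin.Subset.Properties using () renaming (_∈?_ to _∈ˢ?_)
open import Data.List using (List; []; _∷_; _++_; [_]; length; map; concatMap; filter; allFin; cartesianProduct)
import Data.List.Properties as Listₚ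
open import Data.List.Membership.Propositional using (_∈_; _∉_; find; lose)
open import Data.List.Membership.Propositional.Properties
open import Data.List.Relation.Binary.Subset.Propositional using (_⊆_)
open import Data.List.Relation.Unary.All as All using (All; []; _∷_)
import Data.List.Relation.Unary.All.Properties as Allₚ
open import Data.List.Relation.Unary.Any as Any using (here; there)
open import Data.List.Relation.Unary.AllPairs using (AllPairs; []; _∷_)
open import Data.List.Relation.Unary.Linked using (Linked; []; [-]; _∷_)
import Data.List.Relation.Unary.Linked.Properties as Linkedₚ
import Data.List.Relation.Binary.Permutation.Propositional as Perm
import Data.List.Relation.Binary.Permutation.Propositional.Properties as Permₚ
import Data.List.Relation.Binary.Permutation.Setoid.Properties as PermSetoidₚ
import Data.List.Sort as Sort
import Data.Vec as Vec
import Relation.Binary.Construct.On as On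
import Relation.Binary.Construct.Closure.ReflexiveTransitive as Star
import Relation.Binary.Construct.Flip.EqAndOrd as Flip
open import Relation.Binary.Definitions using (tri<; tri≈; tri>)
open import Relation.Binary.Bundles using (DecTotalOrder)
open import Data.List.Relation.Unary.Unique.Propositional using (Unique)
import Data.List.Relation.Unary.Unique.Propositional.Properties as Uniqueₚ
open import Data.Maybe using (Maybe; just; nothing)
open import Data.Product using (Σ; ∃; _×_; _,_; proj₁; proj₂)
open import Data.Product.Properties using (≡-dec)
open import Data.Sum using (_⊎_; inj₁; inj₂; [_,_]′)
open import Data.Empty using (⊥; ⊥-elim)
open import Data.Rational using (ℚ; 0ℚ; 1ℚ; _+_; _*_; _-_; -_; _⊓_; _⊔_) renaming (_≤_ to _≤ℚ_; _<_ to _<ℚ_; ∣_∣ to absℚ)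
import Data.Rational as ℚ
import Data.Rational.Properties as ℚₚ
open import Function using (_∘_; id; case_of_)
open import Level using (0ℓ)
open import Relation.Binary.PropositionalEquality using (setoid; _≡_; _≢_; refl; sym; trans; cong; cong₂; subst; subst₂)
open import Relation.Nullary using (¬_; Dec; yes; no; ¬?)
open import Relation.Nullary.Decidable using (⌊_⌋; _×-dec_)
open import Relation.Binary.Construct.Closure.ReflexiveTransitive using (Star; _◅_) renaming (ε to nil)
open import Relation.Unary using (Decidable)
open import Tactic.RingSolver using (solve; solve-∀)
open import Tactic.RingSolver.Core.AlmostCommutativeRing using (AlmostCommutativeRing; fromCommutativeRing)

-- Rational inequalities and finite sums.

ℚ-ring : AlmostCommutativeRing 0ℓ 0ℓ
ℚ-ring = fromCommutativeRing ℚₚ.+-*-commutativeRing isZero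
  where
  isZero : ∀ x → Maybe (0ℚ ≡ x)
  isZero x with 0ℚ ℚₚ.≟ x
  ... | yes p = just p
  ... | no _ = nothing

+-cancel-+- : ∀ r p → p + r + (- r) ≡ p
+-cancel-+- r p = trans (ℚₚ.+-assoc p r (- r)) (trans (cong (p +_) (ℚₚ.+-inverseʳ r)) (ℚₚ.+-identityʳ p))

+-cancelʳ-≤ : ∀ {r p q} → p + r ≤ℚ q + r → p ≤ℚ q
+-cancelʳ-≤ {r} {p} {q} h = subst₂ _≤ℚ_ (+-cancel-+- r p) (+-cancel-+- r q) (ℚₚ.+-monoˡ-≤ (- r) h)

+-cancelʳ-< : ∀ {r p q} → p + r <ℚ q + r → p <ℚ q
+-cancelʳ-< {r} {p} {q} h = subst₂ _<ℚ_ (+-cancel-+- r p) (+-cancel-+- r q) (ℚₚ.+-monoˡ-< (- r) h)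

-- A linear inequality a ≤ b follows from a sum X ≤ Y of known ones as soon as b − a = Y − X.
lin : ∀ {a b X Y} → X ≤ℚ Y → b + X ≡ a + Y → a ≤ℚ b
lin {a} {b} {X} {Y} h e =
  +-cancelʳ-≤ {X} {a} {b} (ℚₚ.≤-trans (ℚₚ.+-monoʳ-≤ a h) (ℚₚ.≤-reflexive (sym e)))

lin< : ∀ {a b X Y} → X <ℚ Y → b + X ≡ a + Y → a <ℚ b
lin< {a} {b} {X} {Y} h e =
  +-cancelʳ-< {X} {a} {b} (ℚₚ.<-≤-trans (ℚₚ.+-monoʳ-< a h) (ℚₚ.≤-reflexive (sym e)))

infixl 6 _⊕_
_⊕_ : ∀ {a b c d} → a ≤ℚ b → c ≤ℚ d → a + c ≤ℚ b + d
_⊕_ = ℚₚ.+-mono-≤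

*-mono-nonneg : ∀ {c a b} → 0ℚ ≤ℚ c → a ≤ℚ b → c * a ≤ℚ c * b
*-mono-nonneg {c} c≥0 h = ℚₚ.*-monoˡ-≤-nonNeg c ⦃ ℚ.nonNegative c≥0 ⦄ h

*-nonneg : ∀ {a b} → 0ℚ ≤ℚ a → 0ℚ ≤ℚ b → 0ℚ ≤ℚ a * b
*-nonneg {a} {b} p q = subst (_≤ℚ a * b) (ℚₚ.*-zeroʳ a) (*-mono-nonneg p q)

+-nonneg : ∀ {a b} → 0ℚ ≤ℚ a → 0ℚ ≤ℚ b → 0ℚ ≤ℚ a + b
+-nonneg p q = p ⊕ q

≤-step : ∀ {a b c} → 0ℚ ≤ℚ c → a ≤ℚ b → a ≤ℚ b + c
≤-step {a} p q = subst (_≤ℚ _) (ℚₚ.+-identityʳ a) (q ⊕ p)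

infix 5 ∑
∑ : ∀ {A : Set} → List A → (A → ℚ) → ℚ
∑ [] f = 0ℚ
∑ (x ∷ xs) f = f x + ∑ xs f

module _ {A : Set} where

  ∑-mono : ∀ xs {f g : A → ℚ} → (∀ {x} → x ∈ xs → f x ≤ℚ g x) → ∑ xs f ≤ℚ ∑ xs g
  ∑-mono [] h = ℚₚ.≤-refl
  ∑-mono (x ∷ xs) h = h (here refl) ⊕ ∑-mono xs (h ∘ there)

  ∑-cong : ∀ xs {f g : A → ℚ} → (∀ {x} → x ∈ xs → f x ≡ g x) → ∑ xs f ≡ ∑ xs g
  ∑-cong [] h = refl
  ∑-cong (x ∷ xs) h = cong₂ _+_ (h (here refl)) (∑-cong xs (h ∘ there))

  ∑-nonneg : ∀ xs {f : A → ℚ} → (∀ {x} → x ∈ xs → 0ℚ ≤ℚ f x) → 0ℚ ≤ℚ ∑ xs f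
  ∑-nonneg [] h = ℚₚ.≤-refl
  ∑-nonneg (x ∷ xs) h = +-nonneg (h (here refl)) (∑-nonneg xs (h ∘ there))

  ∑-++ : ∀ xs ys (f : A → ℚ) → ∑ (xs ++ ys) f ≡ ∑ xs f + ∑ ys f
  ∑-++ [] ys f = sym (ℚₚ.+-identityˡ _)
  ∑-++ (x ∷ xs) ys f = trans (cong (f x +_) (∑-++ xs ys f)) (sym (ℚₚ.+-assoc (f x) _ _))

  ∑-+ : ∀ xs (f g : A → ℚ) → ∑ xs (λ x → f x + g x) ≡ ∑ xs f + ∑ xs g
  ∑-+ [] f g = refl
  ∑-+ (x ∷ xs) f g = trans (cong (f x + g x +_) (∑-+ xs f g)) (swap (f x) (g x) _ _)
    where
    swap : ∀ a b c d → a + b + (c + d) ≡ (a + c) + (b + d)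
    swap = solve-∀ ℚ-ring

  ∑-0 : ∀ (xs : List A) → ∑ xs (λ _ → 0ℚ) ≡ 0ℚ
  ∑-0 [] = refl
  ∑-0 (x ∷ xs) = trans (ℚₚ.+-identityˡ _) (∑-0 xs)

  ∑-*ˡ : ∀ xs c (f : A → ℚ) → ∑ xs (λ x → c * f x) ≡ c * ∑ xs f
  ∑-*ˡ [] c f = sym (ℚₚ.*-zeroʳ c)
  ∑-*ˡ (x ∷ xs) c f = trans (cong (c * f x +_) (∑-*ˡ xs c f)) (sym (ℚₚ.*-distribˡ-+ c _ _))

  ∑-member : ∀ xs {f : A → ℚ} → (∀ {x} → x ∈ xs → 0ℚ ≤ℚ f x) → ∀ {y} → y ∈ xs → f y ≤ℚ ∑ xs f
  ∑-member (x ∷ xs) {f} h (here refl) = ≤-step (∑-nonneg xs (h ∘ there)) ℚₚ.≤-refl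
  ∑-member (x ∷ xs) {f} h (there {_} {_} p) =
    ℚₚ.≤-trans (∑-member xs (h ∘ there) p) (lin (h (here refl)) (rearrange (f x) (∑ xs f)))
    where
    rearrange : ∀ a b → a + b + 0ℚ ≡ b + a
    rearrange = solve-∀ ℚ-ring

  ∑-mono-gap : ∀ xs {f g : A → ℚ} {δ} → (∀ {x} → x ∈ xs → f x ≤ℚ g x) →
    ∀ {y} → y ∈ xs → f y + δ ≤ℚ g y → ∑ xs f + δ ≤ℚ ∑ xs g
  ∑-mono-gap (x ∷ xs) {f} {g} {δ} h (here refl) p =
    lin (p ⊕ ∑-mono xs (h ∘ there)) (rearrange (f x) (g x) (∑ xs f) (∑ xs g) δ)
    where
    rearrange : ∀ a b c d e → b + d + (a + e + c) ≡ a + c + e + (b + d)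
    rearrange = solve-∀ ℚ-ring
  ∑-mono-gap (x ∷ xs) {f} {g} {δ} h (there q) p =
    lin (h (here refl) ⊕ ∑-mono-gap xs (h ∘ there) q p) (rearrange (f x) (g x) (∑ xs f) (∑ xs g) δ)
    where
    rearrange : ∀ a b c d e → b + d + (a + (c + e)) ≡ a + c + e + (b + d)
    rearrange = solve-∀ ℚ-ring

fromℕ : ℕ → ℚ
fromℕ zero = 0ℚ
fromℕ (suc k) = 1ℚ + fromℕ k

fromℕ-nonneg : ∀ k → 0ℚ ≤ℚ fromℕ k
fromℕ-nonneg zero = ℚₚ.≤-refl
fromℕ-nonneg (suc k) = +-nonneg (ℚₚ.nonNegative⁻¹ 1ℚ) (fromℕ-nonneg k)

fromℕ-mono : ∀ {j k} → j ≤ k → fromℕ j ≤ℚ fromℕ k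
fromℕ-mono {k = k} z≤n = fromℕ-nonneg k
fromℕ-mono (s≤s h) = ℚₚ.≤-refl {1ℚ} ⊕ fromℕ-mono h

∑-const : ∀ {A : Set} (xs : List A) c → ∑ xs (λ _ → c) ≡ fromℕ (length xs) * c
∑-const [] c = sym (ℚₚ.*-zeroˡ c)
∑-const (x ∷ xs) c = trans (cong (c +_) (∑-const xs c)) (distrib c (fromℕ (length xs)))
  where
  distrib : ∀ c k → c + k * c ≡ (1ℚ + k) * c
  distrib = solve-∀ ℚ-ring

∑-mono-const : ∀ {A : Set} xs {f g : A → ℚ} {c} → (∀ {x} → x ∈ xs → f x ≤ℚ g x + c) →
  ∑ xs f ≤ℚ ∑ xs g + fromℕ (length xs) * c
∑-mono-const xs {f} {g} {c} h = ℚₚ.≤-trans (∑-mono xs h)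
  (ℚₚ.≤-reflexive (trans (∑-+ xs g (λ _ → c)) (cong (∑ xs g +_) (∑-const xs c))))

-- Pseudometrics and the insertion of one edge.

module _ {n : ℕ} where

  record IsMetric (d : Fin n → Fin n → ℚ) : Set where
    field
      nonneg : ∀ x y → 0ℚ ≤ℚ d x y
      self : ∀ x → d x x ≡ 0ℚ
      symm : ∀ x y → d x y ≡ d y x
      tri : ∀ x y z → d x z ≤ℚ d x y + d y z

  private
    tri-left : ∀ xu xy yu w vz → xu ≤ℚ xy + yu → xu + w + vz ≤ℚ xy + (yu + w + vz)
    tri-left xu xy yu w vz h = lin h (arith xu xy yu w vz)
      where
      arith : ∀ xu xy yu w b → xy + (yu + w + b) + xu ≡ xu + w + b + (xy + yu)
      arith = solve-∀ ℚ-ring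

    tri-right : ∀ vz vy yz w xu → vz ≤ℚ vy + yz → xu + w + vz ≤ℚ xu + w + vy + yz
    tri-right vz vy yz w xu h = lin h (arith vz vy yz w xu)
      where
      arith : ∀ vz vy yz w b → b + w + vy + yz + vz ≡ b + w + vz + (vy + yz)
      arith = solve-∀ ℚ-ring

    tri-same : ∀ xu w vy yu vz → 0ℚ ≤ℚ vy + yu + w → xu + w + vz ≤ℚ xu + w + vy + (yu + w + vz)
    tri-same xu w vy yu vz h = lin h (arith xu w vy yu vz)
      where
      arith : ∀ xu w vy yu vz → xu + w + vy + (yu + w + vz) + 0ℚ ≡ xu + w + vz + (vy + yu + w)
      arith = solve-∀ ℚ-ring

    tri-back : ∀ xz xu uz w vy yv → xz + 0ℚ + 0ℚ + 0ℚ + 0ℚ ≤ℚ xu + uz + vy + yv + w + w →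
      xz ≤ℚ xu + w + vy + (yv + w + uz)
    tri-back xz xu uz w vy yv h = lin h (arith xz xu uz w vy yv)
      where
      arith : ∀ xz xu uz w vy yv →
        xu + w + vy + (yv + w + uz) + (xz + 0ℚ + 0ℚ + 0ℚ + 0ℚ) ≡ xz + (xu + uz + vy + yv + w + w)
      arith = solve-∀ ℚ-ring

  -- A shortest path uses the new edge not at all, or once in one of its two directions; these are
  -- the three arguments of the minimum.
  addE : (Fin n → Fin n → ℚ) → Fin n → Fin n → ℚ → Fin n → Fin n → ℚ
  addE d u v ω x y = d x y ⊓ ((d x u + ω + d v y) ⊓ (d x v + ω + d u y))

  module _ (d : Fin n → Fin n → ℚ) (u v : Fin n) (ω : ℚ) where

    private
      p₁ p₂ : Fin n → Fin n → ℚ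
      p₁ x y = d x u + ω + d v y
      p₂ x y = d x v + ω + d u y

    addE≤d : ∀ x y → addE d u v ω x y ≤ℚ d x y
    addE≤d x y = ℚₚ.p⊓q≤p (d x y) (p₁ x y ⊓ p₂ x y)

    addE≤uv : ∀ x y → addE d u v ω x y ≤ℚ d x u + ω + d v y
    addE≤uv x y = ℚₚ.≤-trans (ℚₚ.p⊓q≤q (d x y) (p₁ x y ⊓ p₂ x y)) (ℚₚ.p⊓q≤p (p₁ x y) (p₂ x y))

    addE≤vu : ∀ x y → addE d u v ω x y ≤ℚ d x v + ω + d u y
    addE≤vu x y = ℚₚ.≤-trans (ℚₚ.p⊓q≤q (d x y) (p₁ x y ⊓ p₂ x y)) (ℚₚ.p⊓q≤q (p₁ x y) (p₂ x y))

    addE-sel : ∀ x y → d x y ≤ℚ addE d u v ω x y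
      ⊎ (d x u + ω + d v y ≤ℚ addE d u v ω x y ⊎ d x v + ω + d u y ≤ℚ addE d u v ω x y)
    addE-sel x y with ℚₚ.⊓-sel (d x y) ((d x u + ω + d v y) ⊓ (d x v + ω + d u y))
    ... | inj₁ e = inj₁ (ℚₚ.≤-reflexive (sym e))
    ... | inj₂ e with ℚₚ.⊓-sel (d x u + ω + d v y) (d x v + ω + d u y)
    ...   | inj₁ e′ = inj₂ (inj₁ (ℚₚ.≤-reflexive (sym (trans e e′))))
    ...   | inj₂ e′ = inj₂ (inj₂ (ℚₚ.≤-reflexive (sym (trans e e′))))

    addE-glb : ∀ {a} x y → a ≤ℚ d x y → a ≤ℚ d x u + ω + d v y → a ≤ℚ d x v + ω + d u y →
      a ≤ℚ addE d u v ω x y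
    addE-glb x y p q r = ℚₚ.⊓-glb p (ℚₚ.⊓-glb q r)

    module _ (dm : IsMetric d) (ω≥0 : 0ℚ ≤ℚ ω) where
      open IsMetric dm

      addE≤ω : addE d u v ω u v ≤ℚ ω
      addE≤ω = ℚₚ.≤-trans (addE≤uv u v)
        (ℚₚ.≤-reflexive (trans (cong₂ (λ a b → a + ω + b) (self u) (self v)) (zeros ω)))
        where
        zeros : ∀ a → 0ℚ + a + 0ℚ ≡ a
        zeros = solve-∀ ℚ-ring

      addE-symm-≤ : ∀ x y → addE d u v ω x y ≤ℚ addE d u v ω y x
      addE-symm-≤ x y = ℚₚ.⊓-glb
          (ℚₚ.≤-trans (addE≤d x y) (ℚₚ.≤-reflexive (symm x y)))
          (ℚₚ.⊓-glb
            (ℚₚ.≤-trans (addE≤vu x y)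
              (ℚₚ.≤-reflexive (trans (cong₂ (λ a b → a + ω + b) (symm x v) (symm u y)) (flip (d v x) ω (d y u)))))
            (ℚₚ.≤-trans (addE≤uv x y)
              (ℚₚ.≤-reflexive (trans (cong₂ (λ a b → a + ω + b) (symm x u) (symm v y)) (flip (d u x) ω (d y v))))))
        where
        flip : ∀ a b c → a + b + c ≡ c + b + a
        flip = solve-∀ ℚ-ring

      addE-tri : ∀ x y z → addE d u v ω x z ≤ℚ addE d u v ω x y + addE d u v ω y z
      addE-tri x y z with addE-sel x y | addE-sel y z
      ... | inj₁ p | inj₁ q = ℚₚ.≤-trans (ℚₚ.≤-trans (addE≤d x z) (tri x y z)) (p ⊕ q)
      ... | inj₁ p | inj₂ (inj₁ q) =
        ℚₚ.≤-trans (addE≤uv x z) (ℚₚ.≤-trans (tri-left (d x u) (d x y) (d y u) ω (d v z) (tri x y u)) (p ⊕ q))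
      ... | inj₁ p | inj₂ (inj₂ q) =
        ℚₚ.≤-trans (addE≤vu x z) (ℚₚ.≤-trans (tri-left (d x v) (d x y) (d y v) ω (d u z) (tri x y v)) (p ⊕ q))
      ... | inj₂ (inj₁ p) | inj₁ q =
        ℚₚ.≤-trans (addE≤uv x z) (ℚₚ.≤-trans (tri-right (d v z) (d v y) (d y z) ω (d x u) (tri v y z)) (p ⊕ q))
      ... | inj₂ (inj₂ p) | inj₁ q =
        ℚₚ.≤-trans (addE≤vu x z) (ℚₚ.≤-trans (tri-right (d u z) (d u y) (d y z) ω (d x v) (tri u y z)) (p ⊕ q))
      ... | inj₂ (inj₁ p) | inj₂ (inj₁ q) = ℚₚ.≤-trans (addE≤uv x z)
        (ℚₚ.≤-trans (tri-same (d x u) ω (d v y) (d y u) (d v z) (nonneg v y ⊕ nonneg y u ⊕ ω≥0)) (p ⊕ q))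
      ... | inj₂ (inj₂ p) | inj₂ (inj₂ q) = ℚₚ.≤-trans (addE≤vu x z)
        (ℚₚ.≤-trans (tri-same (d x v) ω (d u y) (d y v) (d u z) (nonneg u y ⊕ nonneg y v ⊕ ω≥0)) (p ⊕ q))
      ... | inj₂ (inj₁ p) | inj₂ (inj₂ q) = ℚₚ.≤-trans (addE≤d x z)
        (ℚₚ.≤-trans (tri-back (d x z) (d x u) (d u z) ω (d v y) (d y v) (tri x u z ⊕ nonneg v y ⊕ nonneg y v ⊕ ω≥0 ⊕ ω≥0)) (p ⊕ q))
      ... | inj₂ (inj₂ p) | inj₂ (inj₁ q) = ℚₚ.≤-trans (addE≤d x z)
        (ℚₚ.≤-trans (tri-back (d x z) (d x v) (d v z) ω (d u y) (d y u) (tri x v z ⊕ nonneg u y ⊕ nonneg y u ⊕ ω≥0 ⊕ ω≥0)) (p ⊕ q))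

      addE-nonneg : ∀ x y → 0ℚ ≤ℚ addE d u v ω x y
      addE-nonneg x y = ℚₚ.⊓-glb (nonneg x y) (ℚₚ.⊓-glb
        (+-nonneg (+-nonneg (nonneg _ _) ω≥0) (nonneg _ _)) (+-nonneg (+-nonneg (nonneg _ _) ω≥0) (nonneg _ _)))

      addE-metric : IsMetric (addE d u v ω)
      addE-metric = record
        { nonneg = addE-nonneg
        ; self = λ x → ℚₚ.≤-antisym (ℚₚ.≤-trans (addE≤d x x) (ℚₚ.≤-reflexive (self x))) (addE-nonneg x x)
        ; symm = λ x y → ℚₚ.≤-antisym (addE-symm-≤ x y) (addE-symm-≤ y x)
        ; tri = addE-tri }

    -- The triangle inequality for `ρ` along x, u, v, y bounds `ρ x y` by each alternative. This
    -- universal property allows metrics to be compared edge by edge, without paths.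
    addE-univ : ∀ {ρ} → IsMetric ρ → (∀ x y → ρ x y ≤ℚ d x y) → ρ u v ≤ℚ ω → ∀ x y → ρ x y ≤ℚ addE d u v ω x y
    addE-univ {ρ} ρm h hω x y = addE-glb x y (h x y)
      (lin (tri x u y ⊕ tri u v y ⊕ h x u ⊕ hω ⊕ h v y) (arith (ρ x y) (ρ x u) (ρ u y) (ρ u v) (ρ v y) (d x u) ω (d v y)))
      (lin (tri x v y ⊕ tri v u y ⊕ h x v ⊕ vu ⊕ h u y) (arith (ρ x y) (ρ x v) (ρ v y) (ρ v u) (ρ u y) (d x v) ω (d u y)))
      where
      open IsMetric ρm
      vu : ρ v u ≤ℚ ω
      vu = ℚₚ.≤-trans (ℚₚ.≤-reflexive (symm v u)) hω
      arith : ∀ xy xu uy uv vy dxu w dvy →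
        dxu + w + dvy + (xy + uy + xu + uv + vy) ≡ xy + (xu + uy + (uv + vy) + dxu + w + dvy)
      arith = solve-∀ ℚ-ring

-- Truncated shortest-path metrics of weighted edge lists.

module _ {n : ℕ} where

  -- No alternative in `addE` contains the new edge more than once, so shortening it saves at most
  -- the change of its length.
  addE-lipschitz : ∀ (d : Fin n → Fin n → ℚ) u v {ω ω′} → ω′ ≤ℚ ω → ∀ x y →
    addE d u v ω x y ≤ℚ addE d u v ω′ x y + (ω - ω′)
  addE-lipschitz d u v {ω} {ω′} h x y with addE-sel d u v ω′ x y
  ... | inj₁ p = ℚₚ.≤-trans (addE≤d d u v ω x y) (arith (d x y) (addE d u v ω′ x y) p h)
    where
    arith : ∀ a b → a ≤ℚ b → ω′ ≤ℚ ω → a ≤ℚ b + (ω - ω′)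
    arith a b p h = lin (p ⊕ h) (identity a b ω ω′)
      where
      identity : ∀ a b c c′ → b + (c - c′) + (a + c′) ≡ a + (b + c)
      identity = solve-∀ ℚ-ring
  ... | inj₂ (inj₁ p) = ℚₚ.≤-trans (addE≤uv d u v ω x y) (lin p (identity (d x u) (d v y) (addE d u v ω′ x y) ω ω′))
    where
    identity : ∀ a b t c c′ → t + (c - c′) + (a + c′ + b) ≡ a + c + b + t
    identity = solve-∀ ℚ-ring
  ... | inj₂ (inj₂ p) = ℚₚ.≤-trans (addE≤vu d u v ω x y) (lin p (identity (d x v) (d u y) (addE d u v ω′ x y) ω ω′))
    where
    identity : ∀ a b t c c′ → t + (c - c′) + (a + c′ + b) ≡ a + c + b + t
    identity = solve-∀ ℚ-ring

  -- The cap `M` stands in for an infinite distance, so that disconnected edge lists also have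
  -- rational distances.
  base : ℚ → Fin n → Fin n → ℚ
  base M x y with x ≟ y
  ... | yes _ = 0ℚ
  ... | no _ = M

  WEdge : Set
  WEdge = Fin n × Fin n × ℚ

  -- The largest pseudometric bounded by M in which every listed edge is at most as long as its
  -- weight, i.e. the shortest-path metric truncated at M.
  metricOf : ℚ → List WEdge → Fin n → Fin n → ℚ
  metricOf M [] = base M
  metricOf M ((u , v , ω) ∷ E) = addE (metricOf M E) u v ω

  NonNegWeights : List WEdge → Set
  NonNegWeights = All (λ e → 0ℚ ≤ℚ proj₂ (proj₂ e))

  weigh : (Fin n → Fin n → ℚ) → List (Fin n × Fin n) → List WEdge
  weigh ω = map (λ e → proj₁ e , proj₂ e , ω (proj₁ e) (proj₂ e))

  weigh-nonneg : ∀ {ω} → (∀ u v → 0ℚ ≤ℚ ω u v) → ∀ F → NonNegWeights (weigh ω F)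
  weigh-nonneg h [] = []
  weigh-nonneg h ((u , v) ∷ F) = h u v ∷ weigh-nonneg h F

  weigh-∈ : ∀ {ω} F {e} → e ∈ weigh ω F → ∃ λ f → f ∈ F × e ≡ (proj₁ f , proj₂ f , ω (proj₁ f) (proj₂ f))
  weigh-∈ F p with ∈-map⁻ _ p
  ... | f , f∈F , eq = f , f∈F , eq

  module _ {M : ℚ} (M≥0 : 0ℚ ≤ℚ M) where

    base-metric : IsMetric (base M)
    base-metric = record { nonneg = nn ; self = self′ ; symm = symm′ ; tri = tri′ }
      where
      nn : ∀ x y → 0ℚ ≤ℚ base M x y
      nn x y with x ≟ y
      ... | yes _ = ℚₚ.≤-refl
      ... | no _ = M≥0
      self′ : ∀ x → base M x x ≡ 0ℚ
      self′ x with x ≟ x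
      ... | yes _ = refl
      ... | no x≢x = ⊥-elim (x≢x refl)
      symm′ : ∀ x y → base M x y ≡ base M y x
      symm′ x y with x ≟ y | y ≟ x
      ... | yes _ | yes _ = refl
      ... | no _ | no _ = refl
      ... | yes p | no q = ⊥-elim (q (sym p))
      ... | no p | yes q = ⊥-elim (p (sym q))
      tri′ : ∀ x y z → base M x z ≤ℚ base M x y + base M y z
      tri′ x y z with x ≟ y
      ... | yes refl = ℚₚ.≤-reflexive (sym (ℚₚ.+-identityˡ _))
      ... | no _ = ℚₚ.≤-trans (≤M x z) (≤-step (nn y z) ℚₚ.≤-refl)
        where
        ≤M : ∀ x z → base M x z ≤ℚ M
        ≤M x z with x ≟ z
        ... | yes _ = M≥0
        ... | no _ = ℚₚ.≤-refl

    base≤M : ∀ x y → base M x y ≤ℚ M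
    base≤M x y with x ≟ y
    ... | yes _ = M≥0
    ... | no _ = ℚₚ.≤-refl

    metricOf-metric : ∀ {E} → NonNegWeights E → IsMetric (metricOf M E)
    metricOf-metric [] = base-metric
    metricOf-metric (p ∷ ps) = addE-metric _ _ _ _ (metricOf-metric ps) p

    metricOf≤M : ∀ E x y → metricOf M E x y ≤ℚ M
    metricOf≤M [] x y = base≤M x y
    metricOf≤M ((u , v , ω) ∷ E) x y = ℚₚ.≤-trans (addE≤d (metricOf M E) u v ω x y) (metricOf≤M E x y)

    metricOf-edge : ∀ {E} → NonNegWeights E → ∀ {u v ω} → (u , v , ω) ∈ E → metricOf M E u v ≤ℚ ω
    metricOf-edge {(u , v , ω) ∷ E} (p ∷ ps) (here refl) = addE≤ω (metricOf M E) u v ω (metricOf-metric ps) p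
    metricOf-edge {(u , v , ω) ∷ E} (p ∷ ps) {a} {b} (there q) =
      ℚₚ.≤-trans (addE≤d (metricOf M E) u v ω a b) (metricOf-edge ps q)

    -- Iterates `addE-univ` along the list. Lower bounds on `metricOf` are proved by exhibiting a
    -- suitable `ρ`.
    metricOf-univ : ∀ E {ρ} → IsMetric ρ → (∀ x y → ρ x y ≤ℚ M) →
      (∀ {u v ω} → (u , v , ω) ∈ E → ρ u v ≤ℚ ω) → ∀ x y → ρ x y ≤ℚ metricOf M E x y
    metricOf-univ [] ρm ρ≤M h x y with x ≟ y
    ... | yes refl = ℚₚ.≤-reflexive (IsMetric.self ρm x)
    ... | no _ = ρ≤M x y
    metricOf-univ ((u , v , ω) ∷ E) ρm ρ≤M h x y =
      addE-univ (metricOf M E) u v ω ρm (metricOf-univ E ρm ρ≤M (h ∘ there)) (h (here refl)) x y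

    metricOf-anti : ∀ {E E′} → NonNegWeights E′ → E ⊆ E′ → ∀ x y → metricOf M E′ x y ≤ℚ metricOf M E x y
    metricOf-anti {E} {E′} nn sub =
      metricOf-univ E (metricOf-metric nn) (metricOf≤M E′) (λ p → metricOf-edge nn (sub p))

    module _ {ω ω′ : Fin n → Fin n → ℚ} (ω≥0 : ∀ u v → 0ℚ ≤ℚ ω u v) (ω′≥0 : ∀ u v → 0ℚ ≤ℚ ω′ u v)
      (ω′≤ω : ∀ u v → ω′ u v ≤ℚ ω u v) where

      private
        δ : Fin n × Fin n → ℚ
        δ e = ω (proj₁ e) (proj₂ e) - ω′ (proj₁ e) (proj₂ e)

        shift : ∀ (E : List WEdge) {e E′} → e ∷ (E ++ E′) ⊆ E ++ e ∷ E′
        shift E (here refl) = ∈-++⁺ʳ E (here refl)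
        shift E (there p) with ∈-++⁻ E p
        ... | inj₁ q = ∈-++⁺ˡ q
        ... | inj₂ q = ∈-++⁺ʳ E (there q)

        unshift : ∀ (E : List WEdge) {e E′} → E ++ e ∷ E′ ⊆ e ∷ (E ++ E′)
        unshift E p with ∈-++⁻ E p
        ... | inj₁ q = there (∈-++⁺ˡ q)
        ... | inj₂ (here refl) = here refl
        ... | inj₂ (there q) = there (∈-++⁺ʳ E q)

      -- A shortest path uses every edge at most once.  Lowering the weights one edge at a time
      -- (moving that edge to the front of the list) avoids paths altogether.
      metricOf-lipschitz-++ : ∀ F {E} → NonNegWeights E → ∀ x y →
        metricOf M (weigh ω F ++ E) x y ≤ℚ metricOf M (weigh ω′ F ++ E) x y + ∑ F δ
      metricOf-lipschitz-++ [] nn x y = ℚₚ.≤-reflexive (sym (ℚₚ.+-identityʳ _))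
      metricOf-lipschitz-++ ((u , v) ∷ F) {E} nn x y =
        lin (one ⊕ to ⊕ IH ⊕ fro) (identity (d₀ x y) (d₁ x y) (d₂ x y) (d₃ x y) (d₄ x y) (δ (u , v)) (∑ F δ))
        where
        e′ : WEdge
        e′ = u , v , ω′ u v
        d₀ d₁ d₂ d₃ d₄ : Fin n → Fin n → ℚ
        d₀ = metricOf M (weigh ω ((u , v) ∷ F) ++ E)
        d₁ = metricOf M (e′ ∷ (weigh ω F ++ E))
        d₂ = metricOf M (weigh ω F ++ e′ ∷ E)
        d₃ = metricOf M (weigh ω′ F ++ e′ ∷ E)
        d₄ = metricOf M (e′ ∷ (weigh ω′ F ++ E))
        one : d₀ x y ≤ℚ d₁ x y + δ (u , v)
        one = addE-lipschitz (metricOf M (weigh ω F ++ E)) u v (ω′≤ω u v) x y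
        to : d₁ x y ≤ℚ d₂ x y
        to = metricOf-anti (ω′≥0 u v ∷ Allₚ.++⁺ (weigh-nonneg ω≥0 F) nn) (unshift (weigh ω F)) x y
        IH : d₂ x y ≤ℚ d₃ x y + ∑ F δ
        IH = metricOf-lipschitz-++ F (ω′≥0 u v ∷ nn) x y
        fro : d₃ x y ≤ℚ d₄ x y
        fro = metricOf-anti (Allₚ.++⁺ (weigh-nonneg ω′≥0 F) (ω′≥0 u v ∷ nn)) (shift (weigh ω′ F)) x y
        identity : ∀ a b c d e p q → e + (p + q) + (a + b + c + d) ≡ a + (b + p + c + (d + q) + e)
        identity = solve-∀ ℚ-ring

      metricOf-lipschitz : ∀ F x y → metricOf M (weigh ω F) x y ≤ℚ metricOf M (weigh ω′ F) x y + ∑ F δ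
      metricOf-lipschitz F x y =
        subst₂ (λ E E′ → metricOf M E x y ≤ℚ metricOf M E′ x y + ∑ F δ)
          (Listₚ.++-identityʳ (weigh ω F)) (Listₚ.++-identityʳ (weigh ω′ F)) (metricOf-lipschitz-++ F [] x y)

  module _ {A : Adj n} where

    infixr 5 _++ʷ_
    _++ʷ_ : ∀ {x y z} → Walk A x y → Walk A y z → Walk A x z
    [] ++ʷ q = q
    (e ∷ p) ++ʷ q = e ∷ (p ++ʷ q)

    len-++ʷ : ∀ w {x y z} (p : Walk A x y) (q : Walk A y z) → len w (p ++ʷ q) ≡ len w p + len w q
    len-++ʷ w [] q = sym (ℚₚ.+-identityˡ _)
    len-++ʷ w (_∷_ {u} {v} e p) q = trans (cong (w u v +_) (len-++ʷ w p q)) (sym (ℚₚ.+-assoc (w u v) _ _))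

  module _ {M : ℚ} (M≥0 : 0ℚ ≤ℚ M) {w : Fin n → Fin n → ℚ} (w≥0 : ∀ u v → 0ℚ ≤ℚ w u v)
    (w-sym : ∀ u v → w u v ≡ w v u) {A : Adj n} where

    metricOf≤len : ∀ {F} → (∀ x y → Edge A x y → (x , y) ∈ F ⊎ (y , x) ∈ F) →
      ∀ {x y} (P : Walk A x y) → metricOf M (weigh w F) x y ≤ℚ len w P
    metricOf≤len {F} cover = go
      where
      dm : IsMetric (metricOf M (weigh w F))
      dm = metricOf-metric M≥0 (weigh-nonneg w≥0 F)
      open IsMetric dm
      edge : ∀ {u v} → (u , v) ∈ F → metricOf M (weigh w F) u v ≤ℚ w u v
      edge p = metricOf-edge M≥0 (weigh-nonneg w≥0 F) (∈-map⁺ _ p)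
      step : ∀ x y → Edge A x y → metricOf M (weigh w F) x y ≤ℚ w x y
      step x y e with cover x y e
      ... | inj₁ p = edge p
      ... | inj₂ p = subst₂ _≤ℚ_ (symm y x) (w-sym y x) (edge p)
      go : ∀ {x y} (P : Walk A x y) → metricOf M (weigh w F) x y ≤ℚ len w P
      go {x} [] = ℚₚ.≤-reflexive (self x)
      go {x} {y} (_∷_ {v = z} e P) = ℚₚ.≤-trans (tri x z y) (step x z e ⊕ go P)

    private
      metricOf-nonneg : ∀ F x y → 0ℚ ≤ℚ metricOf M (weigh w F) x y
      metricOf-nonneg F = IsMetric.nonneg (metricOf-metric M≥0 (weigh-nonneg w≥0 F))

      summands≤ : ∀ {a b c t} → 0ℚ ≤ℚ a → 0ℚ ≤ℚ b → 0ℚ ≤ℚ c → a + b + c ≤ℚ t → a ≤ℚ t × c ≤ℚ t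
      summands≤ {a} {b} {c} a≥0 b≥0 c≥0 h =
        ℚₚ.≤-trans (≤-step c≥0 (≤-step b≥0 ℚₚ.≤-refl)) h ,
        ℚₚ.≤-trans (subst (_≤ℚ a + b + c) (ℚₚ.+-identityˡ c) (+-nonneg a≥0 b≥0 ⊕ ℚₚ.≤-refl {c})) h

    -- A value below the cap cannot come from `base` at distinct points, so unfolding the minima
    -- builds a walk. The strict bound passes to both pieces next to an edge because all summands
    -- are nonnegative.
    metricOf-realize : (∀ u v → A u v ≡ A v u) → ∀ F → (∀ {x y} → (x , y) ∈ F → Edge A x y) →
      ∀ x y → metricOf M (weigh w F) x y <ℚ M → Σ (Walk A x y) λ P → len w P ≤ℚ metricOf M (weigh w F) x y
    metricOf-realize A-sym [] inA x y h with x ≟ y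
    ... | yes refl = [] , ℚₚ.≤-refl
    ... | no _ = ⊥-elim (ℚₚ.<-irrefl refl h)
    metricOf-realize A-sym ((u , v) ∷ F) inA x y h
      with addE-sel (metricOf M (weigh w F)) u v (w u v) x y
    ... | inj₁ p with metricOf-realize A-sym F (inA ∘ there) x y (ℚₚ.≤-<-trans p h)
    ...   | P , q = P , ℚₚ.≤-trans q p
    metricOf-realize A-sym ((u , v) ∷ F) inA x y h | inj₂ (inj₁ p)
      with summands≤ (metricOf-nonneg F x u) (w≥0 u v) (metricOf-nonneg F v y) p
    ... | l , r with metricOf-realize A-sym F (inA ∘ there) x u (ℚₚ.≤-<-trans l h)
                   | metricOf-realize A-sym F (inA ∘ there) v y (ℚₚ.≤-<-trans r h)
    ...   | P , q | P′ , q′ = (P ++ʷ (inA (here refl) ∷ P′)) ,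
      ℚₚ.≤-trans (ℚₚ.≤-reflexive (trans (len-++ʷ w P _) (sym (ℚₚ.+-assoc (len w P) _ _))))
        (ℚₚ.≤-trans (q ⊕ ℚₚ.≤-refl {w u v} ⊕ q′) p)
    metricOf-realize A-sym ((u , v) ∷ F) inA x y h | inj₂ (inj₂ p)
      with summands≤ (metricOf-nonneg F x v) (w≥0 u v) (metricOf-nonneg F u y) p
    ... | l , r with metricOf-realize A-sym F (inA ∘ there) x v (ℚₚ.≤-<-trans l h)
                   | metricOf-realize A-sym F (inA ∘ there) u y (ℚₚ.≤-<-trans r h)
    ...   | P , q | P′ , q′ = (P ++ʷ (trans (A-sym v u) (inA (here refl)) ∷ P′)) ,
      ℚₚ.≤-trans (ℚₚ.≤-reflexive (trans (len-++ʷ w P _) (sym (ℚₚ.+-assoc (len w P) _ _))))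
        (ℚₚ.≤-trans (q ⊕ ℚₚ.≤-reflexive (w-sym v u) ⊕ q′) p)

-- Minima and positive parts.

⊓≤₁ : ∀ p q → p ⊓ q ≤ℚ p
⊓≤₁ = ℚₚ.p⊓q≤p

⊓≤₂ : ∀ p q → p ⊓ q ≤ℚ q
⊓≤₂ = ℚₚ.p⊓q≤q

⊓-either : ∀ {p q t} → p ⊓ q ≤ℚ t → p ≤ℚ t ⊎ q ≤ℚ t
⊓-either {p} {q} h with ℚₚ.⊓-sel p q
... | inj₁ e = inj₁ (ℚₚ.≤-trans (ℚₚ.≤-reflexive (sym e)) h)
... | inj₂ e = inj₂ (ℚₚ.≤-trans (ℚₚ.≤-reflexive (sym e)) h)

⊓₃-glb-+ : ∀ {t d p q c} → t ≤ℚ d + c → t ≤ℚ p + c → t ≤ℚ q + c → t ≤ℚ (d ⊓ (p ⊓ q)) + c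
⊓₃-glb-+ {t} {d} {p} {q} {c} hd hp hq with ℚₚ.⊓-sel d (p ⊓ q)
... | inj₁ e = subst (λ s → t ≤ℚ s + c) (sym e) hd
... | inj₂ e with ℚₚ.⊓-sel p q
...   | inj₁ e′ = subst (λ s → t ≤ℚ s + c) (sym (trans e e′)) hp
...   | inj₂ e′ = subst (λ s → t ≤ℚ s + c) (sym (trans e e′)) hq

_⁺ : ℚ → ℚ
t ⁺ = t ⊔ 0ℚ

⁺-nonneg : ∀ t → 0ℚ ≤ℚ t ⁺
⁺-nonneg t = ℚₚ.p≤q⊔p t 0ℚ

sub-⁺ : ∀ p c → p ≤ℚ (p - c) ⁺ + c
sub-⁺ p c = lin (ℚₚ.p≤p⊔q (p - c) 0ℚ) (identity p c ((p - c) ⁺))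
  where
  identity : ∀ p c m → m + c + (p - c) ≡ p + m
  identity = solve-∀ ℚ-ring

⁺-least : ∀ {p c t} → 0ℚ ≤ℚ t → p ≤ℚ t + c → (p - c) ⁺ ≤ℚ t
⁺-least {p} {c} {t} t≥0 h = ℚₚ.⊔-lub {t} {p - c} {0ℚ} (lin h (identity p c t)) t≥0
  where
  identity : ∀ p c t → t + p ≡ p - c + (t + c)
  identity = solve-∀ ℚ-ring

⊓-⁺ : ∀ {p q c t} → 0ℚ ≤ℚ t → p ⊓ q ≤ℚ t + c → (p - c) ⁺ ⊓ (q - c) ⁺ ≤ℚ t
⊓-⁺ {p} {q} {c} t≥0 h with ⊓-either {p} {q} h
... | inj₁ h′ = ℚₚ.≤-trans (⊓≤₁ ((p - c) ⁺) ((q - c) ⁺)) (⁺-least {p} t≥0 h′)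
... | inj₂ h′ = ℚₚ.≤-trans (⊓≤₂ ((p - c) ⁺) ((q - c) ⁺)) (⁺-least {q} t≥0 h′)

∑-filter : ∀ {A : Set} {P : A → Set} (P? : Decidable P) xs {f g : A → ℚ} →
  (∀ {x} → x ∈ xs → 0ℚ ≤ℚ g x) → (∀ {x} → P x → f x ≤ℚ g x) → ∑ (filter P? xs) f ≤ℚ ∑ xs g
∑-filter P? [] nn h = ℚₚ.≤-refl
∑-filter P? (x ∷ xs) {f} {g} nn h with P? x
... | yes p = h p ⊕ ∑-filter P? xs (nn ∘ there) h
... | no _ = subst (_≤ℚ g x + ∑ xs g) (ℚₚ.+-identityˡ (∑ (filter P? xs) f))
  (nn (here refl) ⊕ ∑-filter P? xs (nn ∘ there) h)

-- The potential: forgetting vertices and inserting edges.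

module Potential {n : ℕ} {K : ℚ} (K≥0 : 0ℚ ≤ℚ K) {dT : Fin n → Fin n → ℚ} (dTm : IsMetric dT) where

  private module T = IsMetric dTm

  -- Radii r on the bag B such that no two points are both much larger than their tree distance:
  -- near-duplicates of a point then contribute nothing to the potential.
  record Separated (B : List (Fin n)) (r : Fin n → ℚ) : Set where
    field
      nonneg : ∀ x → 0ℚ ≤ℚ r x
      apart : ∀ {x y} → x ∈ B → y ∈ B → x ≢ y → r x ⊓ r y ≤ℚ K * dT x y

  term : (Fin n → Fin n → ℚ) → (Fin n → ℚ) → Fin n → Fin n → ℚ
  term D r x y = D x y ⊓ (r x ⊓ r y)

  value : (Fin n → Fin n → ℚ) → List (Fin n) → (Fin n → ℚ) → ℚ
  value D B r = ∑ B λ x → ∑ B λ y → term D r x y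

  KdT≥0 : ∀ x y → 0ℚ ≤ℚ K * dT x y
  KdT≥0 x y = *-nonneg K≥0 (T.nonneg x y)

  module _ {D : Fin n → Fin n → ℚ} (Dm : IsMetric D) where

    private module D = IsMetric Dm

    term-nonneg : ∀ {r} → (∀ x → 0ℚ ≤ℚ r x) → ∀ x y → 0ℚ ≤ℚ term D r x y
    term-nonneg r≥0 x y = ℚₚ.⊓-glb (D.nonneg x y) (ℚₚ.⊓-glb (r≥0 x) (r≥0 y))

    term-symm : ∀ r x y → term D r x y ≡ term D r y x
    term-symm r x y = cong₂ _⊓_ (D.symm x y) (ℚₚ.⊓-comm (r x) (r y))

    value-nonneg : ∀ B {r} → (∀ x → 0ℚ ≤ℚ r x) → 0ℚ ≤ℚ value D B r
    value-nonneg B r≥0 = ∑-nonneg B λ {x} _ → ∑-nonneg B λ {y} _ → term-nonneg r≥0 x y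

    -- Forgotten vertices receive radius 0, which cannot violate separation and adds only
    -- nonnegative terms.
    forget : ∀ {P : Fin n → Set} (P? : Decidable P) B {r} → Separated (filter P? B) r →
      ∃ λ r′ → Separated B r′ × value D (filter P? B) r ≤ℚ value D B r′
    forget {P} P? B {r} sep = r′ , sep′ ,
      ∑-filter P? B (λ {x} _ → ∑-nonneg B λ {y} _ → term-nonneg nn x y) λ {x} px →
        ∑-filter P? B (λ {y} _ → term-nonneg nn x y) λ {y} py →
          ℚₚ.≤-reflexive (cong₂ (λ a b → D x y ⊓ (a ⊓ b)) (sym (on x px)) (sym (on y py)))
      where
      open Separated sep
      r′ : Fin n → ℚ
      r′ x with P? x
      ... | yes _ = r x
      ... | no _ = 0ℚ
      on : ∀ x → P x → r′ x ≡ r x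
      on x p with P? x
      ... | yes _ = refl
      ... | no ¬p = ⊥-elim (¬p p)
      nn : ∀ x → 0ℚ ≤ℚ r′ x
      nn x with P? x
      ... | yes _ = nonneg x
      ... | no _ = ℚₚ.≤-refl
      ap : ∀ {x y} → x ∈ B → y ∈ B → x ≢ y → r′ x ⊓ r′ y ≤ℚ K * dT x y
      ap {x} {y} x∈ y∈ ne with P? x | P? y
      ... | yes px | yes py = apart (∈-filter⁺ P? x∈ px) (∈-filter⁺ P? y∈ py) ne
      ... | yes _ | no _ = ℚₚ.≤-trans (⊓≤₂ (r x) 0ℚ) (KdT≥0 x y)
      ... | no _ | yes _ = ℚₚ.≤-trans (⊓≤₁ 0ℚ (r y)) (KdT≥0 x y)
      ... | no _ | no _ = ℚₚ.≤-trans (⊓≤₁ 0ℚ 0ℚ) (KdT≥0 x y)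
      sep′ : Separated B r′
      sep′ = record { nonneg = nn ; apart = ap }

  -- The field `near` allows for `length B` hops of tree length at most W / K each.
  record Raised (B : List (Fin n)) (r : Fin n → ℚ) (x : Fin n) (W : ℚ) : Set where
    field
      r⁺ : Fin n → ℚ
      separated : Separated B r⁺
      above : ∀ y → r y ≤ℚ r⁺ y
      z : Fin n
      z∈B : z ∈ B
      big : W ≤ℚ r⁺ z
      near : K * dT x z ≤ℚ fromℕ (length B) * W

  -- Raise the radius of some point near x to W.  If the radius of z cannot be raised, a nearby z′
  -- with a strictly larger radius is in the way; continue from there.
  raise : ∀ {B r x W} → Separated B r → x ∈ B → 0ℚ ≤ℚ W → Raised B r x W
  raise {B} {r} {x} {W} sep x∈B W≥0 =
    go (length B) x x∈B B 0 (λ p _ → p) ℕₚ.≤-refl (ℕₚ.≤-reflexive (ℕₚ.+-identityʳ (length B)))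
      (ℚₚ.≤-trans (ℚₚ.≤-reflexive (trans (cong (K *_) (T.self x)) (ℚₚ.*-zeroʳ K))) (*-nonneg (fromℕ-nonneg 0) W≥0))
    where
    open Separated sep
    Conflict : Fin n → Fin n → Set
    Conflict z z′ = r z <ℚ r z′ × K * dT z z′ <ℚ W
    conflict? : ∀ z → Decidable (Conflict z)
    conflict? z z′ = (r z ℚₚ.<? r z′) ×-dec (K * dT z z′ ℚₚ.<? W)
    stop : ∀ {z} → z ∈ B → r z ≤ℚ W → (∀ {c} → c ∈ B → ¬ Conflict z c) →
      K * dT x z ≤ℚ fromℕ (length B) * W → Raised B r x W
    stop {z} z∈B rz≤W free near = record
      { r⁺ = r⁺ ; separated = record { nonneg = nn ; apart = ap } ; above = above
      ; z = z ; z∈B = z∈B ; big = big ; near = near }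
      where
      r⁺ : Fin n → ℚ
      r⁺ y with y ≟ z
      ... | yes _ = W
      ... | no _ = r y
      nn : ∀ y → 0ℚ ≤ℚ r⁺ y
      nn y with y ≟ z
      ... | yes _ = W≥0
      ... | no _ = nonneg y
      above : ∀ y → r y ≤ℚ r⁺ y
      above y with y ≟ z
      ... | yes refl = rz≤W
      ... | no _ = ℚₚ.≤-refl
      big : W ≤ℚ r⁺ z
      big with z ≟ z
      ... | yes _ = ℚₚ.≤-refl
      ... | no ne = ⊥-elim (ne refl)
      -- If c is closer to z than W / K, then `r c` is at most `r z`, since c is no conflict, and
      -- the old separation of z and c bounds it.
      apart-z : ∀ {c} → c ∈ B → z ≢ c → W ⊓ r c ≤ℚ K * dT z c
      apart-z {c} c∈B z≢c with r z ℚₚ.<? r c | K * dT z c ℚₚ.<? W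
      ... | yes p | yes q = ⊥-elim (free c∈B (p , q))
      ... | _ | no q = ℚₚ.≤-trans (⊓≤₁ W (r c)) (ℚₚ.≮⇒≥ q)
      ... | no p | yes _ = ℚₚ.≤-trans (⊓≤₂ W (r c))
        (ℚₚ.≤-trans (ℚₚ.⊓-glb (ℚₚ.≮⇒≥ p) ℚₚ.≤-refl) (apart z∈B c∈B z≢c))
      ap : ∀ {a b} → a ∈ B → b ∈ B → a ≢ b → r⁺ a ⊓ r⁺ b ≤ℚ K * dT a b
      ap {a} {b} a∈B b∈B a≢b with a ≟ z | b ≟ z
      ... | yes refl | yes refl = ⊥-elim (a≢b refl)
      ... | yes refl | no _ = apart-z b∈B a≢b
      ... | no _ | yes refl = subst₂ _≤ℚ_ (ℚₚ.⊓-comm W (r a)) (cong (K *_) (T.symm z a)) (apart-z a∈B (a≢b ∘ sym))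
      ... | no _ | no _ = apart a∈B b∈B a≢b
    -- The list `C` contains all points of larger radius than z. Every hop removes the new z′ from
    -- it, which bounds the number `j` of hops by `length B`.
    go : ∀ fuel z → z ∈ B → (C : List (Fin n)) (j : ℕ) → (∀ {c} → c ∈ B → r z <ℚ r c → c ∈ C) →
      length C ≤ fuel → fuel ℕ.+ j ≤ length B → K * dT x z ≤ℚ fromℕ j * W → Raised B r x W
    go fuel z z∈B C j cand C≤ bound near with W ℚₚ.≤? r z
    ... | yes W≤rz = record
      { r⁺ = r ; separated = sep ; above = λ _ → ℚₚ.≤-refl ; z = z ; z∈B = z∈B ; big = W≤rz
      ; near = near-weaken j (ℕₚ.≤-trans (ℕₚ.m≤n+m j fuel) bound) near }
      where
      near-weaken : ∀ j → j ≤ length B → K * dT x z ≤ℚ fromℕ j * W → K * dT x z ≤ℚ fromℕ (length B) * W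
      near-weaken j j≤ h = ℚₚ.≤-trans h (ℚₚ.*-monoʳ-≤-nonNeg W ⦃ ℚ.nonNegative W≥0 ⦄ (fromℕ-mono j≤))
    ... | no W≰rz with Any.any? (conflict? z) B
    ...   | no free = stop z∈B (ℚₚ.<⇒≤ (ℚₚ.≰⇒> W≰rz)) (λ c∈B cf → free (lose c∈B cf))
      (ℚₚ.≤-trans near (ℚₚ.*-monoʳ-≤-nonNeg W ⦃ ℚ.nonNegative W≥0 ⦄ (fromℕ-mono (ℕₚ.≤-trans (ℕₚ.m≤n+m j fuel) bound))))
    ...   | yes found with find found
    ...     | z′ , z′∈B , bigger , close = next fuel C≤ bound
      where
      closer : ∀ zz xz xz′ → K * xz ≤ℚ fromℕ j * W → K * zz <ℚ W → xz′ ≤ℚ xz + zz → K * xz′ ≤ℚ fromℕ (suc j) * W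
      closer zz xz xz′ p q r = lin (p ⊕ ℚₚ.<⇒≤ q ⊕ *-mono-nonneg K≥0 r) (identity K zz xz xz′ (fromℕ j) W)
        where
        identity : ∀ k zz xz xz′ j w → (1ℚ + j) * w + (k * xz + k * zz + k * xz′) ≡ k * xz′ + (j * w + w + k * (xz + zz))
        identity = solve-∀ ℚ-ring
      shorter : length (filter (λ c → r z′ ℚₚ.<? r c) C) ℕ.< length C
      shorter = Listₚ.filter-notAll (λ c → r z′ ℚₚ.<? r c) C
        (lose (cand z′∈B bigger) (ℚₚ.<-irrefl refl))
      next : ∀ fuel → length C ≤ fuel → fuel ℕ.+ j ≤ length B → Raised B r x W
      next zero C≤ _ = ⊥-elim (ℕₚ.n≮0 (ℕₚ.≤-trans shorter C≤))
      next (suc fuel) C≤ bound = go fuel z′ z′∈B (filter (λ c → r z′ ℚₚ.<? r c) C) (suc j)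
        (λ c∈B lt → ∈-filter⁺ (λ c → r z′ ℚₚ.<? r c) (cand c∈B (ℚₚ.<-trans bigger lt)) lt)
        (ℕ.s≤s⁻¹ (ℕₚ.≤-trans shorter C≤))
        (ℕₚ.≤-trans (ℕₚ.≤-reflexive (ℕₚ.+-suc fuel j)) bound)
        (closer (dT z z′) (dT x z) (dT x z′) near close (T.tri x z z′))

  module _ {D : Fin n → Fin n → ℚ} (Dm : IsMetric D) where

    private module D = IsMetric Dm

    -- Raising provides points z, z′ of radius at least W within distance h of x and y. Without the
    -- edge, z and z′ are at distance at least W - 2h = ω + 3h; with it, at most ω + 2h. Hence this
    -- one term differs by at least h, while insertion increases no other term. Of the five h in W,
    -- two pay for the detour to z and z′ before the insertion, two after it, and one is the gain.
    discount : ∀ {x y ω W h B r} → 0ℚ <ℚ K → (∀ x y → D x y ≤ℚ dT x y) → x ∈ B → y ∈ B → 0ℚ ≤ℚ ω → 0ℚ ≤ℚ h →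
      W ≡ ω + (h + h + h + h + h) → W ≤ℚ D x y → fromℕ (length B) * W ≤ℚ K * h → Separated B r →
      ∃ λ r⁺ → Separated B r⁺ × value (addE D x y ω) B r + h ≤ℚ value D B r⁺
    discount {x} {y} {ω} {W} {h} {B} {r} K>0 D≤dT x∈B y∈B ω≥0 h≥0 W≡ W≤D small sep =
      R₂.r⁺ , R₂.separated , ℚₚ.≤-trans (mono ⊕ ℚₚ.≤-refl {h}) gain
      where
      W≥0 : 0ℚ ≤ℚ W
      W≥0 = subst (0ℚ ≤ℚ_) (sym W≡) (+-nonneg ω≥0 (+-nonneg (+-nonneg (+-nonneg (+-nonneg h≥0 h≥0) h≥0) h≥0) h≥0))
      R₁ : Raised B r x W
      R₁ = raise sep x∈B W≥0
      module R₁ = Raised R₁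
      R₂ : Raised B R₁.r⁺ y W
      R₂ = raise R₁.separated y∈B W≥0
      module R₂ = Raised R₂
      z z′ : Fin n
      z = R₁.z
      z′ = R₂.z
      D′ : Fin n → Fin n → ℚ
      D′ = addE D x y ω
      cancelK : ∀ {p q} → K * p ≤ℚ K * q → p ≤ℚ q
      cancelK = ℚₚ.*-cancelˡ-≤-pos K ⦃ ℚ.positive K>0 ⦄
      Dxz≤h : D x z ≤ℚ h
      Dxz≤h = ℚₚ.≤-trans (D≤dT x z) (cancelK (ℚₚ.≤-trans R₁.near small))
      Dyz′≤h : D y z′ ≤ℚ h
      Dyz′≤h = ℚₚ.≤-trans (D≤dT y z′) (cancelK (ℚₚ.≤-trans R₂.near small))
      Dzx≤h : D z x ≤ℚ h
      Dzx≤h = subst (_≤ℚ h) (D.symm x z) Dxz≤h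
      Dz′y≤h : D z′ y ≤ℚ h
      Dz′y≤h = subst (_≤ℚ h) (D.symm y z′) Dyz′≤h
      D′≤ : D′ z z′ + h ≤ℚ ω + (h + h + h)
      D′≤ = lin (addE≤uv D x y ω z z′ ⊕ Dzx≤h ⊕ Dyz′≤h) (identity (D′ z z′) (D z x) ω (D y z′) h)
        where
        identity : ∀ d a w b h → w + (h + h + h) + (d + a + b) ≡ d + h + (a + w + b + h + h)
        identity = solve-∀ ℚ-ring
      ≤W : ω + (h + h + h) ≤ℚ W
      ≤W = subst (ω + (h + h + h) ≤ℚ_) (sym W≡) (lin (h≥0 ⊕ h≥0) (identity ω h))
        where
        identity : ∀ w h → w + (h + h + h + h + h) + (0ℚ + 0ℚ) ≡ w + (h + h + h) + (h + h)
        identity = solve-∀ ℚ-ring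
      ≤D : ω + (h + h + h) ≤ℚ D z z′
      ≤D = lin (subst (_≤ℚ D x y) W≡ W≤D ⊕ D.tri x z y ⊕ D.tri z z′ y ⊕ Dxz≤h ⊕ Dz′y≤h)
        (identity ω h (D x y) (D x z) (D z y) (D z z′) (D z′ y))
        where
        identity : ∀ w h xy xz zy zz z′y → zz + (w + (h + h + h + h + h) + xy + zy + xz + z′y)
          ≡ w + (h + h + h) + (xy + (xz + zy) + (zz + z′y) + h + h)
        identity = solve-∀ ℚ-ring
      D′+h≤W : D′ z z′ + h ≤ℚ W
      D′+h≤W = ℚₚ.≤-trans D′≤ ≤W
      term-gain : term D′ R₂.r⁺ z z′ + h ≤ℚ term D R₂.r⁺ z z′
      term-gain = ℚₚ.≤-trans (ℚₚ.+-monoˡ-≤ h (⊓≤₁ (D′ z z′) (R₂.r⁺ z ⊓ R₂.r⁺ z′)))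
        (ℚₚ.⊓-glb (ℚₚ.≤-trans D′≤ ≤D)
          (ℚₚ.⊓-glb (ℚₚ.≤-trans D′+h≤W (ℚₚ.≤-trans R₁.big (R₂.above z))) (ℚₚ.≤-trans D′+h≤W R₂.big)))
      mono : value D′ B r ≤ℚ value D′ B R₂.r⁺
      mono = ∑-mono B λ {a} _ → ∑-mono B λ {b} _ → ℚₚ.⊓-mono-≤ (ℚₚ.≤-refl {D′ a b})
        (ℚₚ.⊓-mono-≤ (ℚₚ.≤-trans (R₁.above a) (R₂.above a)) (ℚₚ.≤-trans (R₁.above b) (R₂.above b)))
      term-mono : ∀ a b → term D′ R₂.r⁺ a b ≤ℚ term D R₂.r⁺ a b
      term-mono a b = ℚₚ.⊓-mono-≤ (addE≤d D x y ω a b) (ℚₚ.≤-refl {R₂.r⁺ a ⊓ R₂.r⁺ b})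
      gain : value D′ B R₂.r⁺ + h ≤ℚ value D B R₂.r⁺
      gain = ∑-mono-gap B (λ {a} _ → ∑-mono B λ {b} _ → term-mono a b) R₁.z∈B
        (∑-mono-gap B (λ {b} _ → term-mono z b) R₂.z∈B term-gain)

-- The potential: introducing a vertex.

-- Merges the terms of the pairs y z and x z into the new term of y z, where `p` and `q` are the new
-- radii of y and z. One of `rx`, `ry` is at most c, so one of the two old terms is at most c; the
-- other exceeds the new term by at most c, or by a when the distance from x is replaced by that
-- from y.
⊓-swap-bound : ∀ {dy dx ry rx rz c a p q} → dx ≤ℚ a + dy → rx ≤ℚ p + c → ry ≤ℚ p + c → rz ≤ℚ q + c →
  rx ⊓ ry ≤ℚ c → 0ℚ ≤ℚ c → 0ℚ ≤ℚ a →
  (dy ⊓ (ry ⊓ rz)) + (dx ⊓ (rx ⊓ rz)) ≤ℚ (dy ⊓ (p ⊓ q)) + (c + c + a)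
⊓-swap-bound {dy} {dx} {ry} {rx} {rz} {c} {a} {p} {q} hd hx hy hz hxy c≥0 a≥0 with ⊓-either {rx} {ry} hxy
... | inj₁ rx≤c = ⊓₃-glb-+ {d = dy} {p} {q} {c + c + a}
      (lin (⊓≤₁ dy (ry ⊓ rz) ⊕ t≤rx ⊕ rx≤c ⊕ c≥0 ⊕ a≥0) (id₁ s t dy c a rx))
      (lin (s≤ry ⊕ hy ⊕ t≤rx ⊕ rx≤c ⊕ a≥0) (id₂ s t ry p c rx a))
      (lin (s≤rz ⊕ hz ⊕ t≤rx ⊕ rx≤c ⊕ a≥0) (id₂ s t rz q c rx a))
  where
  s t : ℚ
  s = dy ⊓ (ry ⊓ rz)
  t = dx ⊓ (rx ⊓ rz)
  s≤ry : s ≤ℚ ry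
  s≤ry = ℚₚ.≤-trans (⊓≤₂ dy (ry ⊓ rz)) (⊓≤₁ ry rz)
  s≤rz : s ≤ℚ rz
  s≤rz = ℚₚ.≤-trans (⊓≤₂ dy (ry ⊓ rz)) (⊓≤₂ ry rz)
  t≤rx : t ≤ℚ rx
  t≤rx = ℚₚ.≤-trans (⊓≤₂ dx (rx ⊓ rz)) (⊓≤₁ rx rz)
  id₁ : ∀ s t dy c a rx → dy + (c + c + a) + (s + t + rx + 0ℚ + 0ℚ) ≡ s + t + (dy + rx + c + c + a)
  id₁ = solve-∀ ℚ-ring
  id₂ : ∀ s t ry p c rx a → p + (c + c + a) + (s + ry + t + rx + 0ℚ) ≡ s + t + (ry + (p + c) + rx + c + a)
  id₂ = solve-∀ ℚ-ring
... | inj₂ ry≤c = ⊓₃-glb-+ {d = dy} {p} {q} {c + c + a}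
      (lin (s≤ry ⊕ ry≤c ⊕ ⊓≤₁ dx (rx ⊓ rz) ⊕ hd ⊕ c≥0) (id₁ s t ry c dx a dy))
      (lin (s≤ry ⊕ ry≤c ⊕ t≤rx ⊕ hx ⊕ a≥0) (id₂ s t rx p c ry a))
      (lin (s≤ry ⊕ ry≤c ⊕ t≤rz ⊕ hz ⊕ a≥0) (id₂ s t rz q c ry a))
  where
  s t : ℚ
  s = dy ⊓ (ry ⊓ rz)
  t = dx ⊓ (rx ⊓ rz)
  s≤ry : s ≤ℚ ry
  s≤ry = ℚₚ.≤-trans (⊓≤₂ dy (ry ⊓ rz)) (⊓≤₁ ry rz)
  t≤rx : t ≤ℚ rx
  t≤rx = ℚₚ.≤-trans (⊓≤₂ dx (rx ⊓ rz)) (⊓≤₁ rx rz)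
  t≤rz : t ≤ℚ rz
  t≤rz = ℚₚ.≤-trans (⊓≤₂ dx (rx ⊓ rz)) (⊓≤₂ rx rz)
  id₁ : ∀ s t ry c dx a dy → dy + (c + c + a) + (s + ry + t + dx + 0ℚ) ≡ s + t + (ry + c + dx + (a + dy) + c)
  id₁ = solve-∀ ℚ-ring
  id₂ : ∀ s t rx p c ry a → p + (c + c + a) + (s + ry + t + rx + 0ℚ) ≡ s + t + (ry + c + rx + (p + c) + a)
  id₂ = solve-∀ ℚ-ring

module _ {n : ℕ} {K : ℚ} (K≥0 : 0ℚ ≤ℚ K) {dT : Fin n → Fin n → ℚ} (dTm : IsMetric dT) where

  open Potential K≥0 dTm
  private module T = IsMetric dTm

  module _ {D : Fin n → Fin n → ℚ} (Dm : IsMetric D) (D≤dT : ∀ x y → D x y ≤ℚ dT x y) where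

    private module D = IsMetric Dm

    -- The nearby point y inherits the radius of x.  Lowering all radii by K · dT x y restores
    -- separation.
    introduce : ∀ {x y B r} → y ∈ B → x ∉ B → Separated (x ∷ B) r →
      ∃ λ r′ → Separated B r′ ×
        value D (x ∷ B) r ≤ℚ value D B r′ +
          fromℕ (length B) * (fromℕ (length B) * (K * dT x y + K * dT x y + dT x y))
    introduce {x} {y} {B} {r} y∈B x∉B sep = r′ , record { nonneg = nn ; apart = ap } ,
      ℚₚ.≤-trans expand (∑-mono-const B λ {z} z∈B → ∑-mono-const B λ {z′} z′∈B → pointwise z∈B z′∈B)
      where
      open Separated sep
      c a E : ℚ
      c = K * dT x y
      a = dT x y
      E = c + c + a
      c≥0 : 0ℚ ≤ℚ c
      c≥0 = KdT≥0 x y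
      a≥0 : 0ℚ ≤ℚ a
      a≥0 = T.nonneg x y
      -- At most one of x and y has a radius above c, so y can take over the larger radius.
      m : Fin n → ℚ
      m z with z ≟ y
      ... | yes _ = r x ⊔ r y
      ... | no _ = r z
      r′ : Fin n → ℚ
      r′ z = (m z - c) ⁺
      nn : ∀ z → 0ℚ ≤ℚ r′ z
      nn z = ⁺-nonneg (m z - c)
      rx⊓ry≤c : r x ⊓ r y ≤ℚ c
      rx⊓ry≤c = apart (here refl) (there y∈B) λ { refl → x∉B y∈B }
      apart-y : ∀ {z} → z ∈ B → y ≢ z → (r x ⊔ r y) ⊓ r z ≤ℚ K * dT y z + c
      apart-y {z} z∈B y≢z with ℚₚ.⊔-sel (r x) (r y)
      ... | inj₁ e = subst (λ t → t ⊓ r z ≤ℚ K * dT y z + c) (sym e)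
        (ℚₚ.≤-trans (apart (here refl) (there z∈B) λ { refl → x∉B z∈B })
          (lin (*-mono-nonneg K≥0 (T.tri x y z)) (identity K (dT x z) (dT y z) a)))
        where
        identity : ∀ k xz yz xy → k * yz + k * xy + k * xz ≡ k * xz + k * (xy + yz)
        identity = solve-∀ ℚ-ring
      ... | inj₂ e = subst (λ t → t ⊓ r z ≤ℚ K * dT y z + c) (sym e)
        (≤-step c≥0 (apart (there y∈B) (there z∈B) y≢z))
      apart-m : ∀ {z z′} → z ∈ B → z′ ∈ B → z ≢ z′ → m z ⊓ m z′ ≤ℚ K * dT z z′ + c
      apart-m {z} {z′} z∈B z′∈B ne with z ≟ y | z′ ≟ y
      ... | yes refl | yes refl = ⊥-elim (ne refl)
      ... | yes refl | no _ = apart-y z′∈B ne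
      ... | no _ | yes refl = subst₂ _≤ℚ_ (ℚₚ.⊓-comm (r x ⊔ r y) (r z)) (cong (λ t → K * t + c) (T.symm y z))
        (apart-y z∈B (ne ∘ sym))
      ... | no _ | no _ = ≤-step c≥0 (apart (there z∈B) (there z′∈B) ne)
      ap : ∀ {z z′} → z ∈ B → z′ ∈ B → z ≢ z′ → r′ z ⊓ r′ z′ ≤ℚ K * dT z z′
      ap {z} {z′} z∈B z′∈B ne = ⊓-⁺ {m z} {m z′} (KdT≥0 z z′) (apart-m z∈B z′∈B ne)
      t t′ : Fin n → Fin n → ℚ
      t = term D r
      t′ = term D r′
      t≥0 : ∀ u v → 0ℚ ≤ℚ t u v
      t≥0 = term-nonneg Dm nonneg
      -- The row and the column of x are charged to the row and the column of y. The value over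
      -- `x ∷ B` thereby becomes a single sum over pairs from B, which is bounded pointwise.
      onlyAt-y : Fin n → ℚ → ℚ
      onlyAt-y z q with z ≟ y
      ... | yes _ = q
      ... | no _ = 0ℚ
      at-y : ∀ q → onlyAt-y y q ≡ q
      at-y q with y ≟ y
      ... | yes _ = refl
      ... | no ne = ⊥-elim (ne refl)
      onlyAt-y-nonneg : ∀ z {q} → 0ℚ ≤ℚ q → 0ℚ ≤ℚ onlyAt-y z q
      onlyAt-y-nonneg z h with z ≟ y
      ... | yes _ = h
      ... | no _ = ℚₚ.≤-refl
      s₁ s₂ : Fin n → Fin n → ℚ
      s₁ z z′ = onlyAt-y z (t x z′)
      s₂ z z′ = onlyAt-y z′ (t z x)
      txx≤0 : t x x ≤ℚ 0ℚ
      txx≤0 = ℚₚ.≤-trans (⊓≤₁ (D x x) (r x ⊓ r x)) (ℚₚ.≤-reflexive (D.self x))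
      row : ∑ B (t x) ≤ℚ ∑ B (λ z → ∑ B (s₁ z))
      row = ℚₚ.≤-trans (ℚₚ.≤-reflexive (sym (∑-cong B λ {z′} _ → at-y (t x z′))))
        (∑-member B {λ z → ∑ B (s₁ z)} (λ {z} _ → ∑-nonneg B λ {z′} _ → onlyAt-y-nonneg z (t≥0 x z′)) y∈B)
      column : ∑ B (λ z → t z x) ≤ℚ ∑ B (λ z → ∑ B (s₂ z))
      column = ∑-mono B λ {z} _ → ℚₚ.≤-trans (ℚₚ.≤-reflexive (sym (at-y (t z x))))
        (∑-member B {s₂ z} (λ {z′} _ → onlyAt-y-nonneg z′ (t≥0 z x)) y∈B)
      expand : value D (x ∷ B) r ≤ℚ ∑ B (λ z → ∑ B (λ z′ → t z z′ + s₁ z z′ + s₂ z z′))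
      expand = ℚₚ.≤-trans (ℚₚ.≤-reflexive (cong (t x x + ∑ B (t x) +_) (∑-+ B (λ z → t z x) (λ z → ∑ B (t z)))))
        (ℚₚ.≤-trans
          (lin (txx≤0 ⊕ row ⊕ column)
            (identity (t x x) (∑ B (t x)) (∑ B (λ z → t z x)) (∑ B (λ z → ∑ B (t z)))
              (∑ B (λ z → ∑ B (s₁ z))) (∑ B (λ z → ∑ B (s₂ z)))))
          (ℚₚ.≤-reflexive (sym (trans (∑-cong B λ {z} _ → trans (∑-+ B (λ z′ → t z z′ + s₁ z z′) (s₂ z))
              (cong (_+ ∑ B (s₂ z)) (∑-+ B (t z) (s₁ z))))
            (trans (∑-+ B (λ z → ∑ B (t z) + ∑ B (s₁ z)) (λ z → ∑ B (s₂ z)))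
              (cong (_+ ∑ B (λ z → ∑ B (s₂ z))) (∑-+ B (λ z → ∑ B (t z)) (λ z → ∑ B (s₁ z)))))))))
        where
        identity : ∀ xx tx ty tt a b → tt + a + b + (xx + tx + ty) ≡ xx + tx + (ty + tt) + (0ℚ + a + b)
        identity = solve-∀ ℚ-ring
      c≤E : c ≤ℚ E
      c≤E = lin (c≥0 ⊕ a≥0) (identity c a)
        where
        identity : ∀ c a → c + c + a + (0ℚ + 0ℚ) ≡ c + (c + a)
        identity = solve-∀ ℚ-ring
      E≥0 : 0ℚ ≤ℚ E
      E≥0 = ℚₚ.≤-trans c≥0 c≤E
      ≤m : ∀ z → r z ≤ℚ m z
      ≤m z with z ≟ y
      ... | yes refl = ℚₚ.p≤q⊔p (r x) (r y)
      ... | no _ = ℚₚ.≤-refl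
      my : m y ≡ r x ⊔ r y
      my with y ≟ y
      ... | yes _ = refl
      ... | no ne = ⊥-elim (ne refl)
      r≤r′ : ∀ z → r z ≤ℚ r′ z + c
      r≤r′ z = ℚₚ.≤-trans (≤m z) (sub-⁺ (m z) c)
      rx≤r′y : r x ≤ℚ r′ y + c
      rx≤r′y = ℚₚ.≤-trans (subst (r x ≤ℚ_) (sym my) (ℚₚ.p≤p⊔q (r x) (r y))) (sub-⁺ (m y) c)
      Dx≤ : ∀ z → D x z ≤ℚ a + D y z
      Dx≤ z = ℚₚ.≤-trans (D.tri x y z) (D≤dT x y ⊕ ℚₚ.≤-refl {D y z})
      pair-y : ∀ z → t y z + t x z ≤ℚ t′ y z + E
      pair-y z = ⊓-swap-bound {D y z} {D x z} {r y} {r x} {r z} {c} {a} {r′ y} {r′ z}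
        (Dx≤ z) rx≤r′y (r≤r′ y) (r≤r′ z) rx⊓ry≤c c≥0 a≥0
      txy≤c : t x y ≤ℚ c
      txy≤c = ℚₚ.≤-trans (⊓≤₂ (D x y) (r x ⊓ r y)) rx⊓ry≤c
      tyy≤0 : t y y ≤ℚ 0ℚ
      tyy≤0 = ℚₚ.≤-trans (⊓≤₁ (D y y) (r y ⊓ r y)) (ℚₚ.≤-reflexive (D.self y))
      pointwise : ∀ {z z′} → z ∈ B → z′ ∈ B → t z z′ + s₁ z z′ + s₂ z z′ ≤ℚ t′ z z′ + E
      pointwise {z} {z′} z∈B z′∈B = cases (z ≟ y) (z′ ≟ y)
        where
        off-y : ∀ {u} q → u ≢ y → onlyAt-y u q ≡ 0ℚ
        off-y {u} q ne with u ≟ y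
        ... | yes e = ⊥-elim (ne e)
        ... | no _ = refl
        cases : Dec (z ≡ y) → Dec (z′ ≡ y) → t z z′ + s₁ z z′ + s₂ z z′ ≤ℚ t′ z z′ + E
        cases (yes refl) (yes refl) = subst₂ (λ p q → t y y + p + q ≤ℚ t′ y y + E) (sym (at-y (t x y))) (sym (at-y (t y x)))
          (lin (tyy≤0 ⊕ txy≤c ⊕ subst (_≤ℚ c) (term-symm Dm r x y) txy≤c ⊕ term-nonneg Dm nn y y ⊕ a≥0)
            (identity (t y y) (t x y) (t y x) (t′ y y) c a))
          where
          identity : ∀ yy xy yx t c a → t + (c + c + a) + (yy + xy + yx + 0ℚ + 0ℚ) ≡ yy + xy + yx + (0ℚ + c + c + t + a)
          identity = solve-∀ ℚ-ring
        cases (yes refl) (no ne) = subst₂ (λ p q → t y z′ + p + q ≤ℚ t′ y z′ + E) (sym (at-y (t x z′))) (sym (off-y (t y x) ne))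
          (ℚₚ.≤-trans (ℚₚ.≤-reflexive (ℚₚ.+-identityʳ (t y z′ + t x z′))) (pair-y z′))
        cases (no ne) (yes refl) = subst₂ (λ p q → t z y + p + q ≤ℚ t′ z y + E) (sym (off-y (t x y) ne)) (sym (at-y (t z x)))
          (subst₂ _≤ℚ_
            (cong₂ _+_ (trans (term-symm Dm r y z) (sym (ℚₚ.+-identityʳ (t z y)))) (term-symm Dm r x z))
            (cong (_+ E) (term-symm Dm r′ y z)) (pair-y z))
        cases (no ne) (no ne′) = subst₂ (λ p q → t z z′ + p + q ≤ℚ t′ z z′ + E) (sym (off-y (t x z′) ne)) (sym (off-y (t z x) ne′))
          (ℚₚ.≤-trans (ℚₚ.≤-reflexive (trans (ℚₚ.+-identityʳ (t z z′ + 0ℚ)) (ℚₚ.+-identityʳ (t z z′))))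
            (ℚₚ.≤-trans (⊓₃-glb-+ {t z z′} {D z z′} {r′ z} {r′ z′} {c}
                (≤-step c≥0 (⊓≤₁ (D z z′) (r z ⊓ r z′)))
                (ℚₚ.≤-trans (ℚₚ.≤-trans (⊓≤₂ (D z z′) (r z ⊓ r z′)) (⊓≤₁ (r z) (r z′))) (r≤r′ z))
                (ℚₚ.≤-trans (ℚₚ.≤-trans (⊓≤₂ (D z z′) (r z ⊓ r z′)) (⊓≤₂ (r z) (r z′))) (r≤r′ z′)))
              (ℚₚ.≤-refl {t′ z z′} ⊕ c≤E)))

-- Vertex orders, their boundaries, and distances to a list.

Unique-⊆-length : ∀ {A : Set} {xs ys : List A} → Unique xs → xs ⊆ ys → length xs ≤ length ys
Unique-⊆-length [] _ = z≤n
Unique-⊆-length {xs = x ∷ xs} (x∉ ∷ u) sub with ∈-∃++ (sub (here refl))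
... | ys₁ , ys₂ , refl = ℕₚ.≤-trans (s≤s (Unique-⊆-length u sub′))
  (ℕₚ.≤-reflexive (trans (cong suc (Listₚ.length-++ ys₁)) (trans (sym (ℕₚ.+-suc (length ys₁) (length ys₂))) (sym (Listₚ.length-++ ys₁)))))
  where
  sub′ : xs ⊆ ys₁ ++ ys₂
  sub′ p with ∈-++⁻ ys₁ (sub (there p))
  ... | inj₁ q = ∈-++⁺ˡ q
  ... | inj₂ (here refl) = ⊥-elim (All.lookup x∉ p refl)
  ... | inj₂ (there q) = ∈-++⁺ʳ ys₁ q

absℚ-≤ : ∀ {p q t} → p ≤ℚ q + t → q ≤ℚ p + t → absℚ (p - q) ≤ℚ t
absℚ-≤ {p} {q} {t} h h′ with ℚₚ.∣p∣≡p∨∣p∣≡-p (p - q)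
... | inj₁ e = subst (_≤ℚ t) (sym e) (lin h (identity p q t))
  where
  identity : ∀ p q t → t + p ≡ p - q + (q + t)
  identity = solve-∀ ℚ-ring
... | inj₂ e = subst (_≤ℚ t) (sym e) (lin h′ (identity p q t))
  where
  identity : ∀ p q t → t + q ≡ - (p - q) + (p + t)
  identity = solve-∀ ℚ-ring

module _ {n : ℕ} where

  open import Data.List.Membership.DecPropositional (_≟_ {n}) using (_∈?_)

  -- A test metric for `metricOf-univ`: a function that changes along each edge by at most its
  -- weight bounds distances from below.
  difference-metric : ∀ (φ : Fin n → ℚ) → IsMetric (λ u v → absℚ (φ u - φ v))
  difference-metric φ = record
    { nonneg = λ u v → ℚₚ.0≤∣p∣ (φ u - φ v)
    ; self = λ u → cong absℚ (ℚₚ.+-inverseʳ (φ u))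
    ; symm = λ u v → trans (cong absℚ (negate (φ u) (φ v))) (ℚₚ.∣-p∣≡∣p∣ (φ v - φ u))
    ; tri = λ u v z → ℚₚ.≤-trans (ℚₚ.≤-reflexive (cong absℚ (split (φ u) (φ v) (φ z)))) (ℚₚ.∣p+q∣≤∣p∣+∣q∣ (φ u - φ v) (φ v - φ z)) }
    where
    negate : ∀ a b → a - b ≡ - (b - a)
    negate = solve-∀ ℚ-ring
    split : ∀ a b c → a - c ≡ (a - b) + (b - c)
    split = solve-∀ ℚ-ring

  Exits : Adj n → List (Fin n) → Fin n → Set
  Exits A ps y = ∃ λ z → z ∉ ps × Edge A y z

  exits? : ∀ A ps → Decidable (Exits A ps)
  exits? A ps y = Finₚ.any? λ z → ¬? (z ∈? ps) ×-dec (A y z Boolₚ.≟ true)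

  -- The boundary of the set ps of already processed vertices, the most recent vertex first.
  bag : Adj n → List (Fin n) → List (Fin n)
  bag A [] = []
  bag A (x ∷ ps) = filter (exits? A (x ∷ ps)) (x ∷ bag A ps)

  bag⁺ : ∀ A ps {y} → y ∈ ps → Exits A ps y → y ∈ bag A ps
  bag⁺ A (x ∷ ps) (here refl) ex = ∈-filter⁺ (exits? A (x ∷ ps)) (here refl) ex
  bag⁺ A (x ∷ ps) (there p) ex@(z , z∉ , e) =
    ∈-filter⁺ (exits? A (x ∷ ps)) (there (bag⁺ A ps p (z , z∉ ∘ there , e))) ex

  bag⁻ : ∀ A ps {y} → y ∈ bag A ps → y ∈ ps × Exits A ps y
  bag⁻ A (x ∷ ps) p with ∈-filter⁻ (exits? A (x ∷ ps)) {xs = x ∷ bag A ps} p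
  ... | here refl , ex = here refl , ex
  ... | there q , ex = there (proj₁ (bag⁻ A ps q)) , ex

  -- The head of the list is the latest vertex. The boundary is bounded before each insertion, so
  -- together with the inserted vertex it has at most `suc q` elements.
  data Order (A : Adj n) (q : ℕ) : List (Fin n) → Set where
    [] : Order A q []
    step : ∀ {x ps} → x ∉ ps → length (bag A ps) ≤ q → Order A q ps → Order A q (x ∷ ps)

  inside? : ∀ ps (u v : Fin n) → Dec (u ∈ ps × v ∈ ps)
  inside? ps u v = (u ∈? ps) ×-dec (v ∈? ps)

  clip : List (Fin n) → Fin n → Fin n → ℚ → ℚ
  clip ps u v ω with inside? ps u v
  ... | yes _ = 0ℚ
  ... | no _ = ω

  clip-inside : ∀ {ps u v} ω → u ∈ ps → v ∈ ps → clip ps u v ω ≡ 0ℚ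
  clip-inside {ps} {u} {v} ω p q with inside? ps u v
  ... | yes _ = refl
  ... | no ¬pq = ⊥-elim (¬pq (p , q))

  clip-outside : ∀ {ps u v} ω → ¬ (u ∈ ps × v ∈ ps) → clip ps u v ω ≡ ω
  clip-outside {ps} {u} {v} ω ¬pq with inside? ps u v
  ... | yes pq = ⊥-elim (¬pq pq)
  ... | no _ = refl

  clip-nonneg : ∀ ps u v {ω} → 0ℚ ≤ℚ ω → 0ℚ ≤ℚ clip ps u v ω
  clip-nonneg ps u v h with inside? ps u v
  ... | yes _ = ℚₚ.≤-refl
  ... | no _ = h

  clip-anti : ∀ x ps u v {ω} → 0ℚ ≤ℚ ω → clip (x ∷ ps) u v ω ≤ℚ clip ps u v ω
  clip-anti x ps u v {ω} h with inside? ps u v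
  ... | yes (p , q) = ℚₚ.≤-reflexive (clip-inside ω (there p) (there q))
  ... | no _ with inside? (x ∷ ps) u v
  ...   | yes _ = h
  ...   | no _ = ℚₚ.≤-refl

  -- The value M on the empty list is what the first vertex of the sweep costs; it is subtracted again in Lightness.invariant.
  near : ℚ → (Fin n → Fin n → ℚ) → Fin n → List (Fin n) → ℚ
  near M D y [] = M
  near M D y (z ∷ zs) = D y z ⊓ near M D y zs

  module _ (M : ℚ) (D : Fin n → Fin n → ℚ) where

    near≤M : ∀ y zs → near M D y zs ≤ℚ M
    near≤M y [] = ℚₚ.≤-refl
    near≤M y (z ∷ zs) = ℚₚ.≤-trans (⊓≤₂ (D y z) (near M D y zs)) (near≤M y zs)

    near≤ : ∀ y {z} zs → z ∈ zs → near M D y zs ≤ℚ D y z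
    near≤ y (z ∷ zs) (here refl) = ⊓≤₁ (D y z) (near M D y zs)
    near≤ y (z ∷ zs) (there p) = ℚₚ.≤-trans (⊓≤₂ (D y z) (near M D y zs)) (near≤ y zs p)

    near-glb : ∀ {a} y zs → a ≤ℚ M → (∀ {z} → z ∈ zs → a ≤ℚ D y z) → a ≤ℚ near M D y zs
    near-glb y [] h k = h
    near-glb y (z ∷ zs) h k = ℚₚ.⊓-glb (k (here refl)) (near-glb y zs h (k ∘ there))

    near-attained : (∀ x y → D x y ≤ℚ M) → ∀ y zs {z} → z ∈ zs → ∃ λ z′ → z′ ∈ zs × D y z′ ≤ℚ near M D y zs
    near-attained D≤M y (z ∷ []) _ = z , here refl , ℚₚ.⊓-glb ℚₚ.≤-refl (D≤M y z)
    near-attained D≤M y (z ∷ z₁ ∷ zs) _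
      with near-attained D≤M y (z₁ ∷ zs) (here refl) | ℚₚ.⊓-sel (D y z) (near M D y (z₁ ∷ zs))
    ... | _ | inj₁ e = z , here refl , ℚₚ.≤-reflexive (sym e)
    ... | z′ , z′∈ , h | inj₂ e = z′ , there z′∈ , ℚₚ.≤-trans h (ℚₚ.≤-reflexive (sym e))

  near-shift : ∀ M (D D′ : Fin n → Fin n → ℚ) y y′ {g} zs → 0ℚ ≤ℚ g → (∀ z → D y z ≤ℚ D′ y′ z + g) →
    near M D y zs ≤ℚ near M D′ y′ zs + g
  near-shift M D D′ y y′ [] g≥0 h = ≤-step g≥0 ℚₚ.≤-refl
  near-shift M D D′ y y′ {g} (z ∷ zs) g≥0 h with ℚₚ.⊓-sel (D′ y′ z) (near M D′ y′ zs)
  ... | inj₁ e = subst (λ t → D y z ⊓ near M D y zs ≤ℚ t + g) (sym e)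
    (ℚₚ.≤-trans (⊓≤₁ (D y z) (near M D y zs)) (h z))
  ... | inj₂ e = subst (λ t → D y z ⊓ near M D y zs ≤ℚ t + g) (sym e)
    (ℚₚ.≤-trans (⊓≤₂ (D y z) (near M D y zs)) (near-shift M D D′ y y′ zs g≥0 h))

-- The total distance at which vertices are introduced.

module Introduction {n : ℕ} {A : Adj n} (A-sym : ∀ u v → A u v ≡ A v u)
  {w : Fin n → Fin n → ℚ} (w≥0 : ∀ u v → 0ℚ ≤ℚ w u v)
  {M : ℚ} (M≥0 : 0ℚ ≤ℚ M) (Tl : List (Fin n × Fin n))
  (Tl⊆A : ∀ {u v} → (u , v) ∈ Tl → Edge A u v) where

  open import Data.List.Membership.DecPropositional (_≟_ {n}) using (_∈?_)

  TreeStep : Fin n → Fin n → Set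
  TreeStep u v = (u , v) ∈ Tl ⊎ (v , u) ∈ Tl

  TreePath : Fin n → Fin n → Set
  TreePath = Star TreeStep

  dT : Fin n → Fin n → ℚ
  dT = metricOf M (weigh w Tl)

  dT-metric : IsMetric dT
  dT-metric = metricOf-metric M≥0 (weigh-nonneg w≥0 Tl)

  private module T = IsMetric dT-metric

  dT-edge : ∀ {u v} → (u , v) ∈ Tl → dT u v ≤ℚ w u v
  dT-edge p = metricOf-edge M≥0 (weigh-nonneg w≥0 Tl) (∈-map⁺ _ p)

  unseen : List (Fin n) → Fin n → Fin n → ℚ
  unseen ps u v = clip ps u v (w u v)

  unseen≥0 : ∀ ps u v → 0ℚ ≤ℚ unseen ps u v
  unseen≥0 ps u v = clip-nonneg ps u v (w≥0 u v)

  -- The tree metric after contracting the tree edges inside ps.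
  dC : List (Fin n) → Fin n → Fin n → ℚ
  dC ps = metricOf M (weigh (unseen ps) Tl)

  dC-metric : ∀ ps → IsMetric (dC ps)
  dC-metric ps = metricOf-metric M≥0 (weigh-nonneg (unseen≥0 ps) Tl)

  dC-contracted : ∀ {ps u v} → TreeStep u v → u ∈ ps → v ∈ ps → dC ps u v ≤ℚ 0ℚ
  dC-contracted {ps} {u} {v} (inj₁ e) p q = ℚₚ.≤-trans
    (metricOf-edge M≥0 (weigh-nonneg (unseen≥0 ps) Tl) (∈-map⁺ _ e)) (ℚₚ.≤-reflexive (clip-inside (w u v) p q))
  dC-contracted {ps} {u} {v} (inj₂ e) p q =
    subst (_≤ℚ 0ℚ) (IsMetric.symm (dC-metric ps) v u) (dC-contracted {ps} (inj₁ e) q p)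

  dC-trans0 : ∀ ps {x y z} → dC ps x y ≤ℚ 0ℚ → dC ps y z ≤ℚ 0ℚ → dC ps x z ≤ℚ 0ℚ
  dC-trans0 ps {x} {y} {z} p q = ℚₚ.≤-trans (IsMetric.tri (dC-metric ps) x y z) (p ⊕ q)

  -- The path starts in `ps` and must leave it. The last vertex before it first does so lies on the
  -- boundary, and all edges up to there are contracted.
  exit : ∀ ps {x y} → TreePath y x → y ∈ ps → x ∉ ps → ∃ λ b → b ∈ bag A ps × dC ps y b ≤ℚ 0ℚ
  exit ps nil y∈ x∉ = ⊥-elim (x∉ y∈)
  exit ps {x} {y} (_◅_ {j = y′} s path) y∈ x∉ with y′ ∈? ps
  ... | yes y′∈ with exit ps path y′∈ x∉
  ...   | b , b∈ , h = b , b∈ , dC-trans0 ps (dC-contracted s y∈ y′∈) h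
  exit ps {x} {y} (_◅_ {j = y′} s path) y∈ x∉ | no y′∉ =
    y , bag⁺ A ps y∈ (y′ , y′∉ , edge s) , ℚₚ.≤-reflexive (IsMetric.self (dC-metric ps) y)
    where
    edge : TreeStep y y′ → Edge A y y′
    edge (inj₁ e) = Tl⊆A e
    edge (inj₂ e) = trans (A-sym y y′) (Tl⊆A e)

  module _ (ps : List (Fin n)) where

    private
      B : List (Fin n)
      B = bag A ps

      φ : Fin n → ℚ
      φ u with u ∈? ps
      ... | yes _ = 0ℚ
      ... | no _ = near M dT u B

      φ≥0 : ∀ u → 0ℚ ≤ℚ φ u
      φ≥0 u with u ∈? ps
      ... | yes _ = ℚₚ.≤-refl
      ... | no _ = near-glb M dT u B M≥0 (λ {z} _ → T.nonneg u z)

      φ≤M : ∀ u → φ u ≤ℚ M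
      φ≤M u with u ∈? ps
      ... | yes _ = M≥0
      ... | no _ = near≤M M dT u B

      -- If the edge leads from u outside `ps` to v inside, then v is a boundary vertex, so the
      -- distance of u from the boundary is at most the length of the edge. An edge inside `ps` has
      -- clipped length 0, and `φ` vanishes at both of its ends.
      φ-lipschitz : ∀ u v ω → Edge A v u → 0ℚ ≤ℚ ω → dT u v ≤ℚ ω → φ u ≤ℚ φ v + clip ps u v ω
      φ-lipschitz u v ω e ω≥0 h with u ∈? ps | v ∈? ps
      ... | yes _ | yes _ = ℚₚ.≤-refl
      ... | yes _ | no _ = +-nonneg (near-glb M dT v B M≥0 (λ {z} _ → T.nonneg v z)) ω≥0
      ... | no u∉ | yes v∈ = ℚₚ.≤-trans (near≤ M dT u B (bag⁺ A ps v∈ (u , u∉ , e)))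
        (ℚₚ.≤-trans h (ℚₚ.≤-reflexive (sym (ℚₚ.+-identityˡ ω))))
      ... | no _ | no _ = near-shift M dT dT u v B ω≥0 λ z → ℚₚ.≤-trans (T.tri u v z)
        (ℚₚ.≤-trans (h ⊕ ℚₚ.≤-refl {dT v z}) (ℚₚ.≤-reflexive (ℚₚ.+-comm ω (dT v z))))

      clip-symm : ∀ u v ω → clip ps u v ω ≡ clip ps v u ω
      clip-symm u v ω with inside? ps u v
      ... | yes (p , q) = sym (clip-inside ω q p)
      ... | no ¬pq = sym (clip-outside ω λ { (p , q) → ¬pq (q , p) })

      ρ≤dC : ∀ u v → absℚ (φ u - φ v) ≤ℚ dC ps u v
      ρ≤dC = metricOf-univ M≥0 (weigh (unseen ps) Tl) (difference-metric φ)
        (λ u v → absℚ-≤ (ℚₚ.≤-trans (φ≤M u) (subst (_≤ℚ φ v + M) (ℚₚ.+-identityˡ M) (φ≥0 v ⊕ ℚₚ.≤-refl {M})))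
                        (ℚₚ.≤-trans (φ≤M v) (subst (_≤ℚ φ u + M) (ℚₚ.+-identityˡ M) (φ≥0 u ⊕ ℚₚ.≤-refl {M}))))
        edge
        where
        edge : ∀ {u v ω} → (u , v , ω) ∈ weigh (unseen ps) Tl → absℚ (φ u - φ v) ≤ℚ ω
        edge p with weigh-∈ {ω = unseen ps} Tl p
        ... | (u , v) , e , refl = absℚ-≤
          (φ-lipschitz u v (w u v) (trans (A-sym v u) (Tl⊆A e)) (w≥0 u v) (dT-edge e))
          (subst (λ t → φ v ≤ℚ φ u + t) (clip-symm v u (w u v))
            (φ-lipschitz v u (w u v) (Tl⊆A e) (w≥0 u v) (subst (_≤ℚ w u v) (T.symm u v) (dT-edge e))))

    -- A path from outside reaches the boundary before it can use a contracted edge. Formally, `φ`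
    -- is 0 on `ps` and equals the boundary distance at x, and its differences are at most
    -- contracted distances.
    contraction-keeps-boundary-distance : ∀ {x} → x ∉ ps → near M dT x (bag A ps) ≤ℚ near M (dC ps) x ps
    contraction-keeps-boundary-distance {x} x∉ = near-glb M (dC ps) x ps (near≤M M dT x B) λ {z} z∈ →
      ℚₚ.≤-trans (ℚₚ.≤-reflexive (sym (difference z∈))) (ρ≤dC x z)
      where
      difference : ∀ {z} → z ∈ ps → absℚ (φ x - φ z) ≡ near M dT x B
      difference {z} z∈ with x ∈? ps | z ∈? ps
      ... | yes x∈ | _ = ⊥-elim (x∉ x∈)
      ... | no _ | no z∉ = ⊥-elim (z∉ z∈)
      ... | no _ | yes _ = trans (cong absℚ (ℚₚ.+-identityʳ (near M dT x B)))
        (ℚₚ.0≤p⇒∣p∣≡p (near-glb M dT x B M≥0 (λ {z} _ → T.nonneg x z)))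

  -- The sum J of the sweep. The oldest vertex contributes `M`, having no earlier vertices.
  older : (Fin n → Fin n → ℚ) → List (Fin n) → ℚ
  older D [] = 0ℚ
  older D (y ∷ os) = near M D y os + older D os

  -- Only the oldest vertex of a component of the processed part of the tree is at positive
  -- contracted distance from the vertices before it, and every component meets the boundary.
  record Founders (ps os : List (Fin n)) (D′ : Fin n → Fin n → ℚ) (g : ℚ) : Set where
    field
      bs : List (Fin n)
      unique : Unique bs
      bs⊆ : bs ⊆ bag A ps
      reached : ∀ {b} → b ∈ bs → ∃ λ y → y ∈ os × dC ps y b ≤ℚ 0ℚ
      bound : older (dC ps) os ≤ℚ older D′ os + fromℕ (length bs) * g

  -- Proceed from the oldest vertex on. A vertex at contracted distance 0 from the older ones loses
  -- nothing. Any other vertex loses at most g, and the boundary vertex of its component is not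
  -- reached by older vertices, so it can be added to `bs` without repetition.
  founders : ∀ ps {D′ g} → IsMetric D′ → 0ℚ ≤ℚ g → (∀ u v → dC ps u v ≤ℚ D′ u v + g) →
    (∀ {y} → y ∈ ps → ∃ λ b → b ∈ bag A ps × dC ps y b ≤ℚ 0ℚ) →
    ∀ os → os ⊆ ps → Founders ps os D′ g
  founders ps {D′} {g} D′m g≥0 close ex [] sub = record
    { bs = [] ; unique = [] ; bs⊆ = λ () ; reached = λ ()
    ; bound = ℚₚ.≤-reflexive (sym (trans (ℚₚ.+-identityˡ (0ℚ * g)) (ℚₚ.*-zeroˡ g))) }
  founders ps {D′} {g} D′m g≥0 close ex (y ∷ os) sub
    with founders ps D′m g≥0 close ex os (sub ∘ there) | near M (dC ps) y os ℚₚ.≤? 0ℚ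
  ... | F | yes small = record
    { bs = bs ; unique = unique ; bs⊆ = bs⊆
    ; reached = λ b∈ → case reached b∈ of λ { (y , y∈ , h) → y , there y∈ , h }
    ; bound = lin (ℚₚ.≤-trans small (near-glb M D′ y os M≥0 (λ {z} _ → IsMetric.nonneg D′m y z)) ⊕ bound)
        (identity (near M (dC ps) y os) (near M D′ y os) (older (dC ps) os) (older D′ os) (fromℕ (length bs) * g)) }
    where
    open Founders F
    identity : ∀ a a′ b b′ c → a′ + b′ + c + (a + b) ≡ a + b + (a′ + (b′ + c))
    identity = solve-∀ ℚ-ring
  ... | F | no large with ex (sub (here refl))
  ...   | b , b∈ , yb = record
    { bs = b ∷ bs ; unique = Allₚ.¬Any⇒All¬ bs fresh ∷ unique
    ; bs⊆ = λ { (here refl) → b∈ ; (there p) → bs⊆ p }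
    ; reached = λ { (here refl) → y , here refl , yb
                  ; (there p) → case reached p of λ { (y , y∈ , h) → y , there y∈ , h } }
    ; bound = lin (near-shift M (dC ps) D′ y y os g≥0 (close y) ⊕ bound)
        (identity (near M (dC ps) y os) (near M D′ y os) (older (dC ps) os) (older D′ os) (fromℕ (length bs)) g) }
    where
    open Founders F
    module C = IsMetric (dC-metric ps)
    fresh : b ∉ bs
    fresh p with reached p
    ... | y′ , y′∈ , y′b = large (ℚₚ.≤-trans (near≤ M (dC ps) y os y′∈)
      (dC-trans0 ps yb (subst (_≤ℚ 0ℚ) (C.symm y′ b) y′b)))
    identity : ∀ a a′ b b′ k c → a′ + b′ + (1ℚ + k) * c + (a + b) ≡ a + b + (a′ + c + (b′ + k * c))
    identity = solve-∀ ℚ-ring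

  cost : List (Fin n) → ℚ
  cost [] = 0ℚ
  cost (x ∷ ps) = near M dT x (bag A ps) + cost ps

  unseenWeight : List (Fin n) → ℚ
  unseenWeight ps = ∑ Tl λ e → unseen ps (proj₁ e) (proj₂ e)

  module _ (connected : ∀ x y → TreePath x y) where

    -- Let sweeping x contract tree edges of total weight g. The boundary distance of x is at most
    -- its contracted distance to `ps`, which falls by at most g, and the older summands of J fall
    -- by at most q g in total. The decrease of (q + 1) times the unseen weight pays for both.
    cost-invariant : ∀ {q ps} → Order A q ps →
      cost ps + fromℕ (suc q) * unseenWeight ps ≤ℚ fromℕ (suc q) * unseenWeight [] + older (dC ps) ps
    cost-invariant {q} [] = ℚₚ.≤-reflexive (ℚₚ.+-comm 0ℚ (fromℕ (suc q) * unseenWeight []))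
    cost-invariant {q} {x ∷ ps} (step x∉ len≤ ord) =
      lin (contraction-keeps-boundary-distance ps x∉ ⊕ near-shift M (dC ps) (dC (x ∷ ps)) x x ps g≥0 (close x) ⊕ bound ⊕ few ⊕ cost-invariant ord)
        (identity (near M dT x (bag A ps)) (near M (dC ps) x ps) (near M (dC (x ∷ ps)) x ps)
          (older (dC ps) ps) (older (dC (x ∷ ps)) ps) (cost ps) (fromℕ q) (fromℕ (length bs))
          (unseenWeight ps) (unseenWeight (x ∷ ps)) (unseenWeight []))
      where
      g : ℚ
      g = unseenWeight ps - unseenWeight (x ∷ ps)
      δ-sum : ∀ F → ∑ F (λ e → unseen ps (proj₁ e) (proj₂ e) - unseen (x ∷ ps) (proj₁ e) (proj₂ e))
        ≡ ∑ F (λ e → unseen ps (proj₁ e) (proj₂ e)) - ∑ F (λ e → unseen (x ∷ ps) (proj₁ e) (proj₂ e))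
      δ-sum [] = refl
      δ-sum ((u , v) ∷ F) = trans (cong (unseen ps u v - unseen (x ∷ ps) u v +_) (δ-sum F))
        (swap (unseen ps u v) (unseen (x ∷ ps) u v) (∑ F (λ e → unseen ps (proj₁ e) (proj₂ e))) (∑ F (λ e → unseen (x ∷ ps) (proj₁ e) (proj₂ e))))
        where
        swap : ∀ a b c d → (a - b) + (c - d) ≡ (a + c) - (b + d)
        swap = solve-∀ ℚ-ring
      anti : ∀ u v → unseen (x ∷ ps) u v ≤ℚ unseen ps u v
      anti u v = clip-anti x ps u v (w≥0 u v)
      g≥0 : 0ℚ ≤ℚ g
      g≥0 = lin (∑-mono Tl (λ {e} _ → anti (proj₁ e) (proj₂ e))) (identity (unseenWeight ps) (unseenWeight (x ∷ ps)))
        where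
        identity : ∀ a b → a - b + b ≡ 0ℚ + a
        identity = solve-∀ ℚ-ring
      close : ∀ u v → dC ps u v ≤ℚ dC (x ∷ ps) u v + g
      close u v = subst (λ t → dC ps u v ≤ℚ dC (x ∷ ps) u v + t) (δ-sum Tl)
        (metricOf-lipschitz M≥0 (unseen≥0 ps) (unseen≥0 (x ∷ ps)) anti Tl u v)
      open Founders (founders ps (dC-metric (x ∷ ps)) g≥0 close
        (λ {y} y∈ → exit ps (connected y x) y∈ x∉) ps id)
      few : fromℕ (length bs) * g ≤ℚ fromℕ q * g
      few = ℚₚ.*-monoʳ-≤-nonNeg g ⦃ ℚ.nonNegative g≥0 ⦄
        (fromℕ-mono (ℕₚ.≤-trans (Unique-⊆-length unique bs⊆) len≤))
      identity : ∀ a b b′ o o′ c q l U U′ U₀ →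
        (1ℚ + q) * U₀ + (b′ + o′) + (a + b + o + l * (U - U′) + (c + (1ℚ + q) * U))
        ≡ a + c + (1ℚ + q) * U′ + (b + (b′ + (U - U′)) + (o′ + l * (U - U′)) + q * (U - U′) + ((1ℚ + q) * U₀ + o))
      identity = solve-∀ ℚ-ring

    -- Once all vertices are swept, the connected graph `Tl` is contracted to a point, and J is at
    -- most the `M` of the first vertex.
    cost-bound : ∀ {q ps} → Order A q ps → (∀ x → x ∈ ps) → cost ps ≤ℚ fromℕ (suc q) * ∑ Tl (λ e → w (proj₁ e) (proj₂ e)) + M
    cost-bound {q} {ps} ord all = lin (cost-invariant ord ⊕ older≤M ps ⊕ *-nonneg (fromℕ-nonneg (suc q)) (∑-nonneg Tl (λ {e} _ → unseen≥0 ps (proj₁ e) (proj₂ e))))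
      (identity (cost ps) (fromℕ (suc q)) (unseenWeight ps) (unseenWeight []) (older (dC ps) ps) M)
      where
      identity : ∀ c q U U₀ o m → q * U₀ + m + (c + q * U + o + 0ℚ) ≡ c + (q * U₀ + o + m + q * U)
      identity = solve-∀ ℚ-ring
      path0 : ∀ {x y} → TreePath x y → dC ps x y ≤ℚ 0ℚ
      path0 {x} nil = ℚₚ.≤-reflexive (IsMetric.self (dC-metric ps) x)
      path0 (_◅_ {i = u} {j = v} s path) = dC-trans0 ps (dC-contracted s (all u) (all v)) (path0 path)
      older≤M : ∀ os → older (dC ps) os ≤ℚ M
      older≤M [] = M≥0
      older≤M (y ∷ []) = ℚₚ.≤-reflexive (ℚₚ.+-identityʳ M)
      older≤M (y ∷ os@(z ∷ _)) = ℚₚ.≤-trans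
        (ℚₚ.≤-trans (near≤ M (dC ps) y os (here refl)) (path0 (connected y z)) ⊕ older≤M os) (ℚₚ.≤-reflexive (ℚₚ.+-identityˡ M))

-- The sweep: the potential pays for the non-tree edges.

∑-filter-cover : ∀ {A : Set} {P Q R : A → Set} (P? : Decidable P) (Q? : Decidable Q) (R? : Decidable R) xs {f : A → ℚ} →
  (∀ {x} → x ∈ xs → 0ℚ ≤ℚ f x) → (∀ {x} → P x → Q x ⊎ R x) →
  ∑ (filter P? xs) f ≤ℚ ∑ (filter Q? xs) f + ∑ (filter R? xs) f
∑-filter-cover P? Q? R? [] nn cov = ℚₚ.≤-refl
∑-filter-cover P? Q? R? (x ∷ xs) {f} nn cov
  with P? x | Q? x | R? x | ∑-filter-cover P? Q? R? xs {f} (nn ∘ there) cov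
... | no _ | no _ | no _ | h = h
... | no _ | no _ | yes _ | h = lin (h ⊕ nn (here refl)) (identity (f x) (∑ (filter P? xs) f) (∑ (filter Q? xs) f) (∑ (filter R? xs) f))
  where
  identity : ∀ a p q r → q + (a + r) + (p + 0ℚ) ≡ p + (q + r + a)
  identity = solve-∀ ℚ-ring
... | no _ | yes _ | no _ | h = lin (h ⊕ nn (here refl)) (identity (f x) (∑ (filter P? xs) f) (∑ (filter Q? xs) f) (∑ (filter R? xs) f))
  where
  identity : ∀ a p q r → a + q + r + (p + 0ℚ) ≡ p + (q + r + a)
  identity = solve-∀ ℚ-ring
... | no _ | yes _ | yes _ | h = lin (h ⊕ nn (here refl) ⊕ nn (here refl)) (identity (f x) (∑ (filter P? xs) f) (∑ (filter Q? xs) f) (∑ (filter R? xs) f))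
  where
  identity : ∀ a p q r → a + q + (a + r) + (p + 0ℚ + 0ℚ) ≡ p + (q + r + a + a)
  identity = solve-∀ ℚ-ring
... | yes px | no ¬q | no ¬r | h = ⊥-elim ([ ¬q , ¬r ]′ (cov px))
... | yes _ | no _ | yes _ | h = lin h (identity (f x) (∑ (filter P? xs) f) (∑ (filter Q? xs) f) (∑ (filter R? xs) f))
  where
  identity : ∀ a p q r → q + (a + r) + p ≡ a + p + (q + r)
  identity = solve-∀ ℚ-ring
... | yes _ | yes _ | no _ | h = lin h (identity (f x) (∑ (filter P? xs) f) (∑ (filter Q? xs) f) (∑ (filter R? xs) f))
  where
  identity : ∀ a p q r → a + q + r + p ≡ a + p + (q + r)
  identity = solve-∀ ℚ-ring
... | yes _ | yes _ | yes _ | h = lin (h ⊕ nn (here refl)) (identity (f x) (∑ (filter P? xs) f) (∑ (filter Q? xs) f) (∑ (filter R? xs) f))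
  where
  identity : ∀ a p q r → a + q + (a + r) + (p + 0ℚ) ≡ a + p + (q + r + a)
  identity = solve-∀ ℚ-ring

module Lightness {n : ℕ} {A : Adj n} (A-sym : ∀ u v → A u v ≡ A v u)
  {w : Fin n → Fin n → ℚ} (w≥0 : ∀ u v → 0ℚ ≤ℚ w u v)
  {M : ℚ} (M≥0 : 0ℚ ≤ℚ M) {Tl L : List (Fin n × Fin n)}
  (Tl⊆A : ∀ {u v} → (u , v) ∈ Tl → Edge A u v) (L⊆A : ∀ {u v} → (u , v) ∈ L → Edge A u v)
  (connected : ∀ x y → Star (λ u v → (u , v) ∈ Tl ⊎ (v , u) ∈ Tl) x y)
  (L-unique : Unique L)
  {q : ℕ} {κ K : ℚ} (κ≥0 : 0ℚ ≤ℚ κ) (K>0 : 0ℚ <ℚ K)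
  (K-large : fromℕ (suc q) * (1ℚ + (κ + κ + κ + κ + κ)) ≤ℚ K * κ)
  (gap : ∀ {u v} → (u , v) ∈ L → ∀ S → S ⊆ L → (u , v) ∉ S →
    (1ℚ + (κ + κ + κ + κ + κ)) * w u v ≤ℚ metricOf M (weigh w (S ++ Tl)) u v)
  where

  open Introduction A-sym w≥0 M≥0 Tl Tl⊆A

  private
    K≥0 : 0ℚ ≤ℚ K
    K≥0 = ℚₚ.<⇒≤ K>0

    E : Set
    E = Fin n × Fin n

    wt : E → ℚ
    wt e = w (proj₁ e) (proj₂ e)

  open Potential K≥0 dT-metric

  D : List E → Fin n → Fin n → ℚ
  D S = metricOf M (weigh w (S ++ Tl))

  D-metric : ∀ S → IsMetric (D S)
  D-metric S = metricOf-metric M≥0 (weigh-nonneg w≥0 (S ++ Tl))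

  D≤dT : ∀ S x y → D S x y ≤ℚ dT x y
  D≤dT S = metricOf-anti M≥0 (weigh-nonneg w≥0 (S ++ Tl)) sub
    where
    sub : weigh w Tl ⊆ weigh w (S ++ Tl)
    sub p with weigh-∈ {ω = w} Tl p
    ... | (u , v) , e , refl = ∈-map⁺ _ (∈-++⁺ʳ S e)

  -- Quantifying over all separated radii takes the place of the maximum in the potential.
  Inv : List (Fin n) → List E → ℚ → Set
  Inv B S budget = ∀ {r} → Separated B r → value (D S) B r + κ * ∑ S wt ≤ℚ budget

  -- Edges are inserted one at a time; by `discount` the value falls by at least the amount by which
  -- the weight term grows, possibly at the price of changing the radii, over which `Inv`
  -- quantifies.
  Inv-edges : ∀ {B budget} → length B ≤ suc q → ∀ F S →
    (∀ {u v} → (u , v) ∈ F → u ∈ B × v ∈ B × (u , v) ∈ L) → Unique F → (∀ {e} → e ∈ F → e ∉ S) → S ⊆ L →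
    Inv B S budget → Inv B (F ++ S) budget
  Inv-edges len≤ [] S inB uF disj S⊆L inv = inv
  Inv-edges {B} {budget} len≤ ((u , v) ∷ F) S inB (e∉F ∷ uF) disj S⊆L inv {r} sep =
    lin (proj₂ (proj₂ raised) ⊕ Inv-edges len≤ F S (inB ∘ there) uF (disj ∘ there) S⊆L inv (proj₁ (proj₂ raised)))
      (identity (value (D ((u , v) ∷ F ++ S)) B r) (value (D (F ++ S)) B (proj₁ raised)) κ (w u v) (∑ (F ++ S) wt) budget)
    where
    S′ : List E
    S′ = F ++ S
    S′⊆L : S′ ⊆ L
    S′⊆L p with ∈-++⁻ F p
    ... | inj₁ q = proj₂ (proj₂ (inB (there q)))
    ... | inj₂ q = S⊆L q
    e∉S′ : (u , v) ∉ S′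
    e∉S′ p with ∈-++⁻ F p
    ... | inj₁ q = All.lookup e∉F q refl
    ... | inj₂ q = disj (here refl) q
    gap′ : (1ℚ + (κ + κ + κ + κ + κ)) * w u v ≤ℚ D S′ u v
    gap′ = gap (proj₂ (proj₂ (inB (here refl)))) S′ S′⊆L e∉S′
    W≡ : ∀ k t → (1ℚ + (k + k + k + k + k)) * t ≡ t + (k * t + k * t + k * t + k * t + k * t)
    W≡ = solve-∀ ℚ-ring
    -- The premise of `discount` for W = (1 + 5κ) w(e) and h = κ w(e); `K-large` is chosen for it.
    small : fromℕ (length B) * ((1ℚ + (κ + κ + κ + κ + κ)) * w u v) ≤ℚ K * (κ * w u v)
    small = ℚₚ.≤-trans
      (ℚₚ.*-monoʳ-≤-nonNeg ((1ℚ + (κ + κ + κ + κ + κ)) * w u v) ⦃ ℚ.nonNegative (*-nonneg factor≥0 (w≥0 u v)) ⦄ (fromℕ-mono len≤))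
      (subst₂ _≤ℚ_ (comm (w u v) (fromℕ (suc q)) (1ℚ + (κ + κ + κ + κ + κ))) (comm (w u v) K κ) (*-mono-nonneg (w≥0 u v) K-large))
      where
      factor≥0 : 0ℚ ≤ℚ 1ℚ + (κ + κ + κ + κ + κ)
      factor≥0 = +-nonneg (fromℕ-nonneg 1) (+-nonneg (+-nonneg (+-nonneg (+-nonneg κ≥0 κ≥0) κ≥0) κ≥0) κ≥0)
      comm : ∀ t a b → t * (a * b) ≡ a * (b * t)
      comm = solve-∀ ℚ-ring
    raised : ∃ λ r⁺ → Separated B r⁺ × value (D ((u , v) ∷ S′)) B r + κ * w u v ≤ℚ value (D S′) B r⁺
    raised = discount (D-metric S′) K>0 (D≤dT S′) (proj₁ (inB (here refl))) (proj₁ (proj₂ (inB (here refl))))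
      (w≥0 u v) (*-nonneg κ≥0 (w≥0 u v)) (W≡ κ (w u v)) gap′ small sep
    identity : ∀ a b k t s c → c + (a + k * t + (b + k * s)) ≡ a + k * (t + s) + (b + c)
    identity = solve-∀ ℚ-ring

  Inv-forget : ∀ {P : Fin n → Set} (P? : Decidable P) {B S budget} → Inv B S budget → Inv (filter P? B) S budget
  Inv-forget P? {B} {S} {budget} inv {r} sep =
    ℚₚ.≤-trans (proj₂ (proj₂ extended) ⊕ ℚₚ.≤-refl {κ * ∑ S wt}) (inv (proj₁ (proj₂ extended)))
    where
    extended : ∃ λ r′ → Separated B r′ × value (D S) (filter P? B) r ≤ℚ value (D S) B r′
    extended = forget (D-metric S) P? B sep

  -- At most q² pairs lose up to 2K + 1 times the distance of the new vertex each, by `introduce`.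
  rate : ℚ
  rate = fromℕ q * (fromℕ q * (K + K + 1ℚ))

  Inv-introduce : ∀ {x y B S budget a} → length B ≤ q → y ∈ B → x ∉ B → dT x y ≤ℚ a →
    Inv B S budget → Inv (x ∷ B) S (budget + rate * a)
  Inv-introduce {x} {y} {B} {S} {budget} {a} len≤ y∈B x∉B near≤a inv {r} sep =
    lin (proj₂ (proj₂ moved) ⊕ inv (proj₁ (proj₂ moved)) ⊕ loss)
      (identity (value (D S) (x ∷ B) r) (value (D S) B (proj₁ moved)) (κ * ∑ S wt) budget (rate * a) (fromℕ (length B) * (fromℕ (length B) * E′)))
    where
    E′ : ℚ
    E′ = K * dT x y + K * dT x y + dT x y
    moved : ∃ λ r′ → Separated B r′ × value (D S) (x ∷ B) r ≤ℚ value (D S) B r′ + fromℕ (length B) * (fromℕ (length B) * E′)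
    moved = introduce K≥0 dT-metric (D-metric S) (D≤dT S) y∈B x∉B sep
    E≤ : E′ ≤ℚ (K + K + 1ℚ) * a
    E≤ = ℚₚ.≤-trans (ℚₚ.≤-reflexive (factor K (dT x y)))
      (*-mono-nonneg (+-nonneg (+-nonneg K≥0 K≥0) (fromℕ-nonneg 1)) near≤a)
      where
      factor : ∀ k t → k * t + k * t + t ≡ (k + k + 1ℚ) * t
      factor = solve-∀ ℚ-ring
    E≥0 : 0ℚ ≤ℚ E′
    E≥0 = +-nonneg (+-nonneg (KdT≥0 x y) (KdT≥0 x y)) (IsMetric.nonneg dT-metric x y)
    scale : ∀ {s t} → 0ℚ ≤ℚ s → s ≤ℚ t → fromℕ (length B) * s ≤ℚ fromℕ q * t
    scale {s} s≥0 s≤t = ℚₚ.≤-trans (ℚₚ.*-monoʳ-≤-nonNeg s ⦃ ℚ.nonNegative s≥0 ⦄ (fromℕ-mono len≤))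
      (*-mono-nonneg (fromℕ-nonneg q) s≤t)
    loss : fromℕ (length B) * (fromℕ (length B) * E′) ≤ℚ rate * a
    loss = ℚₚ.≤-trans (scale (*-nonneg (fromℕ-nonneg (length B)) E≥0) (scale E≥0 E≤))
      (ℚₚ.≤-reflexive (assoc (fromℕ q) (K + K + 1ℚ) a))
      where
      assoc : ∀ a b c → a * (a * (b * c)) ≡ a * (a * b) * c
      assoc = solve-∀ ℚ-ring
    identity : ∀ a b c d e f → d + e + (a + (b + c) + f) ≡ a + c + (b + f + d + e)
    identity = solve-∀ ℚ-ring

  Inside : List (Fin n) → E → Set
  Inside ps e = proj₁ e ∈ ps × proj₂ e ∈ ps

  insideE? : ∀ ps → Decidable (Inside ps)
  insideE? ps e = inside? ps (proj₁ e) (proj₂ e)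

  newE? : ∀ x ps → Decidable (λ e → Inside (x ∷ ps) e × ¬ Inside ps e)
  newE? x ps e = insideE? (x ∷ ps) e ×-dec ¬? (insideE? ps e)

  -- The edges of `L` between swept vertices, arranged by the time of their insertion so that
  -- `Inv-edges` applies.
  seen : List (Fin n) → List E
  seen [] = []
  seen (x ∷ ps) = filter (newE? x ps) L ++ seen ps

  seen⁻ : ∀ ps {e} → e ∈ seen ps → e ∈ L × Inside ps e
  seen⁻ (x ∷ ps) p with ∈-++⁻ (filter (newE? x ps) L) p
  ... | inj₁ q with ∈-filter⁻ (newE? x ps) {xs = L} q
  ...   | e∈L , ins , _ = e∈L , ins
  seen⁻ (x ∷ ps) p | inj₂ q with seen⁻ ps q
  ...   | e∈L , i , j = e∈L , there i , there j

  wt≥0 : ∀ {e} → 0ℚ ≤ℚ wt e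
  wt≥0 {u , v} = w≥0 u v

  seen-weight : ∀ ps → ∑ (filter (insideE? ps) L) wt ≤ℚ ∑ (seen ps) wt
  seen-weight [] = ℚₚ.≤-reflexive (cong (λ F → ∑ F wt) (Listₚ.filter-none (insideE? []) (All.universal (λ _ → λ ()) L)))
  seen-weight (x ∷ ps) = ℚₚ.≤-trans
    (∑-filter-cover (insideE? (x ∷ ps)) (newE? x ps) (insideE? ps) L (λ _ → wt≥0) cover)
    (ℚₚ.≤-trans (ℚₚ.≤-refl {∑ (filter (newE? x ps) L) wt} ⊕ seen-weight ps)
      (ℚₚ.≤-reflexive (sym (∑-++ (filter (newE? x ps) L) (seen ps) wt))))
    where
    cover : ∀ {e} → Inside (x ∷ ps) e → (Inside (x ∷ ps) e × ¬ Inside ps e) ⊎ Inside ps e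
    cover {e} i with insideE? ps e
    ... | yes j = inj₂ j
    ... | no ¬j = inj₁ (i , ¬j)

  -- A newly completed edge joins x to itself or to a swept vertex, and the latter is on the
  -- boundary because x was outside. All new edges therefore lie in `x ∷ bag A ps`; they are
  -- inserted before vertices are forgotten.
  Inv-new : ∀ {x ps budget} → x ∉ ps → length (bag A ps) ≤ q → Inv (x ∷ bag A ps) (seen ps) budget →
    Inv (bag A (x ∷ ps)) (seen (x ∷ ps)) budget
  Inv-new {x} {ps} x∉ len≤ inv = Inv-forget (exits? A (x ∷ ps)) {x ∷ bag A ps} {seen (x ∷ ps)}
    (Inv-edges (s≤s len≤) (filter (newE? x ps) L) (seen ps) inB (Uniqueₚ.filter⁺ (newE? x ps) L-unique)
      (λ p q → proj₂ (proj₂ (∈-filter⁻ (newE? x ps) {xs = L} p)) (proj₂ (seen⁻ ps q)))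
      (proj₁ ∘ seen⁻ ps) inv)
    where
    inB : ∀ {u v} → (u , v) ∈ filter (newE? x ps) L → u ∈ x ∷ bag A ps × v ∈ x ∷ bag A ps × (u , v) ∈ L
    inB {u} {v} p with ∈-filter⁻ (newE? x ps) {xs = L} p
    ... | e∈L , (here refl , here refl) , _ = here refl , here refl , e∈L
    ... | e∈L , (here refl , there v∈) , _ =
      here refl , there (bag⁺ A ps v∈ (u , x∉ , trans (A-sym v u) (L⊆A e∈L))) , e∈L
    ... | e∈L , (there u∈ , here refl) , _ = there (bag⁺ A ps u∈ (v , x∉ , L⊆A e∈L)) , here refl , e∈L
    ... | e∈L , (there u∈ , there v∈) , ¬i = ⊥-elim (¬i (u∈ , v∈))

  -- The first vertex has potential 0, so the `M` charged for it in `cost` is taken off. Every later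
  -- vertex is introduced next to its nearest boundary vertex; one exists because `Tl` is connected.
  invariant : ∀ {x ps} → Order A q (x ∷ ps) → Inv (bag A (x ∷ ps)) (seen (x ∷ ps)) (rate * (cost (x ∷ ps) - M))
  invariant {x} {[]} (step x∉ len≤ []) = Inv-new {x} {[]} x∉ len≤ start
    where
    start : Inv (x ∷ []) [] (rate * (M + 0ℚ - M))
    start {r} sep = ℚₚ.≤-trans
      (lin (ℚₚ.≤-trans (⊓≤₁ (D [] x x) (r x ⊓ r x)) (ℚₚ.≤-reflexive (IsMetric.self (D-metric []) x)))
        (identity (term (D []) r x x) κ))
      (ℚₚ.≤-reflexive (zero-budget rate M))
      where
      identity : ∀ t k → 0ℚ + t ≡ t + 0ℚ + 0ℚ + k * 0ℚ + 0ℚ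
      identity = solve-∀ ℚ-ring
      zero-budget : ∀ r m → 0ℚ ≡ r * (m + 0ℚ - m)
      zero-budget = solve-∀ ℚ-ring
  invariant {x} {ps@(y ∷ _)} (step x∉ len≤ ord) = Inv-new x∉ len≤
    (subst (Inv (x ∷ bag A ps) (seen ps)) (split rate (near M dT x (bag A ps)) (cost ps) M)
      (Inv-introduce {S = seen ps} len≤ (proj₁ (proj₂ nearest)) (x∉ ∘ proj₁ ∘ bag⁻ A ps) (proj₂ (proj₂ nearest)) (invariant ord)))
    where
    nearest : ∃ λ z → z ∈ bag A ps × dT x z ≤ℚ near M dT x (bag A ps)
    nearest = near-attained M dT (metricOf≤M M≥0 (weigh w Tl)) x (bag A ps)
      (proj₁ (proj₂ (exit ps (connected y x) (here refl) x∉)))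
    split : ∀ r a c m → r * (c - m) + r * a ≡ r * (a + c - m)
    split = solve-∀ ℚ-ring

  -- Apply the invariant to radii 0 at the end of the sweep: the value is nonnegative and every edge
  -- of `L` has been seen.
  light : ∀ {ps} → Order A q ps → (∀ x → x ∈ ps) → κ * ∑ L wt ≤ℚ rate * (fromℕ (suc q) * ∑ Tl wt)
  light {[]} ord all = subst (κ * ∑ L wt ≤ℚ_) refl (ℚₚ.≤-trans (ℚₚ.≤-reflexive (trans (cong (κ *_) (empty L)) (ℚₚ.*-zeroʳ κ)))
    (*-nonneg rate≥0 (*-nonneg (fromℕ-nonneg (suc q)) (∑-nonneg Tl (λ {e} _ → wt≥0 {e})))))
    where
    empty : ∀ F → ∑ F wt ≡ 0ℚ
    empty [] = refl
    empty ((u , v) ∷ F) with all u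
    ... | ()
    rate≥0 : 0ℚ ≤ℚ rate
    rate≥0 = *-nonneg (fromℕ-nonneg q) (*-nonneg (fromℕ-nonneg q) (+-nonneg (+-nonneg K≥0 K≥0) (fromℕ-nonneg 1)))
  light {x ∷ ps} ord all = ℚₚ.≤-trans (*-mono-nonneg κ≥0 L≤seen)
    (ℚₚ.≤-trans (subst (_≤ℚ value (D S) B zeroᵣ + κ * ∑ S wt) (ℚₚ.+-identityˡ (κ * ∑ S wt))
        (value-nonneg (D-metric S) B (λ _ → ℚₚ.≤-refl) ⊕ ℚₚ.≤-refl {κ * ∑ S wt}))
      (ℚₚ.≤-trans (invariant ord zero-separated) (*-mono-nonneg rate≥0 cost≤)))
    where
    S : List E
    S = seen (x ∷ ps)
    B : List (Fin n)
    B = bag A (x ∷ ps)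
    zeroᵣ : Fin n → ℚ
    zeroᵣ _ = 0ℚ
    zero-separated : Separated B zeroᵣ
    zero-separated = record { nonneg = λ _ → ℚₚ.≤-refl ; apart = λ {a} {b} _ _ _ → KdT≥0 a b }
    L≤seen : ∑ L wt ≤ℚ ∑ S wt
    L≤seen = subst (λ F → ∑ F wt ≤ℚ ∑ S wt)
      (Listₚ.filter-all (insideE? (x ∷ ps)) (All.universal (λ e → all (proj₁ e) , all (proj₂ e)) L))
      (seen-weight (x ∷ ps))
    rate≥0 : 0ℚ ≤ℚ rate
    rate≥0 = *-nonneg (fromℕ-nonneg q) (*-nonneg (fromℕ-nonneg q) (+-nonneg (+-nonneg K≥0 K≥0) (fromℕ-nonneg 1)))
    cost≤ : cost (x ∷ ps) - M ≤ℚ fromℕ (suc q) * ∑ Tl wt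
    cost≤ = lin (cost-bound connected ord all) (identity (cost (x ∷ ps)) M (fromℕ (suc q) * ∑ Tl wt))
      where
      identity : ∀ c m t → t + c ≡ c - m + (t + m)
      identity = solve-∀ ℚ-ring

-- Narrow vertex orders from caterpillar decompositions.

elements : ∀ {n} → Subset n → List (Fin n)
elements Vec.[] = []
elements (true Vec.∷ s) = Fin.zero ∷ map Fin.suc (elements s)
elements (false Vec.∷ s) = map Fin.suc (elements s)

length-elements : ∀ {n} (s : Subset n) → length (elements s) ≡ ∣ s ∣
length-elements Vec.[] = refl
length-elements (true Vec.∷ s) = cong suc (trans (Listₚ.length-map Fin.suc (elements s)) (length-elements s))
length-elements (false Vec.∷ s) = trans (Listₚ.length-map Fin.suc (elements s)) (length-elements s)

∈-elements : ∀ {n} {s : Subset n} {v} → v ∈ˢ s → v ∈ elements s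
∈-elements {s = true Vec.∷ s} Vec.here = here refl
∈-elements {s = true Vec.∷ s} (Vec.there p) = there (∈-map⁺ Fin.suc (∈-elements p))
∈-elements {s = false Vec.∷ s} (Vec.there p) = ∈-map⁺ Fin.suc (∈-elements p)

argmin : ∀ {A : Set} (f : A → ℕ) xs {x} → x ∈ xs → ∃ λ y → y ∈ xs × (∀ {z} → z ∈ xs → f y ≤ f z)
argmin f (x ∷ []) _ = x , here refl , λ { (here refl) → ℕₚ.≤-refl }
argmin f (x ∷ x′ ∷ xs) _ with argmin f (x′ ∷ xs) (here refl)
... | y , y∈ , least with ℕₚ.≤-total (f x) (f y)
...   | inj₁ h = x , here refl , λ { (here refl) → ℕₚ.≤-refl ; (there p) → ℕₚ.≤-trans h (least p) }
...   | inj₂ h = y , there y∈ , λ { (here refl) → h ; (there p) → least p }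

Linked-close : ∀ {A : Set} {R : A → A → Set} xs {b s zs} → Linked R (xs ++ b ∷ zs) → R b s → Linked R (xs ++ b ∷ s ∷ [])
Linked-close [] _ r = r ∷ [-]
Linked-close (x ∷ []) (h ∷ l) r = h ∷ Linked-close [] l r
Linked-close (x ∷ x′ ∷ xs) (h ∷ l) r = h ∷ Linked-close (x′ ∷ xs) l r

Unique-prefix : ∀ {A : Set} (xs : List A) {ys} → Unique (xs ++ ys) → Unique xs
Unique-prefix [] _ = []
Unique-prefix (x ∷ xs) (h ∷ u) = Allₚ.++⁻ˡ xs h ∷ Unique-prefix xs u

module _ {m : ℕ} where

  idx : List (Fin m) → Fin m → ℕ
  idx [] a = 0
  idx (s ∷ ss) a with a ≟ s
  ... | yes _ = 0
  ... | no _ = suc (idx ss a)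

  idx-injective : ∀ ss {a b} → a ∈ ss → b ∈ ss → idx ss a ≡ idx ss b → a ≡ b
  idx-injective (s ∷ ss) {a} {b} a∈ b∈ eq with a ≟ s | b ≟ s
  ... | yes p | yes q = trans p (sym q)
  ... | no p | no q = idx-injective ss (tail p a∈) (tail q b∈) (ℕₚ.suc-injective eq)
    where
    tail : ∀ {c} → c ≢ s → c ∈ s ∷ ss → c ∈ ss
    tail ne (here e) = ⊥-elim (ne e)
    tail ne (there p) = p

  -- An edge between non-consecutive vertices of the spine would close a cycle.
  chordless : ∀ {A : Adj m} → (∀ u v → A u v ≡ A v u) → Acyclic A → ∀ ss → Linked (Edge A) ss → Unique ss →
    ∀ {a b} → a ∈ ss → b ∈ ss → Edge A a b → idx ss b ≤ suc (idx ss a)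
  chordless {A} A-sym acyclic (s ∷ ss) l (s∉ ∷ u) {a} {b} a∈ b∈ e with b ≟ s | a ≟ s
  ... | yes _ | _ = z≤n
  chordless {A} A-sym acyclic (s ∷ ss) l (s∉ ∷ u) {a} {b} a∈ (here p) e | no q | _ = ⊥-elim (q p)
  chordless {A} A-sym acyclic (s ∷ ss) l (s∉ ∷ u) {a} {b} (here p) (there b∈) e | no _ | no q = ⊥-elim (q p)
  chordless {A} A-sym acyclic (s ∷ ss) l (s∉ ∷ u) {a} {b} (there a∈) (there b∈) e | no _ | no q =
    s≤s (chordless A-sym acyclic ss (tail ss l) u a∈ b∈ e)
    where
    tail : ∀ ss → Linked (Edge A) (s ∷ ss) → Linked (Edge A) ss
    tail [] l = []
    tail (x ∷ ss) (_ ∷ l) = l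
  chordless {A} A-sym acyclic (s ∷ ss) l (s∉ ∷ u) {a} {b} a∈ (there b∈) e | no b≢s | yes refl with ∈-∃++ b∈
  ... | [] , zs , refl = s≤s (ℕₚ.≤-reflexive first)
    where
    first : idx (b ∷ zs) b ≡ 0
    first with b ≟ b
    ... | yes _ = refl
    ... | no ne = ⊥-elim (ne refl)
  ... | y ∷ ys , zs , refl = ⊥-elim (acyclic (a , (y ∷ ys) ++ [ b ] , long , distinct , closed))
    where
    long : 2 ≤ length ((y ∷ ys) ++ [ b ])
    long = s≤s (subst (1 ≤_) (sym (Listₚ.length-++ ys)) (ℕₚ.m≤n+m 1 (length ys)))
    distinct : Unique (a ∷ (y ∷ ys) ++ [ b ])
    distinct = Unique-prefix (a ∷ (y ∷ ys) ++ [ b ])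
      (subst (λ xs → Unique (a ∷ xs)) (sym (Listₚ.++-assoc (y ∷ ys) [ b ] zs)) (s∉ ∷ u))
    closed : Linked (Edge A) (a ∷ ((y ∷ ys) ++ [ b ]) ++ [ a ])
    closed = subst (λ xs → Linked (Edge A) (a ∷ xs)) (sym (Listₚ.++-assoc (y ∷ ys) [ b ] [ a ]))
      (Linked-close (a ∷ y ∷ ys) l (trans (A-sym b a) e))

bag-unique : ∀ {n} (A : Adj n) ps → Unique ps → Unique (bag A ps)
bag-unique A [] u = []
bag-unique A (x ∷ ps) (x∉ ∷ u) = Uniqueₚ.filter⁺ (exits? A (x ∷ ps))
  (Allₚ.¬Any⇒All¬ (bag A ps) (λ p → All.lookup x∉ (proj₁ (bag⁻ A ps p)) refl) ∷ bag-unique A ps u)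

module _ {n : ℕ} {G : Adj n} {k : ℕ} (cd : CaterpillarDecomposition G k) where

  open CaterpillarDecomposition cd renaming (bag to node)
  open import Data.List.Membership.DecPropositional (_≟_ {m}) using (_∈?_)

  private
    tree-sym : ∀ i j → tree i j ≡ tree j i
    tree-sym = proj₁ (proj₁ (proj₁ caterpillar))

    spine : List (Fin m)
    spine = proj₁ (proj₂ caterpillar)

    -- A spine node is its own anchor, a leaf off the spine is anchored at its only neighbour.
    anchored : ∀ i → ∃ λ j → j ∈ spine × (i ∈ spine → j ≡ i) × (i ∉ spine → ∀ j′ → Edge tree i j′ → j′ ≡ j)
    anchored i with i ∈? spine
    ... | yes i∈ = i , i∈ , (λ _ → refl) , λ i∉ → ⊥-elim (i∉ i∈)
    ... | no i∉ with proj₂ (proj₂ (proj₂ (proj₂ caterpillar))) i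
    ...   | inj₁ i∈ = ⊥-elim (i∉ i∈)
    ...   | inj₂ (j , j∈ , _ , only) = j , j∈ , (λ i∈ → ⊥-elim (i∉ i∈)) , λ _ → only

    anchor : Fin m → Fin m
    anchor i = proj₁ (anchored i)

    anchor∈ : ∀ i → anchor i ∈ spine
    anchor∈ i = proj₁ (proj₂ (anchored i))

    anchor-spine : ∀ {i} → i ∈ spine → anchor i ≡ i
    anchor-spine {i} = proj₁ (proj₂ (proj₂ (anchored i)))

    anchor-leaf : ∀ {i j} → i ∉ spine → Edge tree i j → j ≡ anchor i
    anchor-leaf {i} {j} i∉ = proj₂ (proj₂ (proj₂ (anchored i))) i∉ j

    level : Fin m → ℕ
    level i = idx spine (anchor i)

    level-anchor : ∀ i → level (anchor i) ≡ level i
    level-anchor i = cong (idx spine) (anchor-spine (anchor∈ i))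

    same-level : ∀ {i j} → level i ≡ level j → anchor i ≡ anchor j
    same-level {i} {j} = idx-injective spine (anchor∈ i) (anchor∈ j)

    -- A leaf shares the level of its anchor, and edges between spine nodes do not skip levels by
    -- `chordless`.
    level-step : ∀ {i j} → Edge tree i j → level j ≤ suc (level i)
    level-step {i} {j} e = go (i ∈? spine) (j ∈? spine)
      where
      go : Dec (i ∈ spine) → Dec (j ∈ spine) → level j ≤ suc (level i)
      go (no i∉) _ = ℕₚ.m≤n⇒m≤1+n (ℕₚ.≤-reflexive (trans (cong level (anchor-leaf i∉ e)) (level-anchor i)))
      go (yes _) (no j∉) = ℕₚ.m≤n⇒m≤1+n (ℕₚ.≤-reflexive
        (sym (trans (cong level (anchor-leaf j∉ (trans (tree-sym j i) e))) (level-anchor j))))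
      go (yes i∈) (yes j∈) =
        subst₂ (λ a b → idx spine a ≤ suc (idx spine b)) (sym (anchor-spine j∈)) (sym (anchor-spine i∈))
          (chordless tree-sym (proj₂ (proj₂ (proj₁ caterpillar))) spine (proj₁ (proj₂ (proj₂ caterpillar)))
            (proj₁ (proj₂ (proj₂ (proj₂ caterpillar)))) i∈ j∈ e)

    -- Levels rise by at most one per step, so the walk visits the level of c. If it starts there at
    -- a leaf, its next node is the anchor; it cannot climb to a leaf of that level, because the
    -- only neighbour of the leaf has the same level. The trivial walk at a leaf is the exception.
    passes : ∀ {v} c {a b} (p : Walk tree a b) → All (λ x → v ∈ˢ node x) (verts p) →
      level a ≤ level c → level c ≤ level b → a ≡ b ⊎ v ∈ˢ node (anchor c)
    passes c [] _ _ _ = inj₁ refl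
    passes {v} c {a} (_∷_ {v = a′} e p) (v∈a ∷ v∈p) lo hi with level a ℕₚ.≟ level c
    ... | yes eq = inj₂ (hit (a ∈? spine))
      where
      head∈ : ∀ {i j} (p : Walk tree i j) → All (λ x → v ∈ˢ node x) (verts p) → v ∈ˢ node i
      head∈ [] (h ∷ _) = h
      head∈ (_ ∷ _) (h ∷ _) = h
      hit : Dec (a ∈ spine) → v ∈ˢ node (anchor c)
      hit (yes a∈) = subst (λ i → v ∈ˢ node i) (trans (sym (anchor-spine a∈)) (same-level eq)) v∈a
      hit (no a∉) = subst (λ i → v ∈ˢ node i) (trans (anchor-leaf a∉ e) (same-level eq)) (head∈ p v∈p)
    ... | no ne with passes c p v∈p (ℕₚ.≤-trans (level-step e) (ℕₚ.≤∧≢⇒< lo ne)) hi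
    ...   | inj₂ h = inj₂ h
    ...   | inj₁ refl = inj₂ (arrive (a′ ∈? spine))
      where
      last∈ : ∀ {i} (p : Walk tree i a′) → All (λ x → v ∈ˢ node x) (verts p) → v ∈ˢ node i
      last∈ [] (h ∷ _) = h
      last∈ (_ ∷ _) (h ∷ _) = h
      level≡ : level a′ ≡ level c
      level≡ = ℕₚ.≤-antisym (ℕₚ.≤-trans (level-step e) (ℕₚ.≤∧≢⇒< lo ne)) hi
      arrive : Dec (a′ ∈ spine) → v ∈ˢ node (anchor c)
      arrive (yes a′∈) = subst (λ i → v ∈ˢ node i) (trans (sym (anchor-spine a′∈)) (same-level level≡)) (last∈ p v∈p)
      arrive (no a′∉) = ⊥-elim (ne (trans (trans (cong level (anchor-leaf a′∉ (trans (tree-sym a′ a) e))) (level-anchor a′)) level≡))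

    -- Lexicographic code: by level first, then by number, which is below m.
    pos : Fin m → ℕ
    pos i = level i ℕ.* m ℕ.+ toℕ i

    pos-level : ∀ {i j} → pos i ≤ pos j → level i ≤ level j
    pos-level {i} {j} h = ℕₚ.≮⇒≥ λ lt → ℕₚ.<-irrefl refl (begin-strict
      pos j                          <⟨ ℕₚ.+-monoʳ-< (level j ℕ.* m) (Finₚ.toℕ<n j) ⟩
      level j ℕ.* m ℕ.+ m            ≡⟨ ℕₚ.+-comm (level j ℕ.* m) m ⟩
      suc (level j) ℕ.* m            ≤⟨ ℕₚ.*-monoˡ-≤ m lt ⟩
      level i ℕ.* m                  ≤⟨ ℕₚ.m≤m+n (level i ℕ.* m) (toℕ i) ⟩
      pos i                          ≤⟨ h ⟩
      pos j                          ∎)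
      where open ℕₚ.≤-Reasoning

    pos-injective : ∀ {i j} → pos i ≡ pos j → i ≡ j
    pos-injective {i} {j} eq = Finₚ.toℕ-injective (ℕₚ.+-cancelˡ-≡ (level i ℕ.* m) (toℕ i) (toℕ j)
      (trans eq (cong (λ l → l ℕ.* m ℕ.+ toℕ j) (sym level≡))))
      where
      level≡ : level i ≡ level j
      level≡ = ℕₚ.≤-antisym (pos-level (ℕₚ.≤-reflexive eq)) (pos-level (ℕₚ.≤-reflexive (sym eq)))

    leftmost : ∀ v → ∃ λ i → v ∈ˢ node i × (∀ {j} → v ∈ˢ node j → pos i ≤ pos j)
    leftmost v with argmin pos (filter (λ i → v ∈ˢ? node i) (allFin m))
      (∈-filter⁺ (λ i → v ∈ˢ? node i) (∈-allFin (proj₁ (cover v))) (proj₂ (cover v)))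
    ... | i , i∈ , least = i , proj₂ (∈-filter⁻ (λ i → v ∈ˢ? node i) {xs = allFin m} i∈) ,
      λ v∈j → least (∈-filter⁺ (λ i → v ∈ˢ? node i) (∈-allFin _) v∈j)

    home : Fin n → Fin m
    home v = proj₁ (leftmost v)

    key : Fin n → ℕ
    key v = pos (home v)

    -- Decreasing keys, because the head of an `Order` is its latest vertex.
    descending : DecTotalOrder 0ℓ 0ℓ 0ℓ
    descending = Flip.decTotalOrder (On.decTotalOrder ℕₚ.≤-decTotalOrder key)

    module S = Sort descending

    order : List (Fin n)
    order = S.sort (allFin n)

    order-unique : Unique order
    order-unique = PermSetoidₚ.Unique-resp-↭ (setoid (Fin n)) (Perm.↭⇒↭ₛ (Perm.↭-sym (S.sort-↭ (allFin n)))) (Uniqueₚ.allFin⁺ n)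

    order-sorted : AllPairs (λ u v → key v ≤ key u) order
    order-sorted = Linkedₚ.Linked⇒AllPairs (λ p q → ℕₚ.≤-trans q p) (S.sort-↗ (allFin n))

    -- Let c be the leftmost node of x. A boundary vertex y has its leftmost node no later than c,
    -- and shares a node no earlier than c with a neighbour outside. By `passes` it lies in the bag
    -- of the anchor of c, unless both nodes coincide, and then they are c. Two bags thus cover the
    -- boundary.
    boundary-small : ∀ {x ps} → All (λ y → key y ≤ key x) ps → Unique (x ∷ ps) →
      (∀ {y z} → y ∈ x ∷ ps → z ∉ x ∷ ps → key y ≤ key z) → length (bag G (x ∷ ps)) ≤ suc k ℕ.+ suc k
    boundary-small {x} {ps} ≤x u before = ℕₚ.≤-trans (Unique-⊆-length (bag-unique G (x ∷ ps) u) inHome)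
      (ℕₚ.≤-trans (ℕₚ.≤-reflexive (Listₚ.length-++ (elements (node c)))) (ℕₚ.+-mono-≤ (small c) (small (anchor c))))
      where
      c : Fin m
      c = home x
      small : ∀ i → length (elements (node i)) ≤ suc k
      small i = ℕₚ.≤-trans (ℕₚ.≤-reflexive (length-elements (node i))) (width i)
      inHome : bag G (x ∷ ps) ⊆ elements (node c) ++ elements (node (anchor c))
      inHome {y} y∈bag with bag⁻ G (x ∷ ps) y∈bag
      ... | y∈ , z , z∉ , e with edgeCover y z e
      ...   | i , y∈i , z∈i with coherent y (home y) i (proj₁ (proj₂ (leftmost y))) y∈i
      ...     | p , all-p with passes c p all-p (pos-level {home y} {c} key≤) (pos-level {c} {i} key≥)
        where
        key≤ : key y ≤ key x
        key≤ = case y∈ of λ { (here refl) → ℕₚ.≤-refl ; (there q) → All.lookup ≤x q }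
        key≥ : key x ≤ pos i
        key≥ = ℕₚ.≤-trans (before (here refl) z∉) (proj₂ (proj₂ (leftmost z)) z∈i)
      ...       | inj₂ y∈a = ∈-++⁺ʳ (elements (node c)) (∈-elements y∈a)
      ...       | inj₁ refl = ∈-++⁺ˡ (∈-elements (subst (λ i → y ∈ˢ node i)
        (pos-injective {i} {c} (ℕₚ.≤-antisym key≤ key≥)) y∈i))
        where
        key≤ : key y ≤ key x
        key≤ = case y∈ of λ { (here refl) → ℕₚ.≤-refl ; (there q) → All.lookup ≤x q }
        key≥ : key x ≤ pos i
        key≥ = ℕₚ.≤-trans (before (here refl) z∉) (proj₂ (proj₂ (leftmost z)) z∈i)

    toOrder : ∀ ps → AllPairs (λ u v → key v ≤ key u) ps → Unique ps →
      (∀ {y z} → y ∈ ps → z ∉ ps → key y ≤ key z) → Order G (suc k ℕ.+ suc k) ps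
    toOrder [] _ _ _ = []
    toOrder (x ∷ ps) (≤x ∷ sorted) (x∉ ∷ u) before = step (λ p → All.lookup x∉ p refl) (small ps sorted u before′) (toOrder ps sorted u before′)
      where
      before′ : ∀ {y z} → y ∈ ps → z ∉ ps → key y ≤ key z
      before′ {y} {z} y∈ z∉ with z ≟ x
      ... | yes refl = All.lookup ≤x y∈
      ... | no z≢x = before (there y∈) λ { (here e) → z≢x e ; (there q) → z∉ q }
      small : ∀ ps → AllPairs (λ u v → key v ≤ key u) ps → Unique ps → (∀ {y z} → y ∈ ps → z ∉ ps → key y ≤ key z) →
        length (bag G ps) ≤ suc k ℕ.+ suc k
      small [] _ _ _ = z≤n
      small (x ∷ ps) (≤x ∷ _) u before = boundary-small ≤x u before

  narrow-order : ∃ λ ps → Order G (suc k ℕ.+ suc k) ps × (∀ x → x ∈ ps)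
  narrow-order = order , toOrder order order-sorted order-unique (λ {_} {z} _ z∉ → ⊥-elim (z∉ (all z))) , all
    where
    all : ∀ x → x ∈ order
    all x = Permₚ.∈-resp-↭ (Perm.↭-sym (S.sort-↭ (allFin n))) (∈-allFin x)

-- Edge lists, weights and walks.

∑-Unique-⊆ : ∀ {A : Set} {xs ys : List A} {f : A → ℚ} → (∀ x → 0ℚ ≤ℚ f x) → Unique xs → xs ⊆ ys → ∑ xs f ≤ℚ ∑ ys f
∑-Unique-⊆ {ys = ys} f≥0 [] _ = ∑-nonneg ys (λ {x} _ → f≥0 x)
∑-Unique-⊆ {xs = x ∷ xs} {f = f} f≥0 (x∉ ∷ u) sub with ∈-∃++ (sub (here refl))
... | ys₁ , ys₂ , refl = ℚₚ.≤-trans (ℚₚ.≤-refl {f x} ⊕ ∑-Unique-⊆ f≥0 u sub′)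
  (ℚₚ.≤-reflexive (trans (cong (f x +_) (∑-++ ys₁ ys₂ f)) (trans (swap (f x) (∑ ys₁ f) (∑ ys₂ f)) (sym (∑-++ ys₁ (x ∷ ys₂) f)))))
  where
  swap : ∀ a b c → a + (b + c) ≡ b + (a + c)
  swap = solve-∀ ℚ-ring
  sub′ : xs ⊆ ys₁ ++ ys₂
  sub′ p with ∈-++⁻ ys₁ (sub (there p))
  ... | inj₁ q = ∈-++⁺ˡ q
  ... | inj₂ (here refl) = ⊥-elim (All.lookup x∉ p refl)
  ... | inj₂ (there q) = ∈-++⁺ʳ ys₁ q

∑-filter-≡ : ∀ {A : Set} {P : A → Set} (P? : Decidable P) xs {f g : A → ℚ} →
  (∀ {x} → P x → f x ≡ g x) → (∀ {x} → ¬ P x → f x ≡ 0ℚ) → ∑ xs f ≡ ∑ (filter P? xs) g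
∑-filter-≡ P? [] h k = refl
∑-filter-≡ P? (x ∷ xs) h k with P? x
... | yes p = cong₂ _+_ (h p) (∑-filter-≡ P? xs h k)
... | no ¬p = trans (cong₂ _+_ (k ¬p) (∑-filter-≡ P? xs h k)) (ℚₚ.+-identityˡ _)

module _ {n : ℕ} where

  wt : (Fin n → Fin n → ℚ) → Fin n × Fin n → ℚ
  wt w e = w (proj₁ e) (proj₂ e)

  allPairs : List (Fin n × Fin n)
  allPairs = cartesianProduct (allFin n) (allFin n)

  -- The cells summed by weight; the conditional used there is a private local function.
  cells : (w : Fin n → Fin n → ℚ) (A : Adj n) →
    Σ (Fin n → Fin n → ℚ) λ f → weight w A ≡ sumℚ (concatMap (λ u → map (f u) (allFin n)) (allFin n))
  cells w A = _ , refl

  cell : (Fin n → Fin n → ℚ) → Adj n → Fin n → Fin n → ℚ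
  cell w A = proj₁ (cells w A)

  cell-edge : ∀ w A u v → Edge A u v → toℕ u ℕ.< toℕ v → cell w A u v ≡ w u v
  cell-edge w A u v e lt with A u v | e | toℕ u ℕ.<? toℕ v
  ... | true | _ | yes _ = refl
  ... | true | _ | no ¬lt = ⊥-elim (¬lt lt)

  cell-none : ∀ w A u v → ¬ (Edge A u v × toℕ u ℕ.< toℕ v) → cell w A u v ≡ 0ℚ
  cell-none w A u v ¬e with A u v | toℕ u ℕ.<? toℕ v
  ... | false | _ = refl
  ... | true | no _ = refl
  ... | true | yes lt = ⊥-elim (¬e (refl , lt))

  ForwardEdge : Adj n → Fin n × Fin n → Set
  ForwardEdge A e = Edge A (proj₁ e) (proj₂ e) × toℕ (proj₁ e) ℕ.< toℕ (proj₂ e)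

  forwardEdge? : ∀ A → Decidable (ForwardEdge A)
  forwardEdge? A e = (A (proj₁ e) (proj₂ e) Boolₚ.≟ true) ×-dec (toℕ (proj₁ e) ℕ.<? toℕ (proj₂ e))

  edgeList : Adj n → List (Fin n × Fin n)
  edgeList A = filter (forwardEdge? A) allPairs

  edgeList-unique : ∀ A → Unique (edgeList A)
  edgeList-unique A = Uniqueₚ.filter⁺ (forwardEdge? A) (Uniqueₚ.cartesianProduct⁺ (Uniqueₚ.allFin⁺ n) (Uniqueₚ.allFin⁺ n))

  edgeList⁺ : ∀ A {u v} → Edge A u v → toℕ u ℕ.< toℕ v → (u , v) ∈ edgeList A
  edgeList⁺ A {u} {v} e lt = ∈-filter⁺ (forwardEdge? A) (∈-cartesianProduct⁺ (∈-allFin u) (∈-allFin v)) (e , lt)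

  edgeList⁻ : ∀ A {u v} → (u , v) ∈ edgeList A → Edge A u v × toℕ u ℕ.< toℕ v
  edgeList⁻ A p = proj₂ (∈-filter⁻ (forwardEdge? A) {xs = allPairs} p)

  weight-edgeList : ∀ w A → weight w A ≡ ∑ (edgeList A) (wt w)
  weight-edgeList w A = trans (proj₂ (cells w A)) (trans (pairs (allFin n))
    (∑-filter-≡ (forwardEdge? A) allPairs
      (λ {e} p → cell-edge w A (proj₁ e) (proj₂ e) (proj₁ p) (proj₂ p))
      (λ {e} ¬p → cell-none w A (proj₁ e) (proj₂ e) ¬p)))
    where
    sum-++ : ∀ xs ys → sumℚ (xs ++ ys) ≡ sumℚ xs + sumℚ ys
    sum-++ [] ys = sym (ℚₚ.+-identityˡ (sumℚ ys))
    sum-++ (x ∷ xs) ys = trans (cong (x +_) (sum-++ xs ys)) (sym (ℚₚ.+-assoc x (sumℚ xs) (sumℚ ys)))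
    row : ∀ u vs → sumℚ (map (cell w A u) vs) ≡ ∑ (map (u ,_) vs) (wt (cell w A))
    row u [] = refl
    row u (v ∷ vs) = cong (cell w A u v +_) (row u vs)
    pairs : ∀ us → sumℚ (concatMap (λ u → map (cell w A u) (allFin n)) us) ≡ ∑ (cartesianProduct us (allFin n)) (wt (cell w A))
    pairs [] = refl
    pairs (u ∷ us) = trans (sum-++ (map (cell w A u) (allFin n)) _)
      (trans (cong₂ _+_ (row u (allFin n)) (pairs us)) (sym (∑-++ (map (u ,_) (allFin n)) _ (wt (cell w A)))))

  weight-cover : ∀ {w} → (∀ u v → 0ℚ ≤ℚ w u v) → ∀ A F → (∀ {u v} → Edge A u v → toℕ u ℕ.< toℕ v → (u , v) ∈ F) →
    weight w A ≤ℚ ∑ F (wt w)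
  weight-cover {w} w≥0 A F cover = ℚₚ.≤-trans (ℚₚ.≤-reflexive (weight-edgeList w A))
    (∑-Unique-⊆ (λ e → w≥0 (proj₁ e) (proj₂ e)) (edgeList-unique A) λ p → cover (proj₁ (edgeList⁻ A p)) (proj₂ (edgeList⁻ A p)))

  weight-nonneg : ∀ {w} → (∀ u v → 0ℚ ≤ℚ w u v) → ∀ A → 0ℚ ≤ℚ weight w A
  weight-nonneg {w} w≥0 A = subst (0ℚ ≤ℚ_) (sym (weight-edgeList w A)) (∑-nonneg (edgeList A) λ {e} _ → w≥0 (proj₁ e) (proj₂ e))

  addEdge⁻ : ∀ (H : Adj n) u v {x y} → Edge (addEdge H u v) x y → Edge H x y ⊎ (x ≡ u × y ≡ v) ⊎ (x ≡ v × y ≡ u)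
  addEdge⁻ H u v {x} {y} e with H x y | x ≟ u | y ≟ v | x ≟ v | y ≟ u
  ... | true | _ | _ | _ | _ = inj₁ refl
  ... | false | yes p | yes q | _ | _ = inj₂ (inj₁ (p , q))
  ... | false | yes _ | no _ | yes p | yes q = inj₂ (inj₂ (p , q))
  ... | false | no _ | _ | yes p | yes q = inj₂ (inj₂ (p , q))

  addEdge-mono : ∀ (H : Adj n) u v → H ⊆ᴳ addEdge H u v
  addEdge-mono H u v x y e = cong (_∨ ((⌊ x ≟ u ⌋ ∧ ⌊ y ≟ v ⌋) ∨ (⌊ x ≟ v ⌋ ∧ ⌊ y ≟ u ⌋))) e

  addEdge-new : ∀ (H : Adj n) u v → Edge (addEdge H u v) u v
  addEdge-new H u v with H u v | u ≟ u | v ≟ v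
  ... | true | _ | _ = refl
  ... | false | yes _ | yes _ = refl
  ... | false | no ne | _ = ⊥-elim (ne refl)
  ... | false | yes _ | no ne = ⊥-elim (ne refl)

  addEdge-sym : ∀ (H : Adj n) u v → (∀ x y → H x y ≡ H y x) → ∀ x y → addEdge H u v x y ≡ addEdge H u v y x
  addEdge-sym H u v H-sym x y = cong₂ _∨_ (H-sym x y)
    (trans (Boolₚ.∨-comm (⌊ x ≟ u ⌋ ∧ ⌊ y ≟ v ⌋) _)
      (cong₂ _∨_ (Boolₚ.∧-comm ⌊ x ≟ v ⌋ ⌊ y ≟ u ⌋) (Boolₚ.∧-comm ⌊ x ≟ u ⌋ ⌊ y ≟ v ⌋)))

module _ {n : ℕ} {w : Fin n → Fin n → ℚ} (w-sym : ∀ u v → w u v ≡ w v u) where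

  mapʷ : ∀ {A B : Adj n} → A ⊆ᴳ B → ∀ {x y} → Walk A x y → Walk B x y
  mapʷ sub [] = []
  mapʷ sub (e ∷ p) = sub _ _ e ∷ mapʷ sub p

  len-mapʷ : ∀ {A B : Adj n} (sub : A ⊆ᴳ B) {x y} (p : Walk A x y) → len w (mapʷ sub p) ≡ len w p
  len-mapʷ sub [] = refl
  len-mapʷ sub (_∷_ {u} {v} e p) = cong (w u v +_) (len-mapʷ sub p)

  module _ {A : Adj n} (A-sym : ∀ u v → A u v ≡ A v u) where

    reverseʷ : ∀ {x y} → Walk A x y → Walk A y x
    reverseʷ [] = []
    reverseʷ (_∷_ {u} {v} e p) = reverseʷ p ++ʷ (trans (A-sym v u) e ∷ [])

    len-reverseʷ : ∀ {x y} (p : Walk A x y) → len w (reverseʷ p) ≡ len w p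
    len-reverseʷ [] = refl
    len-reverseʷ (_∷_ {u} {v} e p) = trans (len-++ʷ w (reverseʷ p) _)
      (trans (cong₂ _+_ (len-reverseʷ p) (trans (ℚₚ.+-identityʳ (w v u)) (w-sym v u))) (ℚₚ.+-comm (len w p) (w u v)))

-- The greedy algorithm and its gap condition.

record Represents {n} (ES : List (Fin n × Fin n)) (H : Adj n) : Set where
  field
    symm : ∀ u v → H u v ≡ H v u
    listed : ∀ x y → Edge H x y → (x , y) ∈ ES ⊎ (y , x) ∈ ES
    isEdge : ∀ {x y} → (x , y) ∈ ES → Edge H x y

addEdge-represents : ∀ {n} {ES} {H : Adj n} u v → Represents ES H → Represents ((u , v) ∷ ES) (addEdge H u v)
addEdge-represents {ES = ES} {H} u v rep = record
  { symm = addEdge-sym H u v symm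
  ; listed = λ x y e → new x y (addEdge⁻ H u v e)
  ; isEdge = λ { (here refl) → addEdge-new H u v ; (there p) → addEdge-mono H u v _ _ (isEdge p) } }
  where
  open Represents rep
  new : ∀ x y → Edge H x y ⊎ (x ≡ u × y ≡ v) ⊎ (x ≡ v × y ≡ u) → (x , y) ∈ (u , v) ∷ ES ⊎ (y , x) ∈ (u , v) ∷ ES
  new x y (inj₁ e) with listed x y e
  ... | inj₁ p = inj₁ (there p)
  ... | inj₂ p = inj₂ (there p)
  new x y (inj₂ (inj₁ (refl , refl))) = inj₁ (here refl)
  new x y (inj₂ (inj₂ (refl , refl))) = inj₂ (here refl)

module GreedySpanner {n : ℕ} {w : Fin n → Fin n → ℚ} (w-sym : ∀ u v → w u v ≡ w v u) (w≥0 : ∀ u v → 0ℚ ≤ℚ w u v)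
  {ε : ℚ} (ε≥0 : 0ℚ ≤ℚ ε) {M : ℚ} (M≥0 : 0ℚ ≤ℚ M) (M-large : ∀ u v → (1ℚ + ε) * w u v <ℚ M) where

  private
    E : Set
    E = Fin n × Fin n

    _≟ᴱ_ : (e f : E) → Dec (e ≡ f)
    _≟ᴱ_ = ≡-dec _≟_ _≟_

    d : List E → Fin n → Fin n → ℚ
    d F = metricOf M (weigh w F)

    d-metric : ∀ F → IsMetric (d F)
    d-metric F = metricOf-metric M≥0 (weigh-nonneg w≥0 F)

    d-anti : ∀ {F F′} → F ⊆ F′ → ∀ x y → d F′ x y ≤ℚ d F x y
    d-anti {F} {F′} sub = metricOf-anti M≥0 (weigh-nonneg w≥0 F′) λ p →
      case weigh-∈ {ω = w} F p of λ { (f , f∈ , refl) → ∈-map⁺ _ (sub f∈) }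

  -- Since `F` ranges over all sublists without the edge, detours through edges added later are
  -- covered too.
  Gap : List E → List E → Set
  Gap ES Al = ∀ {x y} → (x , y) ∈ Al → ∀ F → F ⊆ ES → (x , y) ∉ F → (1ℚ + ε) * w x y <ℚ d F x y

  -- A distance within the threshold is below the cap, hence realized by a walk in `H`, which is too
  -- long by assumption.
  walk-gap : ∀ {ES H u v} → Represents ES H → (∀ (P : Walk H u v) → (1ℚ + ε) * w u v <ℚ len w P) →
    ∀ F → F ⊆ ES → (1ℚ + ε) * w u v <ℚ d F u v
  walk-gap {ES} {H} {u} {v} rep far F sub = ℚₚ.≰⇒> λ short → contradiction short
    (metricOf-realize M≥0 w≥0 w-sym symm F (isEdge ∘ sub) u v (ℚₚ.≤-<-trans short (M-large u v)))
    where
    open Represents rep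
    contradiction : d F u v ≤ℚ (1ℚ + ε) * w u v → Σ (Walk H u v) (λ P → len w P ≤ℚ d F u v) → ⊥
    contradiction short (P , h) = ℚₚ.<-irrefl refl (ℚₚ.<-≤-trans (far P) (ℚₚ.≤-trans h short))

  -- If a detour around an older edge e uses the new edge f, then exchanging f for e gives a detour
  -- around f, which is long; since f is at least as heavy as e, the first detour is long as well.
  gap-step : ∀ {ES Al u v} → Gap ES Al → Al ⊆ ES → (∀ F → F ⊆ ES → (1ℚ + ε) * w u v <ℚ d F u v) →
    (∀ {e} → e ∈ Al → wt w e ≤ℚ w u v) → Gap ((u , v) ∷ ES) ((u , v) ∷ Al)
  gap-step {ES} {Al} {u} {v} gap Al⊆ far heavy (here refl) F sub f∉F = far F λ {e} p → drop p (sub p)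
    where
    drop : ∀ {e} → e ∈ F → e ∈ (u , v) ∷ ES → e ∈ ES
    drop p (here refl) = ⊥-elim (f∉F p)
    drop p (there q) = q
  gap-step {ES} {Al} {u} {v} gap Al⊆ far heavy {x} {y} (there e∈) F sub e∉F =
    ℚₚ.<-≤-trans (cases (addE-sel (d F′) u v (w u v) x y)) (d-anti F⊆ x y)
    where
    other? : Decidable (λ f → f ≢ (x , y))
    other? f = ¬? (f ≟ᴱ (x , y))
    -- The extreme case: `F` is contained in `(u , v) ∷ F′`, and more edges only shorten distances.
    F′ : List E
    F′ = filter other? ES
    F′⊆ : F′ ⊆ ES
    F′⊆ p = proj₁ (∈-filter⁻ other? {xs = ES} p)
    F⊆ : F ⊆ (u , v) ∷ F′
    F⊆ p with sub p
    ... | here refl = here refl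
    ... | there q = there (∈-filter⁺ other? q λ { refl → e∉F p })
    e∉F′ : (x , y) ∉ F′
    e∉F′ p = proj₂ (∈-filter⁻ other? {xs = ES} p) refl
    module F′ = IsMetric (d-metric F′)
    far′ : (1ℚ + ε) * w u v <ℚ d ((x , y) ∷ F′) u v
    far′ = far ((x , y) ∷ F′) λ { (here refl) → Al⊆ e∈ ; (there p) → F′⊆ p }
    -- The difference of the two sides of the conclusion exceeds (2 + ε)(wf - we), which is
    -- nonnegative.
    exchange : ∀ a b we wf → (1ℚ + ε) * wf <ℚ a + we + b → we ≤ℚ wf → (1ℚ + ε) * we <ℚ a + wf + b
    exchange a b we wf h k = lin< (ℚₚ.+-mono-<-≤ h (*-mono-nonneg (+-nonneg (fromℕ-nonneg 2) ε≥0) k)) (identity a b we wf ε)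
      where
      identity : ∀ a b we wf ε → a + wf + b + ((1ℚ + ε) * wf + (1ℚ + 1ℚ + ε) * we) ≡ (1ℚ + ε) * we + (a + we + b + (1ℚ + 1ℚ + ε) * wf)
      identity = solve-∀ ℚ-ring
    flip : ∀ a b c → a + b + c ≡ c + b + a
    flip = solve-∀ ℚ-ring
    cases : d F′ x y ≤ℚ d ((u , v) ∷ F′) x y ⊎ (d F′ x u + w u v + d F′ v y ≤ℚ d ((u , v) ∷ F′) x y
      ⊎ d F′ x v + w u v + d F′ u y ≤ℚ d ((u , v) ∷ F′) x y) → (1ℚ + ε) * w x y <ℚ d ((u , v) ∷ F′) x y
    cases (inj₁ h) = ℚₚ.<-≤-trans (gap e∈ F′ F′⊆ e∉F′) h
    cases (inj₂ (inj₁ h)) = ℚₚ.<-≤-trans (exchange (d F′ x u) (d F′ v y) (w x y) (w u v)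
      (ℚₚ.<-≤-trans far′ (subst₂ (λ a b → d ((x , y) ∷ F′) u v ≤ℚ a + w x y + b) (F′.symm u x) (F′.symm y v)
        (addE≤uv (d F′) x y (w x y) u v))) (heavy e∈)) h
    cases (inj₂ (inj₂ h)) = ℚₚ.<-≤-trans (exchange (d F′ x v) (d F′ u y) (w x y) (w u v)
      (ℚₚ.<-≤-trans far′ (ℚₚ.≤-trans (addE≤vu (d F′) x y (w x y) u v)
        (ℚₚ.≤-reflexive (flip (d F′ u y) (w x y) (d F′ x v))))) (heavy e∈)) h

  record Outcome (E₀ Al₀ es : List E) (H₀ H : Adj n) : Set where
    field
      Al : List E
      represents : Represents (Al ++ E₀) H
      unique : Unique Al
      gap : Gap (Al ++ E₀) Al
      provenance : ∀ {e} → e ∈ Al → e ∈ Al₀ ⊎ e ∈ es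
      grows : H₀ ⊆ᴳ H
      spans : ∀ {u v} → (u , v) ∈ es → Σ (Walk H u v) λ P → len w P ≤ℚ (1ℚ + ε) * w u v

  stretch : ∀ u v → w u v + 0ℚ ≤ℚ (1ℚ + ε) * w u v
  stretch u v = lin (*-nonneg ε≥0 (w≥0 u v)) (identity ε (w u v))
    where
    identity : ∀ ε a → (1ℚ + ε) * a + 0ℚ ≡ a + 0ℚ + ε * a
    identity = solve-∀ ℚ-ring

  -- The order by weight makes every edge added so far at most as heavy as every edge to come, as
  -- `gap-step` requires. A skipped edge keeps its short walk because the graph only grows.
  run : ∀ {H es H′} → Greedy w ε H es H′ → ∀ {E₀} Al → Represents (Al ++ E₀) H → Unique Al → Gap (Al ++ E₀) Al →
    (∀ {e f} → e ∈ Al → f ∈ es → wt w e ≤ℚ wt w f) → (∀ {e} → e ∈ Al → e ∉ es) →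
    AllPairs (λ e f → wt w e ≤ℚ wt w f) es → Unique es → Outcome E₀ Al es H H′
  run done Al rep uniq gap heavy disj sorted ues = record
    { Al = Al ; represents = rep ; unique = uniq ; gap = gap ; provenance = inj₁ ; grows = λ _ _ e → e ; spans = λ () }
  run (add {H} {u} {v} far g) {E₀} Al rep uniq gap heavy disj (≤es ∷ sorted) (∉es ∷ ues) = record
    { Al = O.Al ; represents = O.represents ; unique = O.unique ; gap = O.gap
    ; provenance = λ p → [ (λ { (here refl) → inj₂ (here refl) ; (there q) → inj₁ q }) , inj₂ ∘ there ]′ (O.provenance p)
    ; grows = λ x y e → O.grows x y (addEdge-mono H u v x y e)
    ; spans = λ { (here refl) → O.grows u v (addEdge-new H u v) ∷ [] , stretch u v ; (there p) → O.spans p } }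
    where
    rest : Outcome E₀ ((u , v) ∷ Al) _ (addEdge H u v) _
    rest = run g ((u , v) ∷ Al) (addEdge-represents u v rep)
      (Allₚ.¬Any⇒All¬ Al (λ p → disj p (here refl)) ∷ uniq)
      (gap-step gap ∈-++⁺ˡ (walk-gap rep far) (λ p → heavy p (here refl)))
      (λ { (here refl) f∈ → All.lookup ≤es f∈ ; (there p) f∈ → heavy p (there f∈) })
      (λ { (here refl) p → All.lookup ∉es p refl ; (there p) q → disj p (there q) })
      sorted ues
    module O = Outcome rest
  run (skip {H} {u} {v} (P , short) g) {E₀} Al rep uniq gap heavy disj (_ ∷ sorted) (_ ∷ ues) = record
    { Al = O.Al ; represents = O.represents ; unique = O.unique ; gap = O.gap
    ; provenance = λ p → [ inj₁ , inj₂ ∘ there ]′ (O.provenance p)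
    ; grows = O.grows
    ; spans = λ { (here refl) → mapʷ w-sym O.grows P , ℚₚ.≤-trans (ℚₚ.≤-reflexive (len-mapʷ w-sym O.grows P)) short
                ; (there p) → O.spans p } }
    where
    rest : Outcome E₀ Al _ H _
    rest = run g Al rep uniq gap (λ p f∈ → heavy p (there f∈)) (λ p q → disj p (there q)) sorted ues
    module O = Outcome rest

  -- Comparing the computable distance with the threshold decides each step: a short distance is
  -- realized by a walk because the threshold is below the cap, and a long one bounds all walks from
  -- below.
  greedy-exists : ∀ es {H ES} → Represents ES H → ∃ λ H′ → Greedy w ε H es H′
  greedy-exists [] {H} rep = H , done
  greedy-exists ((u , v) ∷ es) {H} {ES} rep = decide (d ES u v ℚₚ.≤? (1ℚ + ε) * w u v)
    where
    open Represents rep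
    decide : Dec (d ES u v ≤ℚ (1ℚ + ε) * w u v) → ∃ λ H′ → Greedy w ε H ((u , v) ∷ es) H′
    decide (yes short) with greedy-exists es rep
    ... | H′ , g = H′ , skip (proj₁ realized , ℚₚ.≤-trans (proj₂ realized) short) g
      where
      realized : Σ (Walk H u v) λ P → len w P ≤ℚ d ES u v
      realized = metricOf-realize M≥0 w≥0 w-sym symm ES isEdge u v (ℚₚ.≤-<-trans short (M-large u v))
    decide (no long) with greedy-exists es (addEdge-represents u v rep)
    ... | H′ , g = H′ , add (λ P → ℚₚ.<-≤-trans (ℚₚ.≰⇒> long) (metricOf≤len M≥0 w≥0 w-sym listed P)) g

-- The constants κ = ε / 5 and K.

record Constants (q : ℕ) (ε : ℚ) : Set where
  field
    κ κ⁻¹ K : ℚ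
    κ≥0 : 0ℚ ≤ℚ κ
    κ⁻¹≥0 : 0ℚ ≤ℚ κ⁻¹
    κ⁻¹*κ : κ⁻¹ * κ ≡ 1ℚ
    five : κ + κ + κ + κ + κ ≡ ε
    K>0 : 0ℚ <ℚ K
    K-large : fromℕ (suc q) * (1ℚ + (κ + κ + κ + κ + κ)) ≤ℚ K * κ

  -- The bound of `Lightness.light` divided by `κ`: the ratio of the weight of the charged edges to
  -- that of the connecting edges.
  factor : ℚ
  factor = κ⁻¹ * (fromℕ q * (fromℕ q * (K + K + 1ℚ)) * fromℕ (suc q))

  factor≥0 : 0ℚ ≤ℚ factor
  factor≥0 = *-nonneg κ⁻¹≥0 (*-nonneg (*-nonneg (fromℕ-nonneg q) (*-nonneg (fromℕ-nonneg q)
    (+-nonneg (+-nonneg (ℚₚ.<⇒≤ K>0) (ℚₚ.<⇒≤ K>0)) (fromℕ-nonneg 1)))) (fromℕ-nonneg (suc q)))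

constants : ∀ q {ε} → 0ℚ <ℚ ε → Constants q ε
constants q {ε} ε>0 = record
  { κ = κ ; κ⁻¹ = κ⁻¹ ; K = C * κ⁻¹
  ; κ≥0 = ℚₚ.<⇒≤ (ℚₚ.positive⁻¹ κ)
  ; κ⁻¹≥0 = ℚₚ.<⇒≤ (ℚₚ.positive⁻¹ κ⁻¹ ⦃ κ⁻¹-positive ⦄)
  ; κ⁻¹*κ = ℚₚ.*-inverseˡ κ
  ; five = trans (distrib ε ⅕) (ℚₚ.*-identityʳ ε)
  ; K>0 = ℚₚ.positive⁻¹ (C * κ⁻¹) ⦃ ℚₚ.pos*pos⇒pos C ⦃ C-positive ⦄ κ⁻¹ ⦃ κ⁻¹-positive ⦄ ⦄
  ; K-large = ℚₚ.≤-reflexive (sym (trans (ℚₚ.*-assoc C κ⁻¹ κ) (trans (cong (C *_) (ℚₚ.*-inverseˡ κ)) (ℚₚ.*-identityʳ C)))) }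
  where
  ⅕ κ C : ℚ
  ⅕ = ℤ.+ 1 ℚ./ 5
  κ = ε * ⅕
  C = fromℕ (suc q) * (1ℚ + (κ + κ + κ + κ + κ))
  instance
    κ-positive : ℚ.Positive κ
    κ-positive = ℚₚ.pos*pos⇒pos ε ⦃ ℚ.positive ε>0 ⦄ ⅕
    κ-nonZero : ℚ.NonZero κ
    κ-nonZero = ℚₚ.pos⇒nonZero κ
  κ⁻¹ : ℚ
  κ⁻¹ = ℚ.1/ κ
  κ⁻¹-positive : ℚ.Positive κ⁻¹
  κ⁻¹-positive = ℚₚ.1/pos⇒pos κ
  distrib : ∀ e c → e * c + e * c + e * c + e * c + e * c ≡ e * (c + c + c + c + c)
  distrib = solve-∀ ℚ-ring
  five≥0 : 0ℚ ≤ℚ κ + κ + κ + κ + κ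
  five≥0 = +-nonneg (+-nonneg (+-nonneg (+-nonneg κ≥0 κ≥0) κ≥0) κ≥0) κ≥0
    where
    κ≥0 : 0ℚ ≤ℚ κ
    κ≥0 = ℚₚ.<⇒≤ (ℚₚ.positive⁻¹ κ)
  C-positive : ℚ.Positive C
  C-positive = ℚₚ.pos*pos⇒pos (fromℕ (suc q)) ⦃ ℚ.positive (ℚₚ.+-mono-<-≤ (ℚₚ.positive⁻¹ 1ℚ) (fromℕ-nonneg q)) ⦄
    (1ℚ + (κ + κ + κ + κ + κ)) ⦃ ℚ.positive (ℚₚ.+-mono-<-≤ (ℚₚ.positive⁻¹ 1ℚ) five≥0) ⦄

-- Greedy spanners are spanners and light.

Step : ∀ {n} → List (Fin n × Fin n) → Fin n → Fin n → Set
Step F u v = (u , v) ∈ F ⊎ (v , u) ∈ F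

Step-sym : ∀ {n} {F : List (Fin n × Fin n)} {u v} → Step F u v → Step F v u
Step-sym (inj₁ p) = inj₂ p
Step-sym (inj₂ p) = inj₁ p

Step-mono : ∀ {n} {F F′ : List (Fin n × Fin n)} → F ⊆ F′ → ∀ {u v} → Star (Step F) u v → Star (Step F′) u v
Step-mono sub = Star.map λ { (inj₁ p) → inj₁ (sub p) ; (inj₂ p) → inj₂ (sub p) }

edgeList-represents : ∀ {n} {A : Adj n} → IsGraph A → Represents (edgeList A) A
edgeList-represents {A = A} (A-sym , A-loopless) = record
  { symm = A-sym ; listed = listed ; isEdge = λ p → proj₁ (edgeList⁻ A p) }
  where
  listed : ∀ x y → Edge A x y → (x , y) ∈ edgeList A ⊎ (y , x) ∈ edgeList A
  listed x y e with ℕₚ.<-cmp (toℕ x) (toℕ y)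
  ... | tri< lt _ _ = inj₁ (edgeList⁺ A e lt)
  ... | tri> _ _ gt = inj₂ (edgeList⁺ A (trans (A-sym y x) e) gt)
  ... | tri≈ _ eq _ with Finₚ.toℕ-injective eq
  ...   | refl = case trans (sym e) (A-loopless x) of λ ()

module Spanners {n : ℕ} {G : Adj n} {w : Fin n → Fin n → ℚ} (isGraph : IsGraph G)
  (w-sym : ∀ u v → w u v ≡ w v u) (w≥0 : ∀ u v → 0ℚ ≤ℚ w u v)
  {ε : ℚ} (ε≥0 : 0ℚ ≤ℚ ε) {M : ℚ} (M≥0 : 0ℚ ≤ℚ M) (M-large : ∀ u v → (1ℚ + ε) * w u v <ℚ M) where

  private
    E : Set
    E = Fin n × Fin n

  open GreedySpanner w-sym w≥0 ε≥0 M≥0 M-large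

  greedy-outcome : ∀ {T es H} → IsGraph T → ValidOrder G w T es → Greedy w ε T es H → Outcome (edgeList T) [] es T H
  greedy-outcome T-graph valid greedy = run greedy [] (edgeList-represents T-graph) [] (λ ()) (λ ()) (λ ())
    (Linkedₚ.Linked⇒AllPairs ℚₚ.≤-trans (proj₂ (proj₂ valid))) (proj₁ valid)

  module _ {T : Adj n} (T-graph : IsGraph T) (T⊆G : T ⊆ᴳ G) {es : List E} (valid : ValidOrder G w T es)
    {H : Adj n} (outcome : Outcome (edgeList T) [] es T H) where

    private
      es⁻ : ∀ {u v} → (u , v) ∈ es → Edge G u v × ¬ Edge T u v × toℕ u ℕ.< toℕ v
      es⁻ {u} {v} = proj₁ (proj₁ (proj₂ valid) u v)

      es⁺ : ∀ {u v} → Edge G u v → ¬ Edge T u v → toℕ u ℕ.< toℕ v → (u , v) ∈ es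
      es⁺ {u} {v} e ¬t lt = proj₂ (proj₁ (proj₂ valid) u v) (e , ¬t , lt)

    open Outcome outcome
    open Represents represents

    ES : List E
    ES = Al ++ edgeList T

    ES⁻ : ∀ {u v} → (u , v) ∈ ES → Edge G u v × toℕ u ℕ.< toℕ v
    ES⁻ {u} {v} p with ∈-++⁻ Al p
    ... | inj₁ q with provenance q
    ...   | inj₂ r = proj₁ (es⁻ r) , proj₂ (proj₂ (es⁻ r))
    ES⁻ {u} {v} p | inj₂ q = T⊆G u v (proj₁ (edgeList⁻ T q)) , proj₂ (edgeList⁻ T q)

    H⊆G : H ⊆ᴳ G
    H⊆G x y e with listed x y e
    ... | inj₁ p = proj₁ (ES⁻ p)
    ... | inj₂ p = trans (proj₁ isGraph x y) (proj₁ (ES⁻ p))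

    H-loopless : ∀ u → H u u ≡ false
    H-loopless u = Boolₚ.¬-not λ e → case listed u u e of λ
      { (inj₁ p) → ℕₚ.<-irrefl refl (proj₂ (ES⁻ p)) ; (inj₂ p) → ℕₚ.<-irrefl refl (proj₂ (ES⁻ p)) }

    -- An edge of `T` serves itself. Any other edge was processed from its smaller endpoint, so its
    -- route may have to be reversed.
    edge-route : ∀ u v → Edge G u v → Σ (Walk H u v) λ Q → len w Q ≤ℚ (1ℚ + ε) * w u v
    edge-route u v e with T u v Boolₚ.≟ true
    ... | yes t = grows u v t ∷ [] , stretch u v
    ... | no ¬t with ℕₚ.<-cmp (toℕ u) (toℕ v)
    ...   | tri< lt _ _ = spans (es⁺ e ¬t lt)
    ...   | tri> _ _ gt = reverseʷ w-sym symm (proj₁ back) ,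
      ℚₚ.≤-trans (ℚₚ.≤-reflexive (len-reverseʷ w-sym symm (proj₁ back)))
        (subst (λ t → len w (proj₁ back) ≤ℚ (1ℚ + ε) * t) (w-sym v u) (proj₂ back))
      where
      back : Σ (Walk H v u) λ Q → len w Q ≤ℚ (1ℚ + ε) * w v u
      back = spans (es⁺ (trans (proj₁ isGraph v u) e) (λ t → ¬t (trans (proj₁ T-graph u v) t)) gt)
    ...   | tri≈ _ eq _ with Finₚ.toℕ-injective eq
    ...     | refl = case trans (sym e) (proj₂ isGraph u) of λ ()

    isSpanner : IsSpanner G w ε H
    isSpanner = (symm , H-loopless) , H⊆G , λ _ _ → route
      where
      route : ∀ {u v} (P : Walk G u v) → Σ (Walk H u v) λ Q → len w Q ≤ℚ (1ℚ + ε) * len w P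
      route [] = [] , ℚₚ.≤-reflexive (sym (ℚₚ.*-zeroʳ (1ℚ + ε)))
      route (_∷_ {u} {v} e P) = proj₁ (edge-route u v e) ++ʷ proj₁ (route P) ,
        ℚₚ.≤-trans (ℚₚ.≤-reflexive (len-++ʷ w (proj₁ (edge-route u v e)) (proj₁ (route P))))
          (ℚₚ.≤-trans (proj₂ (edge-route u v e) ⊕ proj₂ (route P))
            (ℚₚ.≤-reflexive (sym (ℚₚ.*-distribˡ-+ (1ℚ + ε) (w u v) (len w P)))))

    module _ {k : ℕ} (cd : CaterpillarDecomposition G k) (constants : Constants (suc k ℕ.+ suc k) ε) where

      open Constants constants
      open import Data.List.Membership.DecPropositional (≡-dec (_≟_ {n}) (_≟_ {n})) using (_∈?_)

      -- Any connected part `Tl` of the spanner containing `T` can play the role of the tree. The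
      -- remaining edges `L` keep their gap over `S ++ Tl`, since these edges belong to `ES` and
      -- omit the edge in question. The summand 1 accounts for `Tl` itself.
      weight≤ : ∀ Tl → Tl ⊆ ES → edgeList T ⊆ Tl → (∀ x y → Star (Step Tl) x y) →
        weight w H ≤ℚ (factor + 1ℚ) * ∑ Tl (wt w)
      weight≤ Tl Tl⊆ES T⊆Tl connected = ℚₚ.≤-trans (weight-cover w≥0 H (L ++ Tl) cover)
        (ℚₚ.≤-trans (ℚₚ.≤-reflexive (∑-++ L Tl (wt w)))
          (lin L-light (identity (∑ L (wt w)) (∑ Tl (wt w)) factor)))
        where
        identity : ∀ l t f → (f + 1ℚ) * t + l ≡ l + t + f * t
        identity = solve-∀ ℚ-ring
        new? : Decidable (λ e → e ∉ Tl)
        new? e = ¬? (e ∈? Tl)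
        L : List E
        L = filter new? Al
        L⁻ : ∀ {e} → e ∈ L → e ∈ Al × e ∉ Tl
        L⁻ p = ∈-filter⁻ new? {xs = Al} p
        in-L++Tl : ∀ {e} → e ∈ ES → e ∈ L ++ Tl
        in-L++Tl {e} p with e ∈? Tl
        ... | yes q = ∈-++⁺ʳ L q
        ... | no ¬q with ∈-++⁻ Al p
        ...   | inj₁ q = ∈-++⁺ˡ (∈-filter⁺ new? q ¬q)
        ...   | inj₂ q = ∈-++⁺ʳ L (T⊆Tl q)
        cover : ∀ {u v} → Edge H u v → toℕ u ℕ.< toℕ v → (u , v) ∈ L ++ Tl
        cover {u} {v} e lt with listed u v e
        ... | inj₁ p = in-L++Tl p
        ... | inj₂ p = ⊥-elim (ℕₚ.<-asym lt (proj₂ (ES⁻ p)))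
        L-gap : ∀ {u v} → (u , v) ∈ L → ∀ S → S ⊆ L → (u , v) ∉ S →
          (1ℚ + (κ + κ + κ + κ + κ)) * w u v ≤ℚ metricOf M (weigh w (S ++ Tl)) u v
        L-gap {u} {v} p S S⊆L e∉S = subst (λ t → (1ℚ + t) * w u v ≤ℚ metricOf M (weigh w (S ++ Tl)) u v) (sym five)
          (ℚₚ.<⇒≤ (gap (proj₁ (L⁻ p)) (S ++ Tl)
            (λ q → [ (λ r → ∈-++⁺ˡ (proj₁ (L⁻ (S⊆L r)))) , Tl⊆ES ]′ (∈-++⁻ S q))
            (λ q → [ e∉S , proj₂ (L⁻ p) ]′ (∈-++⁻ S q))))
        κL≤ : κ * ∑ L (wt w) ≤ℚ fromℕ (suc k ℕ.+ suc k) * (fromℕ (suc k ℕ.+ suc k) * (K + K + 1ℚ)) * (fromℕ (suc (suc k ℕ.+ suc k)) * ∑ Tl (wt w))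
        κL≤ = Lightness.light (proj₁ isGraph) w≥0 M≥0 (λ p → proj₁ (ES⁻ (Tl⊆ES p))) (λ p → proj₁ (ES⁻ (∈-++⁺ˡ (proj₁ (L⁻ p)))))
          connected (Uniqueₚ.filter⁺ new? unique) κ≥0 K>0 K-large L-gap
          (proj₁ (proj₂ (narrow-order cd))) (proj₂ (proj₂ (narrow-order cd)))
        L-light : ∑ L (wt w) ≤ℚ factor * ∑ Tl (wt w)
        L-light = subst₂ _≤ℚ_
          (trans (sym (ℚₚ.*-assoc κ⁻¹ κ (∑ L (wt w)))) (trans (cong (_* ∑ L (wt w)) κ⁻¹*κ) (ℚₚ.*-identityˡ (∑ L (wt w)))))
          (assoc κ⁻¹ (fromℕ (suc k ℕ.+ suc k) * (fromℕ (suc k ℕ.+ suc k) * (K + K + 1ℚ))) (fromℕ (suc (suc k ℕ.+ suc k))) (∑ Tl (wt w)))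
          (*-mono-nonneg κ⁻¹≥0 κL≤)
          where
          assoc : ∀ a b c d → a * (b * (c * d)) ≡ a * (b * c) * d
          assoc = solve-∀ ℚ-ring

  walk-star : ∀ {F} {A : Adj n} → Represents F A → ∀ {x y} → Walk A x y → Star (Step F) x y
  walk-star rep [] = nil
  walk-star rep (_∷_ {u} {v} e P) = Represents.listed rep u v e ◅ walk-star rep P

  record Route (ES : List E) (x y : Fin n) (bound : ℚ) : Set where
    field
      edges : List E
      edges⊆ : edges ⊆ ES
      path : Star (Step edges) x y
      short : ∑ edges (wt w) ≤ℚ bound

  walk-route : ∀ {ES H} → Represents ES H → ∀ {x y} (P : Walk H x y) → Route ES x y (len w P)
  walk-route rep [] = record { edges = [] ; edges⊆ = λ () ; path = nil ; short = ℚₚ.≤-refl }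
  walk-route {ES} rep (_∷_ {u} {v} e P) = extend (Represents.listed rep u v e)
    where
    module R = Route (walk-route rep P)
    extend : (u , v) ∈ ES ⊎ (v , u) ∈ ES → Route ES u _ (w u v + len w P)
    extend (inj₁ p) = record
      { edges = (u , v) ∷ R.edges ; edges⊆ = λ { (here refl) → p ; (there q) → R.edges⊆ q }
      ; path = inj₁ (here refl) ◅ Step-mono there R.path ; short = ℚₚ.≤-refl {w u v} ⊕ R.short }
    extend (inj₂ p) = record
      { edges = (v , u) ∷ R.edges ; edges⊆ = λ { (here refl) → p ; (there q) → R.edges⊆ q }
      ; path = inj₂ (here refl) ◅ Step-mono there R.path ; short = ℚₚ.≤-reflexive (w-sym v u) ⊕ R.short }

  -- The H-routes of the edges of a spanning tree of G form a connected subgraph of H that is at most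
  -- 1 + ε times heavier than the tree.
  record Rerouting (ES F : List E) : Set where
    field
      edges : List E
      edges⊆ : edges ⊆ ES
      paths : ∀ {u v} → (u , v) ∈ F → Star (Step edges) u v
      short : ∑ edges (wt w) ≤ℚ (1ℚ + ε) * ∑ F (wt w)

  reroute : ∀ {ES H} → Represents ES H → ∀ F →
    (∀ {u v} → (u , v) ∈ F → Σ (Walk H u v) λ Q → len w Q ≤ℚ (1ℚ + ε) * w u v) → Rerouting ES F
  reroute rep [] routes = record { edges = [] ; edges⊆ = λ () ; paths = λ () ; short = ℚₚ.≤-reflexive (sym (ℚₚ.*-zeroʳ (1ℚ + ε))) }
  reroute rep ((u , v) ∷ F) routes = record
    { edges = P.edges ++ R.edges
    ; edges⊆ = λ p → [ P.edges⊆ , R.edges⊆ ]′ (∈-++⁻ P.edges p)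
    ; paths = λ { (here refl) → Step-mono ∈-++⁺ˡ P.path ; (there p) → Step-mono (∈-++⁺ʳ P.edges) (R.paths p) }
    ; short = ℚₚ.≤-trans (ℚₚ.≤-reflexive (∑-++ P.edges R.edges (wt w)))
        (ℚₚ.≤-trans (ℚₚ.≤-trans P.short (proj₂ (routes (here refl))) ⊕ R.short)
          (ℚₚ.≤-reflexive (sym (ℚₚ.*-distribˡ-+ (1ℚ + ε) (w u v) (∑ F (wt w)))))) }
    where
    module P = Route (walk-route rep (proj₁ (routes (here refl))))
    module R = Rerouting (reroute rep F (routes ∘ there))

  weightOrder : DecTotalOrder 0ℓ 0ℓ 0ℓ
  weightOrder = On.decTotalOrder ℚₚ.≤-decTotalOrder (wt w)

  module ByWeight = Sort weightOrder

  noEdges : Adj n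
  noEdges _ _ = false

  noEdges-graph : IsGraph noEdges
  noEdges-graph = (λ _ _ → refl) , (λ _ → refl)

  sortedEdges : List E
  sortedEdges = ByWeight.sort (edgeList G)

  sortedEdges-valid : ValidOrder G w noEdges sortedEdges
  sortedEdges-valid =
    PermSetoidₚ.Unique-resp-↭ (setoid E) (Perm.↭⇒↭ₛ (Perm.↭-sym (ByWeight.sort-↭ (edgeList G)))) (edgeList-unique G) ,
    (λ u v → (λ p → let q = edgeList⁻ G (Permₚ.∈-resp-↭ (ByWeight.sort-↭ (edgeList G)) p) in proj₁ q , (λ ()) , proj₂ q) ,
             (λ { (e , _ , lt) → Permₚ.∈-resp-↭ (Perm.↭-sym (ByWeight.sort-↭ (edgeList G))) (edgeList⁺ G e lt) })) ,
    ByWeight.sort-↗ (edgeList G)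

  module _ {k : ℕ} (cd : CaterpillarDecomposition G k) (cs : Constants (suc k ℕ.+ suc k) ε) where

    open Constants cs using (factor; factor≥0)

    bound : ℚ
    bound = (factor + 1ℚ) * (1ℚ + ε)

    private
      factor+1≥0 : 0ℚ ≤ℚ factor + 1ℚ
      factor+1≥0 = +-nonneg factor≥0 (fromℕ-nonneg 1)

    -- The routes of the edges of the competing tree serve as `Tl`; rerouting costs the factor 1 + ε
    -- in `bound`.
    light-from-scratch : ∀ {H} → Outcome (edgeList noEdges) [] sortedEdges noEdges H → Light G w bound H
    light-from-scratch {H} O T (T⊆G , T-tree) = ℚₚ.≤-trans
      (weight≤ noEdges-graph (λ _ _ ()) sortedEdges-valid O cd cs R.edges R.edges⊆
        (λ p → case proj₁ (edgeList⁻ noEdges p) of λ ()) connected)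
      (ℚₚ.≤-trans (*-mono-nonneg factor+1≥0 R.short)
        (ℚₚ.≤-reflexive (trans (sym (ℚₚ.*-assoc (factor + 1ℚ) (1ℚ + ε) _)) (cong (bound *_) (sym (weight-edgeList w T))))))
      where
      module R = Rerouting (reroute (Outcome.represents O) (edgeList T)
        (λ {u} {v} p → edge-route noEdges-graph (λ _ _ ()) sortedEdges-valid O u v (T⊆G u v (proj₁ (edgeList⁻ T p)))))
      connected : ∀ x y → Star (Step R.edges) x y
      connected x y = Star.concat (Star.map
        (λ { (inj₁ p) → R.paths p ; (inj₂ p) → Star.reverse Step-sym (R.paths p) })
        (walk-star (edgeList-represents (proj₁ T-tree)) (proj₁ (proj₂ T-tree) x y)))

    -- Here `T` itself serves as `Tl`, and minimality compares it with the competitor. The factor 1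
    -- + ε is slack that lets both statements share one constant.
    light-from-tree : ∀ {T es H} → MinSpanningTree G w T → ValidOrder G w T es → Outcome (edgeList T) [] es T H → Light G w bound H
    light-from-tree {T} {es} {H} ((T⊆G , T-graph , T-conn , _) , minimal) valid O T′ T′-spanning = ℚₚ.≤-trans
      (weight≤ T-graph T⊆G valid O cd cs (edgeList T)
        (∈-++⁺ʳ (Outcome.Al O)) id
        (λ x y → walk-star (edgeList-represents T-graph) (T-conn x y)))
      (ℚₚ.≤-trans (ℚₚ.≤-reflexive (cong ((factor + 1ℚ) *_) (sym (weight-edgeList w T))))
        (ℚₚ.≤-trans (*-mono-nonneg factor+1≥0 (minimal T′ T′-spanning))
          (lin (*-nonneg (*-nonneg factor+1≥0 ε≥0) (weight-nonneg w≥0 T′)) (identity (factor + 1ℚ) ε (weight w T′)))))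
      where
      identity : ∀ f e t → f * (1ℚ + e) * t + 0ℚ ≡ f * t + f * e * t
      identity = solve-∀ ℚ-ring

-- The distance cap and the conclusion.

module _ {n : ℕ} {w : Fin n → Fin n → ℚ} (w≥0 : ∀ u v → 0ℚ ≤ℚ w u v) {ε : ℚ} (ε≥0 : 0ℚ ≤ℚ ε) where

  private
    1+ε≥0 : 0ℚ ≤ℚ 1ℚ + ε
    1+ε≥0 = +-nonneg (fromℕ-nonneg 1) ε≥0

  -- Each weight is at most the sum of all; the final 1 puts every greedy threshold strictly below
  -- the cap.
  distanceCap : ℚ
  distanceCap = (1ℚ + ε) * ∑ allPairs (wt w) + 1ℚ

  distanceCap≥0 : 0ℚ ≤ℚ distanceCap
  distanceCap≥0 = +-nonneg (*-nonneg 1+ε≥0 (∑-nonneg allPairs λ {e} _ → w≥0 (proj₁ e) (proj₂ e))) (fromℕ-nonneg 1)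

  distanceCap-large : ∀ u v → (1ℚ + ε) * w u v <ℚ distanceCap
  distanceCap-large u v = lin< (ℚₚ.+-mono-≤-< (*-mono-nonneg 1+ε≥0
      (∑-member allPairs (λ {e} _ → w≥0 (proj₁ e) (proj₂ e)) (∈-cartesianProduct⁺ (∈-allFin u) (∈-allFin v))))
      (ℚₚ.positive⁻¹ 1ℚ))
    (identity ((1ℚ + ε) * w u v) ((1ℚ + ε) * ∑ allPairs (wt w)))
    where
    identity : ∀ a b → b + 1ℚ + (a + 0ℚ) ≡ a + (b + 1ℚ)
    identity = solve-∀ ℚ-ring

theorem1 : (k : ℕ) → 1 ≤ k → (ε : ℚ) → 0ℚ <ℚ ε →
    Σ ℚ λ c →
    (n : ℕ) (G : Adj n) (w : Fin n → Fin n → ℚ) →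
    IsGraph G → Connected G → CatwidthAtMost G k →
    (∀ u v → w u v ≡ w v u) → (∀ u v → 0ℚ ≤ℚ w u v) →
    (Σ (Adj n) λ H → IsSpanner G w ε H × Light G w c H)
    × ((T : Adj n) → MinSpanningTree G w T →
    (es : List (Fin n × Fin n)) → ValidOrder G w T es →
    (H : Adj n) → Greedy w ε T es H →
    IsSpanner G w ε H × Light G w c H)
theorem1 k _ ε ε>0 = (Constants.factor cs + 1ℚ) * (1ℚ + ε) , λ n G w isGraph _ cd w-sym w≥0 →
  let ε≥0 = ℚₚ.<⇒≤ ε>0
      M≥0 = distanceCap≥0 w≥0 ε≥0
      M-large = distanceCap-large w≥0 ε≥0
      open Spanners isGraph w-sym w≥0 ε≥0 M≥0 M-large
      H , greedy = GreedySpanner.greedy-exists w-sym w≥0 ε≥0 M≥0 M-large sortedEdges (edgeList-represents noEdges-graph)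
      O = greedy-outcome noEdges-graph sortedEdges-valid greedy
  in (H , isSpanner noEdges-graph (λ _ _ ()) sortedEdges-valid O , light-from-scratch cd cs O) ,
     λ { T mst@((T⊆G , T-graph , _) , _) es valid H greedy →
       let O = greedy-outcome T-graph valid greedy
       in isSpanner T-graph T⊆G valid O , light-from-tree cd cs mst valid O }
  where
  cs : Constants (suc k ℕ.+ suc k) ε
  cs = constants (suc k ℕ.+ suc k) ε>0
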